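{- Let $k$ and $n$ be non-negative integers. (i) Let $p_1,\dots,p_{k+1}$ be primes with $p_i \equiv 2 \pmod 3$ for all $i$, and let $j$ be an integer with $p_{k+1}\nmid j$. Then $$B_{3,7} \left( p_1^2 \cdots p_k^2 p_{k+1}^2 n + \frac{p_1^2 \cdots p_k^2 p_{k+1}\left(3j+ p_{k+1}\right)-1}{3} \right) \equiv 0 \pmod3.$$ (ii) Let $p_1,\dots,p_{k+1}$ be primes with $p_i \equiv 3 \pmod 4$ for all $i$, and let $j$ be an integer with $p_{k+1}\nmid j$. Then $$B_{3,5} \left( p_1^2 \cdots p_k^2 p_{k+1}^2 n + \frac{p_1^2 \cdots p_k^2 p_{k+1}\left(4j+ p_{k+1}\right)-1}{4} \right) \equiv 0 \pmod3.$$ (iii) Let $p_1,\dots,p_{k+1}$ be odd primes with $p_i \not\equiv 1 \pmod 8$ for all $i$, and let $j$ be an integer with $p_{k+1}\nmid j$. Then $$B_{3,2} \left( p_1^2 \cdots p_k^2 p_{k+1}^2 n + \frac{p_1^2 \cdots p_k^2 p_{k+1}\left(8j+ p_{k+1}\right)-1}{8} \right) \equiv 0 \pmod 3.$$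
   Context: For integers $u,v\ge 2$, $B_{u,v}(n)$ is the number of bipartitions $(\alpha,\beta)$ of $n$ with $\alpha$ having no part divisible by $u$ and $\beta$ having no part divisible by $v$; $B_{u,v}(0)=1$ and $\sum_{n\ge0}B_{u,v}(n)q^n=\frac{f_uf_v}{f_1^2}$, $f_t=\prod_{k\ge1}(1-q^{tk})$. By convention $B_{u,v}(m)=0$ for negative $m$. -}

module Defs where

open import Data.Nat using (ℕ; zero; suc; _+_; _*_; _∸_; _/_)
open import Data.Nat.Divisibility using (_∣?_)
open import Data.List using (List; map; upTo)
open import Data.Nat.ListAction using (sum)
open import Data.Integer using (ℤ; +_; -[1+_])
open import Relation.Nullary using (yes; no)

-- partsBounded u m n : number of partitions of n into parts ≤ m,
-- no part divisible by u.  Recursion on the largest allowed part size m: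
-- choose multiplicity c of part m (0 if u ∣ m), recurse on parts ≤ m-1.
partsBounded : ℕ → ℕ → ℕ → ℕ
partsBounded u zero zero = 1
partsBounded u zero (suc n) = 0
partsBounded u (suc m) n with u ∣? suc m
... | yes _ = partsBounded u m n
... | no  _ = sum (map (λ c → partsBounded u m (n ∸ c * suc m)) (upTo (suc (n / suc m))))

partsNotDiv : ℕ → ℕ → ℕ
partsNotDiv u n = partsBounded u n n

-- B_{u,v}(n): bipartitions (α, β) of n, α with no part divisible by u,
-- β with no part divisible by v  (|α| = a, |β| = n - a)
B : ℕ → ℕ → ℕ → ℕ
B u v n = sum (map (λ a → partsNotDiv u a * partsNotDiv v (n ∸ a)) (upTo (suc n)))

Bℤ : ℕ → ℕ → ℤ → ℕ
Bℤ u v (+ n) = B u v n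
Bℤ u v -[1+ n ] = 0

{-# OPTIONS --safe #-}
module Submission where

-- Modulo 3, f₃ = f₁³, so the generating function of B_{3,v} is f₁ f_v.  The Jacobi triple product
--   ∏ (1 - q^{bi+a}) (1 - q^{bi+c}) (1 - q^{bi+b}) = Σ_k (-1)^k q^{bk(k-1)/2 + ak},   b = a + c,
-- written T(a,c), turns f₁ f_v into a theta series of a binary quadratic form:
--   f₁ f₅ = T(1,4) T(2,3)  lives on  10 (4N + 1) = x² + y²,
--   f₁ f₂ = T(1,3) T(2,2)  lives on  8N + 1 = x² + y²,
--   f₁ f₂ = T(1,2) T(2,4)  lives on  3 (8N + 1) = x² + 2y²,
--   f₁ f₇ · f₇ = T(1,6) T(2,5) T(4,3).
-- In the last product, summing the lattice ℤ³ along the direction (1,1,1) gives f₇, f₇ or 0 on each line,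
-- according to the class of k₁ + k₂ + k₃ mod 3; dividing by f₇ shows that f₁ f₇ lives on
-- 7 (3N + 1) = x² + xy + y².  In the stated progressions DN + 1 has odd p-adic valuation, for a prime p at
-- which the form is anisotropic, so the coefficient of q^N vanishes.

open import Defs

open import Algebra.Bundles using (CommutativeMonoid)

-- Every identity is proved in ℤ[[q]] / (3, q^M), with M = N + 1 when the coefficient of q^N is
-- wanted. There q is nilpotent, so infinite products and theta series become finite expressions,
-- and each 1 - q^e with e > 0 is regular; cancelling such factors replaces division. Modulo 7 the
-- nonzero residues pair up as 1+6, 2+5, 4+3. Each pair consumes one f₇ in the triple product, while
-- f₁ f₇ supplies only two: hence the extra f₇. The orientation (1, 2, 4) is chosen because 1 + 2 +
-- 4 = 7, which makes the exponents change by multiples of 7 along (1,1,1). For f₁ f₂ one form does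
-- not suffice: x² + y² is anisotropic at p ≡ 3 (mod 4), x² + 2y² at p ≡ 5 (mod 8), and only
-- together do they reach every odd class other than 1 modulo 8. Anisotropy is reduced to the
-- absence of roots modulo p, which comes not from quadratic reciprocity but from a Fermat descent
-- through all moduli, prime or not, in prescribed residue classes.

module FoldRange {c ℓ} (M : CommutativeMonoid c ℓ) where
  open CommutativeMonoid M
  open import Algebra.Properties.CommutativeSemigroup commutativeSemigroup using (interchange)
  open import Data.Nat using (ℕ; zero; suc; _<_; z<s; s<s) renaming (_+_ to _+ℕ_; _*_ to _*ℕ_)
  import Data.Nat.Properties as ℕ
  open import Function using (_∘_)
  open import Relation.Binary.PropositionalEquality as ≡ using (_≡_)
  open import Relation.Binary.Reasoning.Setoid setoid

  fold : ℕ → (ℕ → Carrier) → Carrier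
  fold zero    f = ε
  fold (suc n) f = f 0 ∙ fold n (f ∘ suc)

  fold-cong : ∀ n {f g} → (∀ i → i < n → f i ≈ g i) → fold n f ≈ fold n g
  fold-cong zero    eq = refl
  fold-cong (suc n) eq = ∙-cong (eq 0 z<s) (fold-cong n (λ i i<n → eq (suc i) (s<s i<n)))

  fold-ε : ∀ n {f} → (∀ i → i < n → f i ≈ ε) → fold n f ≈ ε
  fold-ε zero    eq = refl
  fold-ε (suc n) eq = trans (∙-cong (eq 0 z<s) (fold-ε n (λ i i<n → eq (suc i) (s<s i<n)))) (identityˡ ε)

  fold-+ : ∀ m n f → fold (m +ℕ n) f ≈ fold m f ∙ fold n (f ∘ (m +ℕ_))
  fold-+ zero    n f = sym (identityˡ _)
  fold-+ (suc m) n f = trans (∙-congˡ (fold-+ m n (f ∘ suc))) (sym (assoc _ _ _))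

  fold-last : ∀ n f → fold (suc n) f ≈ fold n f ∙ f n
  fold-last zero    f = comm _ _
  fold-last (suc n) f = trans (∙-congˡ (fold-last n (f ∘ suc))) (sym (assoc _ _ _))

  fold-∙ : ∀ n f g → fold n (λ i → f i ∙ g i) ≈ fold n f ∙ fold n g
  fold-∙ zero    f g = sym (identityˡ ε)
  fold-∙ (suc n) f g = trans (∙-congˡ (fold-∙ n (f ∘ suc) (g ∘ suc))) (interchange _ _ _ _)

  fold-swap : ∀ m n (f : ℕ → ℕ → Carrier) →
    fold m (λ i → fold n (f i)) ≈ fold n (λ j → fold m (λ i → f i j))
  fold-swap zero    n f = sym (fold-ε n (λ _ _ → refl))
  fold-swap (suc m) n f = trans (∙-congˡ (fold-swap m n (f ∘ suc))) (sym (fold-∙ n _ _))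

  fold-reverse : ∀ n f g → (∀ i j → suc (i +ℕ j) ≡ n → f i ≈ g j) → fold n f ≈ fold n g
  fold-reverse zero    f g eq = refl
  fold-reverse (suc n) f g eq = begin
    f 0 ∙ fold n (f ∘ suc) ≈⟨ ∙-cong (eq 0 n ≡.refl) (fold-reverse n _ g (λ i j e → eq (suc i) j (≡.cong suc e))) ⟩
    g n ∙ fold n g         ≈⟨ comm _ _ ⟩
    fold n g ∙ g n         ≈⟨ fold-last n g ⟨
    fold (suc n) g         ∎

  -- Sorts the indices below n d by their remainder modulo d. For products this dissects a q-product
  -- into residue classes; for sums it splits a lattice line modulo 3.
  fold-* : ∀ n d f → fold (n *ℕ d) f ≈ fold d (λ r → fold n (λ i → f (i *ℕ d +ℕ r)))
  fold-* zero    d f = sym (fold-ε d (λ _ _ → refl))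
  fold-* (suc n) d f = begin
    fold (d +ℕ n *ℕ d) f ≈⟨ fold-+ d (n *ℕ d) f ⟩
    fold d f ∙ fold (n *ℕ d) (f ∘ (d +ℕ_)) ≈⟨ ∙-congˡ (fold-* n d (f ∘ (d +ℕ_))) ⟩
    fold d f ∙ fold d (λ r → fold n (λ i → f (d +ℕ (i *ℕ d +ℕ r)))) ≈⟨ fold-∙ d _ _ ⟨
    fold d (λ r → f r ∙ fold n (λ i → f (d +ℕ (i *ℕ d +ℕ r))))
      ≈⟨ fold-cong d (λ r _ → ∙-congˡ (fold-cong n (λ i _ →
           reflexive (≡.cong f (≡.sym (ℕ.+-assoc d (i *ℕ d) r)))))) ⟩
    fold d (λ r → fold (suc n) (λ i → f (i *ℕ d +ℕ r))) ∎

-- Power series over ℤ, and their truncations modulo 3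

module Series where
  open import Data.Nat using (ℕ; zero; suc; s≤s; z≤n) renaming (_+_ to _+ℕ_; _<_ to _<ℕ_; _≤_ to _≤ℕ_)
  import Data.Nat.Properties as ℕ
  open import Data.Integer hiding (suc; _<_; _≤_; _⊖_; _≟_; NonZero)
  open import Data.Integer.Properties hiding (≡-setoid)
  open import Data.Integer.Tactic.RingSolver using (solve-∀)
  open import Data.Integer.Divisibility.Signed
  open import Data.Product using (_,_)
  open import Algebra.Bundles using (CommutativeRing)
  open import Algebra.Structures using (IsCommutativeRing)
  open import Level using (0ℓ)
  open import Function using (_∘_)
  open import Relation.Binary.PropositionalEquality
  open ≡-Reasoning

  Series : Set
  Series = ℕ → ℤ

  infixl 6 _⊕_
  infixl 7 _⊛_

  _⊕_ : Series → Series → Series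
  (f ⊕ g) n = f n + g n

  ⊖_ : Series → Series
  (⊖ f) n = - f n

  _⊛_ : Series → Series → Series
  (f ⊛ g) zero    = f 0 * g 0
  (f ⊛ g) (suc n) = f 0 * g (suc n) + ((f ∘ suc) ⊛ g) n

  𝟘 : Series
  𝟘 _ = 0ℤ

  shift : Series → Series
  shift f zero    = 0ℤ
  shift f (suc n) = f n

  X^ : ℕ → Series
  X^ zero    zero    = 1ℤ
  X^ zero    (suc n) = 0ℤ
  X^ (suc e)         = shift (X^ e)

  -- Mirror image of the defining recursion, which shifts the first factor; the induction for
  -- commutativity alternates between the two.
  ⊛-sucʳ : ∀ f g n → (f ⊛ g) (suc n) ≡ f (suc n) * g 0 + (f ⊛ (g ∘ suc)) n
  ⊛-sucʳ f g zero    = +-comm (f 0 * g 1) _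
  ⊛-sucʳ f g (suc n) = begin
    f 0 * g (suc (suc n)) + ((f ∘ suc) ⊛ g) (suc n)
      ≡⟨ cong (λ z → f 0 * g (suc (suc n)) + z) (⊛-sucʳ (f ∘ suc) g n) ⟩
    f 0 * g (suc (suc n)) + (f (suc (suc n)) * g 0 + ((f ∘ suc) ⊛ (g ∘ suc)) n)
      ≡⟨ rearrange (f 0 * g (suc (suc n))) (f (suc (suc n)) * g 0) _ ⟩
    f (suc (suc n)) * g 0 + (f ⊛ (g ∘ suc)) (suc n) ∎
    where
    rearrange : ∀ a b c → a + (b + c) ≡ b + (a + c)
    rearrange = solve-∀

  ⊛-comm : ∀ f g n → (f ⊛ g) n ≡ (g ⊛ f) n
  ⊛-comm f g zero    = *-comm (f 0) (g 0)
  ⊛-comm f g (suc n) = begin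
    f 0 * g (suc n) + ((f ∘ suc) ⊛ g) n ≡⟨ cong₂ _+_ (*-comm (f 0) _) (⊛-comm (f ∘ suc) g n) ⟩
    g (suc n) * f 0 + (g ⊛ (f ∘ suc)) n ≡⟨ ⊛-sucʳ g f n ⟨
    (g ⊛ f) (suc n) ∎

  ⊛-distribʳ : ∀ h f g n → ((f ⊕ g) ⊛ h) n ≡ (f ⊛ h ⊕ g ⊛ h) n
  ⊛-distribʳ h f g zero    = *-distribʳ-+ (h 0) (f 0) (g 0)
  ⊛-distribʳ h f g (suc n) =
    trans (cong (λ z → (f 0 + g 0) * h (suc n) + z) (⊛-distribʳ h (f ∘ suc) (g ∘ suc) n))
          (rearrange (f 0) (g 0) (h (suc n)) _ _)
    where
    rearrange : ∀ a b c x y → (a + b) * c + (x + y) ≡ a * c + x + (b * c + y)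
    rearrange = solve-∀

  ⊛-scaleˡ : ∀ c f g n → ((λ i → c * f i) ⊛ g) n ≡ c * (f ⊛ g) n
  ⊛-scaleˡ c f g zero    = *-assoc c _ _
  ⊛-scaleˡ c f g (suc n) =
    trans (cong (λ z → c * f 0 * g (suc n) + z) (⊛-scaleˡ c (f ∘ suc) g n)) (rearrange c (f 0) (g (suc n)) _)
    where
    rearrange : ∀ c a b x → c * a * b + c * x ≡ c * (a * b + x)
    rearrange = solve-∀

  ⊛-assoc : ∀ f g h n → ((f ⊛ g) ⊛ h) n ≡ (f ⊛ (g ⊛ h)) n
  ⊛-assoc f g h zero    = *-assoc (f 0) _ _
  ⊛-assoc f g h (suc n) = begin
    f 0 * g 0 * h (suc n) + (((λ i → f 0 * g (suc i)) ⊕ ((f ∘ suc) ⊛ g)) ⊛ h) n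
      ≡⟨ cong (λ z → f 0 * g 0 * h (suc n) + z) (⊛-distribʳ h _ ((f ∘ suc) ⊛ g) n) ⟩
    f 0 * g 0 * h (suc n) + (((λ i → f 0 * g (suc i)) ⊛ h) n + (((f ∘ suc) ⊛ g) ⊛ h) n)
      ≡⟨ cong (λ z → f 0 * g 0 * h (suc n) + z)
           (cong₂ _+_ (⊛-scaleˡ (f 0) (g ∘ suc) h n) (⊛-assoc (f ∘ suc) g h n)) ⟩
    f 0 * g 0 * h (suc n) + (f 0 * ((g ∘ suc) ⊛ h) n + ((f ∘ suc) ⊛ (g ⊛ h)) n)
      ≡⟨ rearrange (f 0) (g 0) (h (suc n)) _ _ ⟩
    f 0 * (g ⊛ h) (suc n) + ((f ∘ suc) ⊛ (g ⊛ h)) n ∎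
    where
    rearrange : ∀ a b c x y → a * b * c + (a * x + y) ≡ a * (b * c + x) + y
    rearrange = solve-∀

  ⊛-zeroˡ : ∀ f n → (𝟘 ⊛ f) n ≡ 0ℤ
  ⊛-zeroˡ f zero    = refl
  ⊛-zeroˡ f (suc n) = trans (+-identityˡ _) (⊛-zeroˡ f n)

  ⊛-identityˡ : ∀ f n → (X^ 0 ⊛ f) n ≡ f n
  ⊛-identityˡ f zero    = *-identityˡ (f 0)
  ⊛-identityˡ f (suc n) = trans (cong₂ _+_ (*-identityˡ (f (suc n))) (⊛-zeroˡ f n)) (+-identityʳ _)

  shift-⊛ : ∀ f g n → (shift f ⊛ g) n ≡ shift (f ⊛ g) n
  shift-⊛ f g zero    = refl
  shift-⊛ f g (suc n) = +-identityˡ _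

  shift-cong : ∀ {f g} → (∀ n → f n ≡ g n) → ∀ n → shift f n ≡ shift g n
  shift-cong p zero    = refl
  shift-cong p (suc n) = p n

  X^-+ : ∀ d e n → X^ (d +ℕ e) n ≡ (X^ d ⊛ X^ e) n
  X^-+ zero    e n = sym (⊛-identityˡ (X^ e) n)
  X^-+ (suc d) e n = trans (shift-cong (X^-+ d e) n) (sym (shift-⊛ (X^ d) (X^ e) n))

  X^-⊛-< : ∀ e f {n} → n <ℕ e → (X^ e ⊛ f) n ≡ 0ℤ
  X^-⊛-< (suc e) f {zero}  _         = refl
  X^-⊛-< (suc e) f {suc n} (s≤s n<e) = trans (shift-⊛ (X^ e) f (suc n)) (X^-⊛-< e f n<e)

  X^-⊛-+ : ∀ e f n → (X^ e ⊛ f) (e +ℕ n) ≡ f n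
  X^-⊛-+ zero    f n = ⊛-identityˡ f n
  X^-⊛-+ (suc e) f n = trans (shift-⊛ (X^ e) f (suc (e +ℕ n))) (X^-⊛-+ e f n)

  X^-≢ : ∀ e n → e ≢ n → X^ e n ≡ 0ℤ
  X^-≢ zero    zero    e≢n with () ← e≢n refl
  X^-≢ zero    (suc n) e≢n = refl
  X^-≢ (suc e) zero    e≢n = refl
  X^-≢ (suc e) (suc n) e≢n = X^-≢ e n (e≢n ∘ cong suc)

  infix 4 _≡₃_
  record _≡₃_ (a b : ℤ) : Set where
    constructor mod₃
    field divides-diff : + 3 ∣ a - b
  open _≡₃_ public

  ≡⇒≡₃ : ∀ {a b} → a ≡ b → a ≡₃ b
  ≡⇒≡₃ {a} refl = mod₃ (divides 0ℤ (+-inverseʳ a))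

  ≡₃-sym : ∀ {a b} → a ≡₃ b → b ≡₃ a
  ≡₃-sym {a} {b} (mod₃ d) = mod₃ (subst (+ 3 ∣_) (eq a b) (∣m⇒∣-m d))
    where
    eq : ∀ a b → - (a - b) ≡ b - a
    eq = solve-∀

  ≡₃-trans : ∀ {a b c} → a ≡₃ b → b ≡₃ c → a ≡₃ c
  ≡₃-trans {a} {b} {c} (mod₃ d) (mod₃ e) = mod₃ (subst (+ 3 ∣_) (eq a b c) (∣m∣n⇒∣m+n d e))
    where
    eq : ∀ a b c → a - b + (b - c) ≡ a - c
    eq = solve-∀

  ≡₃-+ : ∀ {a b c d} → a ≡₃ b → c ≡₃ d → a + c ≡₃ b + d
  ≡₃-+ {a} {b} {c} {d} (mod₃ x) (mod₃ y) = mod₃ (subst (+ 3 ∣_) (eq a b c d) (∣m∣n⇒∣m+n x y))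
    where
    eq : ∀ a b c d → a - b + (c - d) ≡ a + c - (b + d)
    eq = solve-∀

  ≡₃-* : ∀ {a b c d} → a ≡₃ b → c ≡₃ d → a * c ≡₃ b * d
  ≡₃-* {a} {b} {c} {d} (mod₃ x) (mod₃ y) =
    mod₃ (subst (+ 3 ∣_) (eq a b c d) (∣m∣n⇒∣m+n (∣m⇒∣m*n c x) (∣n⇒∣m*n b y)))
    where
    eq : ∀ a b c d → (a - b) * c + b * (c - d) ≡ a * c - b * d
    eq = solve-∀

  ≡₃-neg : ∀ {a b} → a ≡₃ b → - a ≡₃ - b
  ≡₃-neg {a} {b} (mod₃ d) = mod₃ (subst (+ 3 ∣_) (eq a b) (∣m⇒∣-m d))
    where
    eq : ∀ a b → - (a - b) ≡ - a - - b
    eq = solve-∀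

  -- ℤ[[q]] / (3 , q^M)
  module Truncated (M : ℕ) where

    infix 4 _≈_
    record _≈_ (f g : Series) : Set where
      constructor mk≈
      field coeff≈ : ∀ n → n <ℕ M → f n ≡₃ g n
    open _≈_ public

    ≐⇒≈ : ∀ {f g} → (∀ n → f n ≡ g n) → f ≈ g
    ≐⇒≈ p = mk≈ (λ n _ → ≡⇒≡₃ (p n))

    ⊛-cong≡₃ : ∀ n {f f′ g g′} → (∀ i → i ≤ℕ n → f i ≡₃ f′ i) → (∀ i → i ≤ℕ n → g i ≡₃ g′ i) →
      (f ⊛ g) n ≡₃ (f′ ⊛ g′) n
    ⊛-cong≡₃ zero    p q = ≡₃-* (p 0 z≤n) (q 0 z≤n)
    ⊛-cong≡₃ (suc n) p q = ≡₃-+ (≡₃-* (p 0 z≤n) (q (suc n) ℕ.≤-refl))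
      (⊛-cong≡₃ n (λ i i≤n → p (suc i) (s≤s i≤n)) (λ i i≤n → q i (ℕ.m≤n⇒m≤1+n i≤n)))

    isCommutativeRing : IsCommutativeRing _≈_ _⊕_ _⊛_ ⊖_ 𝟘 (X^ 0)
    isCommutativeRing = record
      { isRing = record
        { +-isAbelianGroup = record
          { isGroup = record
            { isMonoid = record
              { isSemigroup = record
                { isMagma = record
                  { isEquivalence = record
                    { refl  = ≐⇒≈ (λ _ → refl)
                    ; sym   = λ (mk≈ p) → mk≈ (λ n l → ≡₃-sym (p n l))
                    ; trans = λ (mk≈ p) (mk≈ q) → mk≈ (λ n l → ≡₃-trans (p n l) (q n l))
                    }
                  ; ∙-cong = λ (mk≈ p) (mk≈ q) → mk≈ (λ n l → ≡₃-+ (p n l) (q n l))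
                  }
                ; assoc = λ f g h → ≐⇒≈ (λ n → +-assoc (f n) (g n) (h n))
                }
              ; identity = (λ f → ≐⇒≈ (λ n → +-identityˡ (f n))) , (λ f → ≐⇒≈ (λ n → +-identityʳ (f n)))
              }
            ; inverse = (λ f → ≐⇒≈ (λ n → +-inverseˡ (f n))) , (λ f → ≐⇒≈ (λ n → +-inverseʳ (f n)))
            ; ⁻¹-cong = λ (mk≈ p) → mk≈ (λ n l → ≡₃-neg (p n l))
            }
          ; comm = λ f g → ≐⇒≈ (λ n → +-comm (f n) (g n))
          }
        ; *-cong = λ (mk≈ p) (mk≈ q) → mk≈ (λ n l → ⊛-cong≡₃ n
            (λ i i≤n → p i (ℕ.≤-<-trans i≤n l)) (λ i i≤n → q i (ℕ.≤-<-trans i≤n l)))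
        ; *-assoc = λ f g h → ≐⇒≈ (⊛-assoc f g h)
        ; *-identity = (λ f → ≐⇒≈ (⊛-identityˡ f))
                     , (λ f → ≐⇒≈ (λ n → trans (⊛-comm f (X^ 0) n) (⊛-identityˡ f n)))
        ; distrib = (λ h f g → ≐⇒≈ (λ n → trans (⊛-comm h (f ⊕ g) n)
                        (trans (⊛-distribʳ h f g n) (cong₂ _+_ (⊛-comm f h n) (⊛-comm g h n)))))
                  , (λ h f g → ≐⇒≈ (⊛-distribʳ h f g))
        }
      ; *-comm = λ f g → ≐⇒≈ (⊛-comm f g)
      }

    ring : CommutativeRing 0ℓ 0ℓ
    ring = record { isCommutativeRing = isCommutativeRing }

    X^-high : ∀ e → M ≤ℕ e → X^ e ≈ 𝟘
    X^-high e M≤e = mk≈ (λ n n<M → ≡⇒≡₃ (X^-≢ e n (ℕ.>⇒≢ (ℕ.<-≤-trans n<M M≤e))))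

    1+1+1≈0 : (X^ 0 ⊕ X^ 0) ⊕ X^ 0 ≈ 𝟘
    1+1+1≈0 = mk≈ λ where
      zero    _ → mod₃ (divides 1ℤ refl)
      (suc n) _ → mod₃ (divides 0ℤ refl)

-- Exponents of theta series

module ThetaExponent where
  open import Data.Nat using (ℕ; zero; suc; NonZero; _≤_; _<_) renaming (_+_ to _+ℕ_; _*_ to _*ℕ_)
  import Data.Nat.Properties as ℕ
  open import Data.Integer hiding (suc; _≤_; _<_; NonZero)
  open import Data.Integer.Properties
  open import Data.Integer.Tactic.RingSolver using (solve-∀)
  open import Data.Product using (∃; ∃₂; _×_)
  open import Relation.Binary.PropositionalEquality
  open ≡-Reasoning

  -- The binomial coefficient n over 2. At k = -m the theta exponent equals c m + (a + c) m (m - 1)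
  -- / 2, so both signs of k can be written with it inside ℕ.
  tri : ℕ → ℕ
  tri zero    = 0
  tri (suc n) = n +ℕ tri n

  -- (a + c) k (k - 1) / 2 + a k
  θ-exp : ℕ → ℕ → ℤ → ℕ
  θ-exp a c (+ n)    = a *ℕ n +ℕ (a +ℕ c) *ℕ tri n
  θ-exp a c -[1+ n ] = c *ℕ suc n +ℕ (a +ℕ c) *ℕ tri (suc n)

  2*tri : ∀ n → + 2 * + tri n ≡ + n * (+ n - + 1)
  2*tri zero    = refl
  2*tri (suc n) = begin
    + 2 * (+ n + + tri n)         ≡⟨ *-distribˡ-+ (+ 2) (+ n) (+ tri n) ⟩
    + 2 * + n + + 2 * + tri n     ≡⟨ cong (λ t → + 2 * + n + t) (2*tri n) ⟩
    + 2 * + n + + n * (+ n - + 1) ≡⟨ rearrange (+ n) ⟩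
    (+ 1 + + n) * (+ 1 + + n - + 1) ∎
    where
    rearrange : ∀ n → + 2 * n + n * (n - + 1) ≡ (+ 1 + n) * (+ 1 + n - + 1)
    rearrange = solve-∀

  cast-linear : ∀ x n y t → + (x *ℕ n +ℕ y *ℕ t) ≡ + x * + n + + y * + t
  cast-linear x n y t = cong₂ _+_ (pos-* x n) (pos-* y t)

  -- Twice the theta exponent. Doubling clears the denominator, so relations between exponents
  -- become polynomial identities over ℤ, and `halve` returns to ℕ.
  quad : ℤ → ℤ → ℤ → ℤ
  quad a c k = (a + c) * (k * (k - + 1)) + + 2 * (a * k)

  2*θ-exp : ∀ a c k → + 2 * + θ-exp a c k ≡ quad (+ a) (+ c) k
  2*θ-exp a c (+ n) = begin
    + 2 * + (a *ℕ n +ℕ (a +ℕ c) *ℕ tri n)         ≡⟨ cong (+ 2 *_) (cast-linear a n (a +ℕ c) (tri n)) ⟩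
    + 2 * (+ a * + n + (+ a + + c) * + tri n)     ≡⟨ expand (+ a) (+ c) (+ n) (+ tri n) ⟩
    (+ a + + c) * (+ 2 * + tri n) + + 2 * (+ a * + n) ≡⟨ cong (λ t → (+ a + + c) * t + + 2 * (+ a * + n)) (2*tri n) ⟩
    (+ a + + c) * (+ n * (+ n - + 1)) + + 2 * (+ a * + n) ∎
    where
    expand : ∀ a c n t → + 2 * (a * n + (a + c) * t) ≡ (a + c) * (+ 2 * t) + + 2 * (a * n)
    expand = solve-∀
  2*θ-exp a c -[1+ n ] = begin
    + 2 * + (c *ℕ suc n +ℕ (a +ℕ c) *ℕ tri (suc n))   ≡⟨ cong (+ 2 *_) (cast-linear c (suc n) (a +ℕ c) (tri (suc n))) ⟩
    + 2 * (+ c * m + (+ a + + c) * + tri (suc n))     ≡⟨ expand (+ a) (+ c) m (+ tri (suc n)) ⟩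
    (+ a + + c) * (+ 2 * + tri (suc n)) + + 2 * (+ c * m) ≡⟨ cong (λ t → (+ a + + c) * t + + 2 * (+ c * m)) (2*tri (suc n)) ⟩
    (+ a + + c) * (m * (m - + 1)) + + 2 * (+ c * m)   ≡⟨ negate (+ a) (+ c) m ⟩
    (+ a + + c) * (- m * (- m - + 1)) + + 2 * (+ a * - m) ∎
    where
    m = + suc n
    expand : ∀ a c n t → + 2 * (c * n + (a + c) * t) ≡ (a + c) * (+ 2 * t) + + 2 * (c * n)
    expand = solve-∀
    negate : ∀ a c m → (a + c) * (m * (m - + 1)) + + 2 * (c * m) ≡ (a + c) * (- m * (- m - + 1)) + + 2 * (a * - m)
    negate = solve-∀

  halve : ∀ {x y : ℕ} → + 2 * + x ≡ + 2 * + y → x ≡ y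
  halve eq = +-injective (*-cancelˡ-≡ (+ 2) _ _ eq)

  -- This confines a theta series modulo q^M to |k| < M. Both a and c must be positive: for c = 0
  -- the exponents at k = 0 and k = -1 are both 0.
  ∣k∣≤θ-exp : ∀ a c .{{_ : NonZero a}} .{{_ : NonZero c}} k → ∣ k ∣ ≤ θ-exp a c k
  ∣k∣≤θ-exp a c (+ n)    = ℕ.≤-trans (ℕ.m≤n*m n a) (ℕ.m≤m+n _ _)
  ∣k∣≤θ-exp a c -[1+ n ] = ℕ.≤-trans (ℕ.m≤n*m (suc n) c) (ℕ.m≤m+n _ _)

  -- The exponent grows by a + b k from k to k + 1, where b = a + c. At k = j - l - 1 the part b j
  -- is moved to the left, where the Gaussian coefficient supplies it; the remainder c + b l no
  -- longer depends on j, so it factors out of the sum. `θ-exp-raise` does the same at the other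
  -- end.
  θ-exp-lower : ∀ a c l j → θ-exp a c (- + suc l + + j) +ℕ (a +ℕ c) *ℕ j ≡ (c +ℕ (a +ℕ c) *ℕ l) +ℕ θ-exp a c (- + l + + j)
  θ-exp-lower a c l j = halve (begin
    + 2 * (+ θ-exp a c k₁ + + ((a +ℕ c) *ℕ j))
      ≡⟨ cong (λ t → + 2 * (+ θ-exp a c k₁ + t)) (pos-* (a +ℕ c) j) ⟩
    + 2 * (+ θ-exp a c k₁ + (+ a + + c) * + j)
      ≡⟨ *-distribˡ-+ (+ 2) (+ θ-exp a c k₁) _ ⟩
    + 2 * + θ-exp a c k₁ + + 2 * ((+ a + + c) * + j)
      ≡⟨ cong (λ t → t + + 2 * ((+ a + + c) * + j)) (2*θ-exp a c k₁) ⟩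
    (+ a + + c) * (k₁ * (k₁ - + 1)) + + 2 * (+ a * k₁) + + 2 * ((+ a + + c) * + j)
      ≡⟨ identity (+ a) (+ c) (+ l) (+ j) ⟩
    + 2 * (+ c + (+ a + + c) * + l) + ((+ a + + c) * (k * (k - + 1)) + + 2 * (+ a * k))
      ≡⟨ cong₂ (λ s t → + 2 * (+ c + s) + t) (pos-* (a +ℕ c) l) (2*θ-exp a c k) ⟨
    + 2 * (+ c + + ((a +ℕ c) *ℕ l)) + + 2 * + θ-exp a c k
      ≡⟨ *-distribˡ-+ (+ 2) (+ c + + ((a +ℕ c) *ℕ l)) _ ⟨
    + 2 * (+ c + + ((a +ℕ c) *ℕ l) + + θ-exp a c k) ∎)
    where
    k₁ = - + suc l + + j
    k = - + l + + j
    identity : ∀ a c l j →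
      (a + c) * ((- (+ 1 + l) + j) * (- (+ 1 + l) + j - + 1)) + + 2 * (a * (- (+ 1 + l) + j)) + + 2 * ((a + c) * j)
      ≡ + 2 * (c + (a + c) * l) + ((a + c) * ((- l + j) * (- l + j - + 1)) + + 2 * (a * (- l + j)))
    identity = solve-∀

  θ-exp-raise : ∀ a c m l i j → j +ℕ i ≡ m +ℕ l →
    θ-exp a c (- + l + + suc j) +ℕ (a +ℕ c) *ℕ i ≡ (a +ℕ (a +ℕ c) *ℕ m) +ℕ θ-exp a c (- + l + + j)
  θ-exp-raise a c m l i j j+i≡m+l = halve (begin
    + 2 * (+ θ-exp a c k₁ + + ((a +ℕ c) *ℕ i))
      ≡⟨ cong (λ t → + 2 * (+ θ-exp a c k₁ + t)) (pos-* (a +ℕ c) i) ⟩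
    + 2 * (+ θ-exp a c k₁ + (+ a + + c) * + i)
      ≡⟨ *-distribˡ-+ (+ 2) (+ θ-exp a c k₁) _ ⟩
    + 2 * + θ-exp a c k₁ + + 2 * ((+ a + + c) * + i)
      ≡⟨ cong (λ t → t + + 2 * ((+ a + + c) * + i)) (2*θ-exp a c k₁) ⟩
    (+ a + + c) * (k₁ * (k₁ - + 1)) + + 2 * (+ a * k₁) + + 2 * ((+ a + + c) * + i)
      ≡⟨ identity (+ a) (+ c) (+ l) (+ i) (+ j) ⟩
    + 2 * (+ a + (+ a + + c) * (+ (j +ℕ i) - + l)) + ((+ a + + c) * (k * (k - + 1)) + + 2 * (+ a * k))
      ≡⟨ cong (λ t → + 2 * (+ a + (+ a + + c) * (+ t - + l)) + ((+ a + + c) * (k * (k - + 1)) + + 2 * (+ a * k))) j+i≡m+l ⟩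
    + 2 * (+ a + (+ a + + c) * (+ m + + l - + l)) + ((+ a + + c) * (k * (k - + 1)) + + 2 * (+ a * k))
      ≡⟨ cong (λ t → + 2 * (+ a + (+ a + + c) * t) + ((+ a + + c) * (k * (k - + 1)) + + 2 * (+ a * k))) (cancel (+ m) (+ l)) ⟩
    + 2 * (+ a + (+ a + + c) * + m) + ((+ a + + c) * (k * (k - + 1)) + + 2 * (+ a * k))
      ≡⟨ cong₂ (λ s t → + 2 * (+ a + s) + t) (pos-* (a +ℕ c) m) (2*θ-exp a c k) ⟨
    + 2 * (+ a + + ((a +ℕ c) *ℕ m)) + + 2 * + θ-exp a c k
      ≡⟨ *-distribˡ-+ (+ 2) (+ a + + ((a +ℕ c) *ℕ m)) _ ⟨
    + 2 * (+ a + + ((a +ℕ c) *ℕ m) + + θ-exp a c k) ∎)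
    where
    k₁ = - + l + + suc j
    k = - + l + + j
    cancel : ∀ m l → m + l - l ≡ m
    cancel = solve-∀
    identity : ∀ a c l i j →
      (a + c) * ((- l + (+ 1 + j)) * (- l + (+ 1 + j) - + 1)) + + 2 * (a * (- l + (+ 1 + j))) + + 2 * ((a + c) * i)
      ≡ + 2 * (a + (a + c) * (j + i - l)) + ((a + c) * ((- l + j) * (- l + j - + 1)) + + 2 * (a * (- l + j)))
    identity = solve-∀

  -- Moving by w (1,1,1) adds three copies of 7 w (w - 1) / 2, the cross term 7 w (k₁ + k₂ + k₃) = 7
  -- r w, and the linear term (1 + 2 + 4) w. Together these are a theta exponent of base 21 = 7 (1 +
  -- r) + 7 s with linear coefficient 7 (1 + r).
  θ-exp-diagonal : ∀ r s α β w → r +ℕ s ≡ 2 →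
    θ-exp 1 6 (α + w) +ℕ (θ-exp 2 5 (β + w) +ℕ θ-exp 4 3 (+ r - α - β + w))
    ≡ θ-exp 1 6 α +ℕ (θ-exp 2 5 β +ℕ θ-exp 4 3 (+ r - α - β)) +ℕ θ-exp (7 *ℕ suc r) (7 *ℕ s) w
  θ-exp-diagonal r s α β w r+s≡2 = halve (begin
    + 2 * (+ e₁ + (+ e₂ + + e₃))
      ≡⟨ expand (+ e₁) (+ e₂) (+ e₃) ⟩
    + 2 * + e₁ + (+ 2 * + e₂ + + 2 * + e₃)
      ≡⟨ cong₂ _+_ (2*θ-exp 1 6 (α + w)) (cong₂ _+_ (2*θ-exp 2 5 (β + w)) (2*θ-exp 4 3 (+ r - α - β + w))) ⟩
    quad (+ 1) (+ 6) (α + w) + (quad (+ 2) (+ 5) (β + w) + quad (+ 4) (+ 3) (+ r - α - β + w))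
      ≡⟨ identity (+ r) α β w ⟩
    quad (+ 1) (+ 6) α + (quad (+ 2) (+ 5) β + quad (+ 4) (+ 3) (+ r - α - β)) + along (+ 2)
      ≡⟨ cong₂ _+_ (cong₂ _+_ (2*θ-exp 1 6 α) (cong₂ _+_ (2*θ-exp 2 5 β) (2*θ-exp 4 3 (+ r - α - β)))) 2*d₄ ⟨
    + 2 * + d₁ + (+ 2 * + d₂ + + 2 * + d₃) + + 2 * + d₄
      ≡⟨ collapse (+ d₁) (+ d₂) (+ d₃) (+ d₄) ⟩
    + 2 * (+ d₁ + (+ d₂ + + d₃) + + d₄) ∎)
    where
    e₁ = θ-exp 1 6 (α + w)
    e₂ = θ-exp 2 5 (β + w)
    e₃ = θ-exp 4 3 (+ r - α - β + w)
    d₁ = θ-exp 1 6 α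
    d₂ = θ-exp 2 5 β
    d₃ = θ-exp 4 3 (+ r - α - β)
    d₄ = θ-exp (7 *ℕ suc r) (7 *ℕ s) w
    along : ℤ → ℤ
    along t = (+ 7 + + 7 * t) * (w * (w - + 1)) + + 2 * (+ 7 * (+ 1 + + r) * w)
    expand : ∀ x y z → + 2 * (x + (y + z)) ≡ + 2 * x + (+ 2 * y + + 2 * z)
    expand = solve-∀
    collapse : ∀ x y z t → + 2 * x + (+ 2 * y + + 2 * z) + + 2 * t ≡ + 2 * (x + (y + z) + t)
    collapse = solve-∀
    collect : ∀ r s w → (+ 7 + + 7 * (r + s)) * (w * (w - + 1)) + + 2 * (+ 7 * (+ 1 + r) * w)
      ≡ (+ 7 * (+ 1 + r) + + 7 * s) * (w * (w - + 1)) + + 2 * (+ 7 * (+ 1 + r) * w)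
    collect = solve-∀
    2*d₄ : + 2 * + d₄ ≡ along (+ 2)
    2*d₄ = begin
      + 2 * + d₄ ≡⟨ 2*θ-exp (7 *ℕ suc r) (7 *ℕ s) w ⟩
      quad (+ (7 *ℕ suc r)) (+ (7 *ℕ s)) w ≡⟨ cong₂ (λ a c → quad a c w) (pos-* 7 (suc r)) (pos-* 7 s) ⟩
      quad (+ 7 * + suc r) (+ 7 * + s) w ≡⟨ collect (+ r) (+ s) w ⟨
      along (+ (r +ℕ s)) ≡⟨ cong (λ t → along (+ t)) r+s≡2 ⟩
      along (+ 2) ∎
    identity : ∀ r α β w →
      (+ 1 + + 6) * ((α + w) * (α + w - + 1)) + + 2 * (+ 1 * (α + w))
      + ((+ 2 + + 5) * ((β + w) * (β + w - + 1)) + + 2 * (+ 2 * (β + w))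
      + ((+ 4 + + 3) * ((r - α - β + w) * (r - α - β + w - + 1)) + + 2 * (+ 4 * (r - α - β + w))))
      ≡ (+ 1 + + 6) * (α * (α - + 1)) + + 2 * (+ 1 * α)
      + ((+ 2 + + 5) * (β * (β - + 1)) + + 2 * (+ 2 * β)
      + ((+ 4 + + 3) * ((r - α - β) * (r - α - β - + 1)) + + 2 * (+ 4 * (r - α - β))))
      + ((+ 7 + + 7 * + 2) * (w * (w - + 1)) + + 2 * (+ 7 * (+ 1 + r) * w))
    identity = solve-∀

  -- For c = 0 the exponent is a k (k + 1) / 2, symmetric about k = -1/2.
  θ-exp-mirror : ∀ a k → θ-exp a 0 (- + 1 - k) ≡ θ-exp a 0 k
  θ-exp-mirror a k = halve (begin
    + 2 * + θ-exp a 0 (- + 1 - k) ≡⟨ 2*θ-exp a 0 (- + 1 - k) ⟩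
    quad (+ a) (+ 0) (- + 1 - k)  ≡⟨ identity (+ a) k ⟩
    quad (+ a) (+ 0) k            ≡⟨ 2*θ-exp a 0 k ⟨
    + 2 * + θ-exp a 0 k ∎)
    where
    identity : ∀ a k → (a + + 0) * ((- + 1 - k) * (- + 1 - k - + 1)) + + 2 * (a * (- + 1 - k))
      ≡ (a + + 0) * (k * (k - + 1)) + + 2 * (a * k)
    identity = solve-∀

  TwoTheta : (a c a′ c′ : ℕ) → ℕ → Set
  TwoTheta a c a′ c′ e = ∃₂ λ k k′ → e ≡ θ-exp a c k +ℕ θ-exp a′ c′ k′

  -- The triples (α, β, r - α - β) form the plane k₁ + k₂ + k₃ = r in ℤ³, a translate of the A₂
  -- lattice. Only r = 0 and r = 1 occur, since the lines of class 2 sum to 0.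
  Hexagonal : ℕ → Set
  Hexagonal e = ∃ λ r → r < 2 × ∃₂ λ α β → e ≡ θ-exp 1 6 α +ℕ (θ-exp 2 5 β +ℕ θ-exp 4 3 (+ r - α - β))

-- q-products in a ring where q is nilpotent and 3 = 0

module TruncatedPowerRings where
  open import Algebra.Bundles using (CommutativeRing)
  open import Level using (0ℓ)
  open import Data.Nat as ℕ using (ℕ; zero; suc; NonZero; _≤_; _<_) renaming (_+_ to _+ℕ_; _*_ to _*ℕ_)
  open ThetaExponent

  -- All that the product identities need from ℤ[[q]] / (3, q^M); coefficients are hidden until the
  -- final comparison.
  record TruncatedPowers : Set₁ where
    field
      ring : CommutativeRing 0ℓ 0ℓ
    open CommutativeRing ring
    field
      q^     : ℕ → Carrier
      q^0    : q^ 0 ≈ 1#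
      q^-+   : ∀ d e → q^ (d +ℕ e) ≈ q^ d * q^ e
      order  : ℕ
      q^-high : ∀ e → order ≤ e → q^ e ≈ 0#
      char3  : 1# + 1# + 1# ≈ 0#

  module Theta (T : TruncatedPowers) where
    open TruncatedPowers T renaming (order to M; ring to R)
    open CommutativeRing R
    open import Algebra.Properties.Ring ring using (-‿distribˡ-*; -‿distribʳ-*)
    open import Algebra.Properties.AbelianGroup +-abelianGroup using ()
      renaming (x∙y⁻¹≈ε⇒x≈y to x-y≈0⇒x≈y; x≈y⇒x∙y⁻¹≈ε to x≈y⇒x-y≈0; ⁻¹-involutive to -‿involutive; ε⁻¹≈ε to -0≈0)
    open import Algebra.Solver.Ring.NaturalCoefficients.Default commutativeSemiring using (solve; _:+_; _:*_; _:=_; con)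
    open import Relation.Binary.Reasoning.Setoid setoid
    open import Data.Integer using (ℤ; +_; -[1+_]; ∣_∣; +≤+; -≤+) renaming (_+_ to _+ℤ_; -_ to -ℤ_; _≤_ to _≤ℤ_; _-_ to _-ℤ_)
    import Data.Integer.Properties as ℤ
    open import Data.Integer.Tactic.RingSolver using (solve-∀)
    open import Data.Nat.Tactic.RingSolver using () renaming (solve-∀ to solveℕ-∀)
    import Data.Nat.Properties as ℕ
    open import Data.Product using (∃; _,_; _×_)
    open import Data.Sum using (_⊎_; inj₁; inj₂)
    open import Function using (_∘_)
    open import Relation.Nullary using (yes; no)
    open import Relation.Binary.PropositionalEquality as ≡ using (_≡_)
    module Σ = FoldRange +-commutativeMonoid
    module Π = FoldRange *-commutativeMonoid

    ∑ ∏ : ℕ → (ℕ → Carrier) → Carrier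
    ∑ = Σ.fold
    ∏ = Π.fold

    ∑-*ˡ : ∀ n x f → ∑ n (λ i → x * f i) ≈ x * ∑ n f
    ∑-*ˡ zero    x f = sym (zeroʳ x)
    ∑-*ˡ (suc n) x f = trans (+-congˡ (∑-*ˡ n x (f ∘ suc))) (sym (distribˡ x _ _))

    ∑-*ʳ : ∀ n x f → ∑ n (λ i → f i * x) ≈ ∑ n f * x
    ∑-*ʳ n x f = trans (Σ.fold-cong n (λ i _ → *-comm (f i) x)) (trans (∑-*ˡ n x f) (*-comm x _))

    Regular : Carrier → Set
    Regular x = ∀ y → x * y ≈ 0# → y ≈ 0#

    cancel : ∀ {x y z} → Regular x → x * y ≈ x * z → y ≈ z
    cancel {x} {y} {z} reg eq = x-y≈0⇒x≈y y z (reg (y + - z) (begin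
      x * (y + - z)     ≈⟨ distribˡ x y (- z) ⟩
      x * y + x * - z   ≈⟨ +-congˡ (-‿distribʳ-* x z) ⟨
      x * y + - (x * z) ≈⟨ x≈y⇒x-y≈0 eq ⟩
      0#                ∎))

    *-regular : ∀ {x y} → Regular x → Regular y → Regular (x * y)
    *-regular rx ry z eq = ry z (rx _ (trans (sym (*-assoc _ _ _)) eq))

    ∏-regular : ∀ n {f} → (∀ i → Regular (f i)) → Regular (∏ n f)
    ∏-regular zero    r y eq = trans (sym (*-identityˡ y)) eq
    ∏-regular (suc n) r      = *-regular (r 0) (∏-regular n (r ∘ suc))

    1-q^ : ℕ → Carrier
    1-q^ e = 1# + - q^ e

    -- A fixed point of multiplication by q^e is fixed by every q^(k e), and high powers of q vanish.
    fixed⇒0 : ∀ e .{{_ : NonZero e}} {x} → x ≈ q^ e * x → x ≈ 0#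
    fixed⇒0 e {x} fix = trans (power M) (trans (*-congʳ (q^-high (M *ℕ e) (ℕ.m≤m*n M e))) (zeroˡ x))
      where
      power : ∀ k → x ≈ q^ (k *ℕ e) * x
      power zero    = trans (sym (*-identityˡ x)) (*-congʳ (sym q^0))
      power (suc k) = begin
        x                             ≈⟨ fix ⟩
        q^ e * x                      ≈⟨ *-congˡ (power k) ⟩
        q^ e * (q^ (k *ℕ e) * x)      ≈⟨ *-assoc _ _ _ ⟨
        q^ e * q^ (k *ℕ e) * x        ≈⟨ *-congʳ (q^-+ e (k *ℕ e)) ⟨
        q^ (e +ℕ k *ℕ e) * x          ∎

    1-q^-regular : ∀ e .{{_ : NonZero e}} → Regular (1-q^ e)
    1-q^-regular e y eq = fixed⇒0 e (x-y≈0⇒x≈y y (q^ e * y) (begin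
      y + - (q^ e * y)       ≈⟨ +-cong (sym (*-identityˡ y)) (-‿distribˡ-* (q^ e) y) ⟩
      1# * y + - q^ e * y    ≈⟨ distribʳ y 1# (- q^ e) ⟨
      1-q^ e * y             ≈⟨ eq ⟩
      0#                     ∎))

    1-q^-high : ∀ e → M ≤ e → 1-q^ e ≈ 1#
    1-q^-high e M≤e = trans (+-congˡ (trans (-‿cong (q^-high e M≤e)) -0≈0)) (+-identityʳ 1#)

    AP : ℕ → ℕ → ℕ → Carrier
    AP a b n = ∏ n (λ i → 1-q^ (a +ℕ b *ℕ i))

    AP-suc : ∀ a b n → AP a b (suc n) ≈ AP a b n * 1-q^ (a +ℕ b *ℕ n)
    AP-suc a b n = Π.fold-last n _

    AP-regular : ∀ a b n .{{_ : NonZero a}} → Regular (AP a b n)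
    AP-regular a@(suc _) b n = ∏-regular n (λ i → 1-q^-regular (a +ℕ b *ℕ i))

    -- For b > 0 the factors of index at least M have exponent at least M and equal 1, so M factors
    -- already give the infinite product.
    AP∞ : ℕ → ℕ → Carrier
    AP∞ a b = AP a b M

    AP-stable : ∀ a b n .{{_ : NonZero b}} → M ≤ n → AP a b n ≈ AP∞ a b
    AP-stable a b n M≤n with d , ≡.refl ← ℕ.m≤n⇒∃[o]m+o≡n M≤n = begin
      AP a b (M +ℕ d) ≈⟨ Π.fold-+ M d _ ⟩
      AP∞ a b * ∏ d (λ i → 1-q^ (a +ℕ b *ℕ (M +ℕ i)))
        ≈⟨ *-congˡ (Π.fold-ε d (λ i _ → 1-q^-high _ (exponent-high i))) ⟩
      AP∞ a b * 1#    ≈⟨ *-identityʳ _ ⟩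
      AP∞ a b         ∎
      where
      exponent-high : ∀ i → M ≤ a +ℕ b *ℕ (M +ℕ i)
      exponent-high i = ℕ.≤-trans (ℕ.m≤m+n M i) (ℕ.≤-trans (ℕ.m≤n*m (M +ℕ i) b) (ℕ.m≤n+m _ a))

    -- Since M d factors give the same product as M, the index i can be sorted by its residue modulo
    -- d, leaving M factors in each class.
    AP∞-dissect : ∀ d a b .{{_ : NonZero d}} .{{_ : NonZero b}} →
      AP∞ a b ≈ ∏ d (λ r → AP∞ (a +ℕ b *ℕ r) (d *ℕ b))
    AP∞-dissect d a b = begin
      AP∞ a b           ≈⟨ AP-stable a b (M *ℕ d) (ℕ.m≤m*n M d) ⟨
      AP a b (M *ℕ d)   ≈⟨ Π.fold-* M d _ ⟩
      ∏ d (λ r → ∏ M (λ i → 1-q^ (a +ℕ b *ℕ (i *ℕ d +ℕ r))))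
        ≈⟨ Π.fold-cong d (λ r _ → Π.fold-cong M (λ i _ → reflexive (≡.cong 1-q^ (exponent a b d i r)))) ⟩
      ∏ d (λ r → AP∞ (a +ℕ b *ℕ r) (d *ℕ b)) ∎
      where
      exponent : ∀ a b d i r → a +ℕ b *ℕ (i *ℕ d +ℕ r) ≡ a +ℕ b *ℕ r +ℕ d *ℕ b *ℕ i
      exponent = solveℕ-∀

    -- Gaussian binomial coefficients in base q^b

    module Gaussian (b : ℕ) .{{_ : NonZero b}} where

      poch : ℕ → Carrier
      poch = AP b b

      -- The coefficient [N over j] in Q = q^b. A Pascal rule serves as the definition because the
      -- quotient of q-factorials would require division; `gauss-poch` recovers the quotient as a
      -- product.
      gauss : ℕ → ℕ → Carrier
      gauss N       zero    = 1#
      gauss zero    (suc j) = 0#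
      gauss (suc N) (suc j) = gauss N j + q^ (b +ℕ b *ℕ j) * gauss N (suc j)

      gauss-> : ∀ {N j} → N < j → gauss N j ≈ 0#
      gauss-> {zero}  {suc j} _ = refl
      gauss-> {suc N} {suc j} (ℕ.s≤s N<j) = begin
        gauss N j + q^ (b +ℕ b *ℕ j) * gauss N (suc j)
          ≈⟨ +-cong (gauss-> N<j) (*-congˡ (gauss-> (ℕ.m<n⇒m<1+n N<j))) ⟩
        0# + q^ (b +ℕ b *ℕ j) * 0# ≈⟨ trans (+-identityˡ _) (zeroʳ _) ⟩
        0# ∎

      gauss-diagonal : ∀ N → gauss N N ≈ 1#
      gauss-diagonal zero    = refl
      gauss-diagonal (suc N) =
        trans (+-cong (gauss-diagonal N) (trans (*-congˡ (gauss-> (ℕ.n<1+n N))) (zeroʳ _))) (+-identityʳ 1#)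

      -- Induction along the Pascal rule, using 1 - Q^(i+j+2) = (1 - Q^(i+1)) + Q^(i+1) (1 -
      -- Q^(j+1)) with Q = q^b.
      gauss-poch : ∀ i j → gauss (i +ℕ j) i * (poch i * poch j) ≈ poch (i +ℕ j)
      gauss-poch zero    j = trans (*-identityˡ _) (*-identityˡ _)
      gauss-poch (suc i) zero rewrite ℕ.+-identityʳ i =
        trans (*-congʳ (gauss-diagonal (suc i))) (trans (*-identityˡ _) (*-identityʳ _))
      gauss-poch (suc i) (suc j) = begin
        (g₁ + qᵢ * g₂) * (poch (suc i) * poch (suc j))
          ≈⟨ solve 5 (λ g₁ qᵢ g₂ x y → (g₁ :+ qᵢ :* g₂) :* (x :* y) := g₁ :* (x :* y) :+ qᵢ :* (g₂ :* (x :* y))) refl g₁ qᵢ g₂ (poch (suc i)) (poch (suc j)) ⟩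
        g₁ * (poch (suc i) * poch (suc j)) + qᵢ * (g₂ * (poch (suc i) * poch (suc j)))
          ≈⟨ +-cong (*-congˡ (*-congʳ (AP-suc b b i))) (*-congˡ (*-congˡ (*-congˡ (AP-suc b b j)))) ⟩
        g₁ * (poch i * 1-q^ eᵢ * poch (suc j)) + qᵢ * (g₂ * (poch (suc i) * (poch j * 1-q^ eⱼ)))
          ≈⟨ solve 9 (λ g₁ pᵢ u p q g₂ r s v → g₁ :* (pᵢ :* u :* p) :+ q :* (g₂ :* (r :* (s :* v))) := g₁ :* (pᵢ :* p) :* u :+ q :* (g₂ :* (r :* s) :* v)) refl
               g₁ (poch i) (1-q^ eᵢ) (poch (suc j)) qᵢ g₂ (poch (suc i)) (poch j) (1-q^ eⱼ) ⟩
        g₁ * (poch i * poch (suc j)) * 1-q^ eᵢ + qᵢ * (g₂ * (poch (suc i) * poch j) * 1-q^ eⱼ)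
          ≈⟨ +-cong (*-congʳ (gauss-poch i (suc j))) (*-congˡ (*-congʳ IH₂)) ⟩
        P * 1-q^ eᵢ + qᵢ * (P * 1-q^ eⱼ)
          ≈⟨ solve 4 (λ P q q′ r → P :* (con 1 :+ q′) :+ q :* (P :* (con 1 :+ r)) := P :* (con 1 :+ q :* r) :+ P :* (q :+ q′)) refl P qᵢ (- qᵢ) (- q^ eⱼ) ⟩
        P * (1# + qᵢ * - q^ eⱼ) + P * (qᵢ + - qᵢ)
          ≈⟨ +-congˡ (trans (*-congˡ (-‿inverseʳ qᵢ)) (zeroʳ P)) ⟩
        P * (1# + qᵢ * - q^ eⱼ) + 0# ≈⟨ +-identityʳ _ ⟩
        P * (1# + qᵢ * - q^ eⱼ) ≈⟨ *-congˡ (+-congˡ (-‿distribʳ-* _ _)) ⟨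
        P * (1# + - (qᵢ * q^ eⱼ)) ≈⟨ *-congˡ (+-congˡ (-‿cong (q^-+ eᵢ eⱼ))) ⟨
        P * 1-q^ (eᵢ +ℕ eⱼ) ≈⟨ *-congˡ (reflexive (≡.cong 1-q^ (exponents b i j))) ⟩
        P * 1-q^ (b +ℕ b *ℕ (i +ℕ suc j)) ≈⟨ AP-suc b b (i +ℕ suc j) ⟨
        poch (suc (i +ℕ suc j)) ∎
        where
        eᵢ = b +ℕ b *ℕ i
        eⱼ = b +ℕ b *ℕ j
        qᵢ = q^ eᵢ
        g₁ = gauss (i +ℕ suc j) i
        g₂ = gauss (i +ℕ suc j) (suc i)
        P = poch (i +ℕ suc j)
        IH₂ : g₂ * (poch (suc i) * poch j) ≈ P
        IH₂ = ≡.subst (λ n → gauss n (suc i) * (poch (suc i) * poch j) ≈ poch n) (≡.sym (ℕ.+-suc i j)) (gauss-poch (suc i) j)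
        exponents : ∀ b i j → b +ℕ b *ℕ i +ℕ (b +ℕ b *ℕ j) ≡ b +ℕ b *ℕ (i +ℕ (1 +ℕ j))
        exponents = solveℕ-∀

      poch-regular : ∀ n → Regular (poch n)
      poch-regular n = AP-regular b b n

      -- Both sides agree after multiplication by the regular element poch (suc j) * poch i.
      gauss-Pascal′ : ∀ i j → gauss (suc (j +ℕ i)) (suc j) ≈ gauss (j +ℕ i) (suc j) + q^ (b *ℕ i) * gauss (j +ℕ i) j
      gauss-Pascal′ zero j = begin
        gauss (j +ℕ 0) j + q^ (b +ℕ b *ℕ j) * gauss (j +ℕ 0) (suc j)
          ≈⟨ +-cong (sym (trans (*-congʳ (trans (reflexive (≡.cong q^ (ℕ.*-zeroʳ b))) q^0)) (*-identityˡ _))) (trans (*-congˡ vanish) (zeroʳ _)) ⟩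
        q^ (b *ℕ 0) * gauss (j +ℕ 0) j + 0# ≈⟨ +-comm _ _ ⟩
        0# + q^ (b *ℕ 0) * gauss (j +ℕ 0) j ≈⟨ +-congʳ vanish ⟨
        gauss (j +ℕ 0) (suc j) + q^ (b *ℕ 0) * gauss (j +ℕ 0) j ∎
        where
        vanish : gauss (j +ℕ 0) (suc j) ≈ 0#
        vanish = gauss-> (ℕ.s≤s (ℕ.≤-reflexive (ℕ.+-identityʳ j)))
      gauss-Pascal′ (suc i) j = cancel (*-regular (poch-regular (suc j)) (poch-regular (suc i))) (begin
        poch (suc j) * poch (suc i) * gauss (suc N) (suc j) ≈⟨ *-comm _ _ ⟩
        gauss (suc N) (suc j) * (poch (suc j) * poch (suc i)) ≈⟨ gauss-poch (suc j) (suc i) ⟩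
        poch (suc N) ≈⟨ AP-suc b b N ⟩
        poch N * 1-q^ (b +ℕ b *ℕ N) ≈⟨ *-congˡ (+-congˡ (-‿cong (trans (reflexive (≡.cong q^ (exponents b i j))) (q^-+ eᵢ eⱼ)))) ⟩
        poch N * (1# + - (qᵢ * q^ eⱼ)) ≈⟨ *-congˡ (+-congˡ (-‿distribʳ-* _ _)) ⟩
        poch N * (1# + qᵢ * - q^ eⱼ) ≈⟨ +-identityʳ _ ⟨
        poch N * (1# + qᵢ * - q^ eⱼ) + 0# ≈⟨ +-congˡ (trans (*-congˡ (-‿inverseʳ qᵢ)) (zeroʳ _)) ⟨
        poch N * (1# + qᵢ * - q^ eⱼ) + poch N * (qᵢ + - qᵢ)
          ≈⟨ solve 4 (λ P q q′ r → P :* (con 1 :+ q :* r) :+ P :* (q :+ q′) := P :* (con 1 :+ q′) :+ q :* (P :* (con 1 :+ r))) refl (poch N) qᵢ (- qᵢ) (- q^ eⱼ) ⟩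
        poch N * 1-q^ eᵢ + qᵢ * (poch N * 1-q^ eⱼ)
          ≈⟨ +-cong (*-congʳ IH₁) (*-congˡ (*-congʳ (gauss-poch j (suc i)))) ⟨
        g₁ * (poch (suc j) * poch i) * 1-q^ eᵢ + qᵢ * (g₂ * (poch j * poch (suc i)) * 1-q^ eⱼ)
          ≈⟨ solve 9 (λ g₁ p r u q g₂ s t v → g₁ :* (p :* r) :* u :+ q :* (g₂ :* (s :* t) :* v) := p :* (r :* u) :* g₁ :+ (s :* v) :* t :* (q :* g₂)) refl
               g₁ (poch (suc j)) (poch i) (1-q^ eᵢ) qᵢ g₂ (poch j) (poch (suc i)) (1-q^ eⱼ) ⟩
        poch (suc j) * (poch i * 1-q^ eᵢ) * g₁ + poch j * 1-q^ eⱼ * poch (suc i) * (qᵢ * g₂)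
          ≈⟨ +-cong (*-congʳ (*-congˡ (AP-suc b b i))) (*-congʳ (*-congʳ (AP-suc b b j))) ⟨
        poch (suc j) * poch (suc i) * g₁ + poch (suc j) * poch (suc i) * (qᵢ * g₂) ≈⟨ distribˡ _ _ _ ⟨
        poch (suc j) * poch (suc i) * (g₁ + qᵢ * g₂) ≈⟨ *-congˡ (+-congˡ (*-congʳ (reflexive (≡.cong q^ (ℕ.*-suc b i))))) ⟨
        poch (suc j) * poch (suc i) * (g₁ + q^ (b *ℕ suc i) * g₂) ∎)
        where
        N = j +ℕ suc i
        eᵢ = b +ℕ b *ℕ i
        eⱼ = b +ℕ b *ℕ j
        qᵢ = q^ eᵢ
        g₁ = gauss N (suc j)
        g₂ = gauss N j
        IH₁ : g₁ * (poch (suc j) * poch i) ≈ poch N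
        IH₁ = ≡.subst (λ n → gauss n (suc j) * (poch (suc j) * poch i) ≈ poch n) (≡.sym (ℕ.+-suc j i)) (gauss-poch (suc j) i)
        exponents : ∀ b i j → b +ℕ b *ℕ (j +ℕ (1 +ℕ i)) ≡ b +ℕ b *ℕ i +ℕ (b +ℕ b *ℕ j)
        exponents = solveℕ-∀

    sgn : ℕ → Carrier
    sgn zero    = 1#
    sgn (suc n) = - sgn n

    sgn-suc : ∀ k → sgn ∣ + 1 +ℤ k ∣ ≈ - sgn ∣ k ∣
    sgn-suc (+ n)        = refl
    sgn-suc -[1+ zero ]  = sym (-‿involutive 1#)
    sgn-suc -[1+ suc n ] = sym (-‿involutive _)

    sgn-+ : ∀ x y → sgn ∣ x +ℤ y ∣ ≈ sgn ∣ x ∣ * sgn ∣ y ∣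
    sgn-+ x (+ zero) = trans (reflexive (≡.cong (sgn ∘ ∣_∣) (ℤ.+-identityʳ x))) (sym (*-identityʳ _))
    sgn-+ x (+ suc n) = begin
      sgn ∣ x +ℤ + suc n ∣          ≡⟨ ≡.cong (sgn ∘ ∣_∣) (swap x (+ n)) ⟩
      sgn ∣ + 1 +ℤ (x +ℤ + n) ∣     ≈⟨ sgn-suc (x +ℤ + n) ⟩
      - sgn ∣ x +ℤ + n ∣            ≈⟨ -‿cong (sgn-+ x (+ n)) ⟩
      - (sgn ∣ x ∣ * sgn n)         ≈⟨ -‿distribʳ-* _ _ ⟩
      sgn ∣ x ∣ * - sgn n           ∎
      where
      swap : ∀ x n → x +ℤ (+ 1 +ℤ n) ≡ + 1 +ℤ (x +ℤ n)
      swap = solve-∀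
    sgn-+ x -[1+ n ] = begin
      sgn ∣ x +ℤ -[1+ n ] ∣               ≈⟨ -‿involutive _ ⟨
      - - sgn ∣ x +ℤ -[1+ n ] ∣           ≈⟨ -‿cong (sgn-suc (x +ℤ -[1+ n ])) ⟨
      - sgn ∣ + 1 +ℤ (x +ℤ -[1+ n ]) ∣    ≡⟨ ≡.cong (λ k → - sgn ∣ k ∣) (move x (+ n)) ⟩
      - sgn ∣ x +ℤ -ℤ + n ∣               ≈⟨ -‿cong (tail n) ⟩
      - (sgn ∣ x ∣ * sgn n)               ≈⟨ -‿distribʳ-* _ _ ⟩
      sgn ∣ x ∣ * - sgn n                 ∎
      where
      move : ∀ x n → + 1 +ℤ (x +ℤ -ℤ (+ 1 +ℤ n)) ≡ x +ℤ -ℤ n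
      move = solve-∀
      tail : ∀ n → sgn ∣ x +ℤ -ℤ + n ∣ ≈ sgn ∣ x ∣ * sgn n
      tail zero    = sgn-+ x (+ 0)
      tail (suc n) = sgn-+ x -[1+ n ]

    sgn-±1 : ∀ n → sgn n ≈ 1# ⊎ sgn n ≈ - 1#
    sgn-±1 zero = inj₁ refl
    sgn-±1 (suc n) with sgn-±1 n
    ... | inj₁ eq = inj₂ (-‿cong eq)
    ... | inj₂ eq = inj₁ (trans (-‿cong eq) (-‿involutive 1#))

    θ-term : ℕ → ℕ → ℤ → Carrier
    θ-term a c k = sgn ∣ k ∣ * q^ (θ-exp a c k)

    θ-term-high : ∀ a c .{{_ : NonZero a}} .{{_ : NonZero c}} k → M ≤ ∣ k ∣ → θ-term a c k ≈ 0#
    θ-term-high a c k M≤∣k∣ = trans (*-congˡ (q^-high _ (ℕ.≤-trans M≤∣k∣ (∣k∣≤θ-exp a c k)))) (zeroʳ _)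

    -- The finite form of the Jacobi triple product

    module FiniteTripleProduct (a c : ℕ) .{{_ : NonZero (a +ℕ c)}} where
      b = a +ℕ c
      open Gaussian b
      W = θ-term a c

      W-lower : ∀ l j → W (-ℤ + suc l +ℤ + j) * q^ (b *ℕ j) ≈ - q^ (c +ℕ b *ℕ l) * W (-ℤ + l +ℤ + j)
      W-lower l j = begin
        sgn ∣ k₁ ∣ * q^ (θ-exp a c k₁) * q^ (b *ℕ j)     ≈⟨ trans (*-assoc _ _ _) (*-congˡ (sym (q^-+ _ _))) ⟩
        sgn ∣ k₁ ∣ * q^ (θ-exp a c k₁ +ℕ b *ℕ j)         ≡⟨ ≡.cong (λ e → sgn ∣ k₁ ∣ * q^ e) (θ-exp-lower a c l j) ⟩
        sgn ∣ k₁ ∣ * q^ (e +ℕ θ-exp a c k)               ≈⟨ *-cong sign (q^-+ _ _) ⟩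
        - sgn ∣ k ∣ * (q^ e * q^ (θ-exp a c k))          ≈⟨ -‿distribˡ-* _ _ ⟨
        - (sgn ∣ k ∣ * (q^ e * q^ (θ-exp a c k)))        ≈⟨ -‿cong (solve 3 (λ x y z → x :* (y :* z) := y :* (x :* z)) refl (sgn ∣ k ∣) (q^ e) (q^ (θ-exp a c k))) ⟩
        - (q^ e * W k)                                   ≈⟨ -‿distribˡ-* _ _ ⟩
        - q^ e * W k                                     ∎
        where
        k₁ = -ℤ + suc l +ℤ + j
        k = -ℤ + l +ℤ + j
        e = c +ℕ b *ℕ l
        next : ∀ l j → + 1 +ℤ (-ℤ (+ 1 +ℤ l) +ℤ j) ≡ -ℤ l +ℤ j
        next = solve-∀
        sign : sgn ∣ k₁ ∣ ≈ - sgn ∣ k ∣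
        sign = begin
          sgn ∣ k₁ ∣              ≈⟨ -‿involutive _ ⟨
          - - sgn ∣ k₁ ∣          ≈⟨ -‿cong (sgn-suc k₁) ⟨
          - sgn ∣ + 1 +ℤ k₁ ∣     ≡⟨ ≡.cong (λ k → - sgn ∣ k ∣) (next (+ l) (+ j)) ⟩
          - sgn ∣ k ∣             ∎

      W-raise : ∀ m l i j → j +ℕ i ≡ m +ℕ l →
        W (-ℤ + l +ℤ + suc j) * q^ (b *ℕ i) ≈ - q^ (a +ℕ b *ℕ m) * W (-ℤ + l +ℤ + j)
      W-raise m l i j j+i≡m+l = begin
        sgn ∣ k₁ ∣ * q^ (θ-exp a c k₁) * q^ (b *ℕ i)     ≈⟨ trans (*-assoc _ _ _) (*-congˡ (sym (q^-+ _ _))) ⟩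
        sgn ∣ k₁ ∣ * q^ (θ-exp a c k₁ +ℕ b *ℕ i)         ≡⟨ ≡.cong (λ e → sgn ∣ k₁ ∣ * q^ e) (θ-exp-raise a c m l i j j+i≡m+l) ⟩
        sgn ∣ k₁ ∣ * q^ (e +ℕ θ-exp a c k)               ≈⟨ *-cong sign (q^-+ _ _) ⟩
        - sgn ∣ k ∣ * (q^ e * q^ (θ-exp a c k))          ≈⟨ -‿distribˡ-* _ _ ⟨
        - (sgn ∣ k ∣ * (q^ e * q^ (θ-exp a c k)))        ≈⟨ -‿cong (solve 3 (λ x y z → x :* (y :* z) := y :* (x :* z)) refl (sgn ∣ k ∣) (q^ e) (q^ (θ-exp a c k))) ⟩
        - (q^ e * W k)                                   ≈⟨ -‿distribˡ-* _ _ ⟩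
        - q^ e * W k                                     ∎
        where
        k₁ = -ℤ + l +ℤ + suc j
        k = -ℤ + l +ℤ + j
        e = a +ℕ b *ℕ m
        next : ∀ l j → -ℤ l +ℤ (+ 1 +ℤ j) ≡ + 1 +ℤ (-ℤ l +ℤ j)
        next = solve-∀
        sign : sgn ∣ k₁ ∣ ≈ - sgn ∣ k ∣
        sign = trans (reflexive (≡.cong (sgn ∘ ∣_∣) (next (+ l) (+ j)))) (sgn-suc k)

      -- The q-binomial theorem in bilateral form: l counts the factors that start at c, N - l those
      -- that start at a, and the theta index k = j - l runs from -l to N - l.
      S : ℕ → ℕ → Carrier
      S N l = ∑ (suc N) (λ j → W (-ℤ + l +ℤ + j) * gauss N j)

      -- The defining Pascal rule splits the sum in two. The first part is `S l l` after a shift of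
      -- j; in the second, `W-lower` turns the weight q^(b j) into the constant factor -q^(c + b l).
      S-lower : ∀ l → S (suc l) (suc l) ≈ S l l * 1-q^ (c +ℕ b *ℕ l)
      S-lower l = begin
        W (k₁ 0) * 1# + ∑ (suc l) (λ j → W (k₁ (suc j)) * (gauss l j + q^ (b +ℕ b *ℕ j) * gauss l (suc j)))
          ≈⟨ +-cong head (trans (Σ.fold-cong (suc l) (λ j _ → step j)) (Σ.fold-∙ (suc l) s (t ∘ suc))) ⟩
        t 0 + (S l l + ∑ (suc l) (t ∘ suc))
          ≈⟨ solve 3 (λ x y z → x :+ (y :+ z) := y :+ (x :+ z)) refl (t 0) (S l l) (∑ (suc l) (t ∘ suc)) ⟩
        S l l + ∑ (suc (suc l)) t
          ≈⟨ +-congˡ (Σ.fold-last (suc l) t) ⟩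
        S l l + (∑ (suc l) t + t (suc l))
          ≈⟨ +-congˡ (trans (+-congˡ (trans (*-congˡ (gauss-> (ℕ.n<1+n l))) (zeroʳ _))) (+-identityʳ _)) ⟩
        S l l + ∑ (suc l) t
          ≈⟨ +-congˡ (trans (Σ.fold-cong (suc l) (λ j _ → trans (*-congʳ (W-lower l j)) (*-assoc _ _ (gauss l j)))) (∑-*ˡ (suc l) (- x) s)) ⟩
        S l l + - x * S l l
          ≈⟨ solve 2 (λ s x → s :+ x :* s := s :* (con 1 :+ x)) refl (S l l) (- x) ⟩
        S l l * 1-q^ (c +ℕ b *ℕ l) ∎
        where
        x = q^ (c +ℕ b *ℕ l)
        k₁ : ℕ → ℤ
        k₁ j = -ℤ + suc l +ℤ + j
        s t : ℕ → Carrier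
        s j = W (-ℤ + l +ℤ + j) * gauss l j
        t j = W (k₁ j) * q^ (b *ℕ j) * gauss l j
        head : W (k₁ 0) * 1# ≈ t 0
        head = trans (*-identityʳ _) (sym (trans (*-identityʳ _)
          (trans (*-congˡ (trans (reflexive (≡.cong q^ (ℕ.*-zeroʳ b))) q^0)) (*-identityʳ _))))
        shift : ∀ l j → -ℤ (+ 1 +ℤ l) +ℤ (+ 1 +ℤ j) ≡ -ℤ l +ℤ j
        shift = solve-∀
        step : ∀ j → W (k₁ (suc j)) * (gauss l j + q^ (b +ℕ b *ℕ j) * gauss l (suc j)) ≈ W (-ℤ + l +ℤ + j) * gauss l j + t (suc j)
        step j = trans (distribˡ _ _ _) (+-cong
          (*-congʳ (reflexive (≡.cong W (shift (+ l) (+ j)))))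
          (trans (sym (*-assoc _ _ _)) (*-congʳ (*-congˡ (reflexive (≡.cong q^ (≡.sym (ℕ.*-suc b j))))))))

      -- Here l, and with it the range's lower end, stays fixed. The other Pascal rule carries the
      -- weight q^(b i) with i = N - j, which is exactly the one that `W-raise` absorbs.
      S-raise : ∀ m l → S (suc (m +ℕ l)) l ≈ S (m +ℕ l) l * 1-q^ (a +ℕ b *ℕ m)
      S-raise m l = begin
        W (k 0) * 1# + ∑ (suc N) (λ j → W (k (suc j)) * gauss (suc N) (suc j))
          ≈⟨ +-congˡ (trans (Σ.fold-cong (suc N) step) (Σ.fold-∙ (suc N) (t ∘ suc) (λ j → - x * t j))) ⟩
        W (k 0) * 1# + (∑ (suc N) (t ∘ suc) + ∑ (suc N) (λ j → - x * t j))
          ≈⟨ +-assoc _ _ _ ⟨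
        ∑ (suc (suc N)) t + ∑ (suc N) (λ j → - x * t j)
          ≈⟨ +-cong (Σ.fold-last (suc N) t) (∑-*ˡ (suc N) (- x) t) ⟩
        S N l + t (suc N) + - x * S N l
          ≈⟨ +-congʳ (trans (+-congˡ (trans (*-congˡ (gauss-> (ℕ.n<1+n N))) (zeroʳ _))) (+-identityʳ _)) ⟩
        S N l + - x * S N l
          ≈⟨ solve 2 (λ s x → s :+ x :* s := s :* (con 1 :+ x)) refl (S N l) (- x) ⟩
        S N l * 1-q^ (a +ℕ b *ℕ m) ∎
        where
        N = m +ℕ l
        x = q^ (a +ℕ b *ℕ m)
        k : ℕ → ℤ
        k j = -ℤ + l +ℤ + j
        t : ℕ → Carrier
        t j = W (k j) * gauss N j
        step : ∀ j → j < suc N → W (k (suc j)) * gauss (suc N) (suc j) ≈ t (suc j) + - x * t j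
        step j (ℕ.s≤s j≤N) with i , j+i≡N ← ℕ.m≤n⇒∃[o]m+o≡n j≤N = begin
          W (k (suc j)) * gauss (suc N) (suc j)
            ≈⟨ *-congˡ (≡.subst (λ n → gauss (suc n) (suc j) ≈ gauss n (suc j) + q^ (b *ℕ i) * gauss n j) j+i≡N (gauss-Pascal′ i j)) ⟩
          W (k (suc j)) * (gauss N (suc j) + q^ (b *ℕ i) * gauss N j)
            ≈⟨ trans (distribˡ _ _ _) (+-congˡ (sym (*-assoc _ _ _))) ⟩
          t (suc j) + W (k (suc j)) * q^ (b *ℕ i) * gauss N j
            ≈⟨ +-congˡ (trans (*-congʳ (W-raise m l i j j+i≡N)) (*-assoc _ _ _)) ⟩
          t (suc j) + - x * t j ∎

      AP-lower : ∀ l → AP c b l ≈ S l l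
      AP-lower zero    = sym (trans (+-identityʳ _) (trans (*-identityʳ _) (trans (*-identityˡ _)
        (trans (reflexive (≡.cong q^ (θ-exp-0))) q^0))))
        where
        θ-exp-0 : θ-exp a c (+ 0) ≡ 0
        θ-exp-0 = ≡.cong₂ _+ℕ_ (ℕ.*-zeroʳ a) (ℕ.*-zeroʳ b)
      AP-lower (suc l) = trans (AP-suc c b l) (trans (*-congʳ (AP-lower l)) (sym (S-lower l)))

      finite-triple-product : ∀ m l → AP a b m * AP c b l ≈ S (m +ℕ l) l
      finite-triple-product zero    l = trans (*-identityˡ _) (AP-lower l)
      finite-triple-product (suc m) l = begin
        AP a b (suc m) * AP c b l                       ≈⟨ *-congʳ (AP-suc a b m) ⟩
        AP a b m * 1-q^ (a +ℕ b *ℕ m) * AP c b l        ≈⟨ solve 3 (λ x y z → x :* y :* z := x :* z :* y) refl (AP a b m) (1-q^ (a +ℕ b *ℕ m)) (AP c b l) ⟩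
        AP a b m * AP c b l * 1-q^ (a +ℕ b *ℕ m)        ≈⟨ *-congʳ (finite-triple-product m l) ⟩
        S (m +ℕ l) l * 1-q^ (a +ℕ b *ℕ m)               ≈⟨ S-raise m l ⟨
        S (suc m +ℕ l) l                                ∎

    -- The window is -M ≤ k < M. For `Small` functions it amounts to a sum over ℤ. Half-open, it is
    -- mapped onto itself by k ↦ -1 - k, which `theta-a-0` relies on.
    ∑ℤ : (ℤ → Carrier) → Carrier
    ∑ℤ F = ∑ (M +ℕ M) (λ j → F (-ℤ + M +ℤ + j))

    Small : (ℤ → Carrier) → Set
    Small F = ∀ k → M ≤ ∣ k ∣ → F k ≈ 0#

    ≤ℤ⇒∃ : ∀ {i j} → i ≤ℤ j → ∃ λ d → j ≡ i +ℤ + d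
    ≤ℤ⇒∃ {i} {j} i≤j = ∣ j -ℤ i ∣ , ≡.trans (rearrange i j) (≡.cong (i +ℤ_) (≡.sym (ℤ.0≤i⇒+∣i∣≡i (ℤ.i≤j⇒0≤j-i i≤j))))
      where
      rearrange : ∀ i j → j ≡ i +ℤ (j -ℤ i)
      rearrange = solve-∀

    bounds : ∀ k {m} → ∣ k ∣ ≤ m → (-ℤ + m ≤ℤ k) × (k ≤ℤ + m)
    bounds (+ n)    n≤m  = ℤ.neg-≤-pos , +≤+ n≤m
    bounds -[1+ n ] 1+n≤m = ℤ.neg-mono-≤ (+≤+ 1+n≤m) , -≤+

    -- A longer interval splits into the standard window and two tails on which |k| ≥ M. This is
    -- what permits translations of the summation variable.
    ∑-window : ∀ {F} → Small F → ∀ lo n → lo ≤ℤ -ℤ + M → + M ≤ℤ lo +ℤ + n →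
      ∑ n (λ j → F (lo +ℤ + j)) ≈ ∑ℤ F
    ∑-window {F} small lo n lo≤-M M≤lo+n
      with d , -M≡lo+d ← ≤ℤ⇒∃ lo≤-M | e , lo+n≡M+e ← ≤ℤ⇒∃ M≤lo+n = begin
      ∑ n f                                               ≡⟨ ≡.cong (λ n → ∑ n f) width ⟩
      ∑ (d +ℕ ((M +ℕ M) +ℕ e)) f                          ≈⟨ Σ.fold-+ d _ f ⟩
      ∑ d f + ∑ ((M +ℕ M) +ℕ e) (f ∘ (d +ℕ_))             ≈⟨ +-cong (Σ.fold-ε d below) (Σ.fold-+ (M +ℕ M) e _) ⟩
      0# + (∑ (M +ℕ M) (f ∘ (d +ℕ_)) + ∑ e (λ j → f (d +ℕ (M +ℕ M +ℕ j))))
        ≈⟨ trans (+-identityˡ _) (+-cong (Σ.fold-cong (M +ℕ M) (λ j _ → reflexive (≡.cong F (middle j)))) (Σ.fold-ε e above)) ⟩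
      ∑ℤ F + 0#                                           ≈⟨ +-identityʳ _ ⟩
      ∑ℤ F                                                ∎
      where
      f : ℕ → Carrier
      f j = F (lo +ℤ + j)
      width : n ≡ d +ℕ ((M +ℕ M) +ℕ e)
      width = ℤ.+-injective (≡.trans (split lo (+ n)) (≡.trans (≡.cong (_-ℤ lo) lo+n≡M+e)
        (≡.trans (regroup (+ M) (+ e) lo (+ d)) (≡.trans
          (≡.cong (λ z → + d +ℤ (+ M +ℤ + M +ℤ + e) +ℤ (z -ℤ (lo +ℤ + d))) -M≡lo+d)
          (clear (+ d +ℤ (+ M +ℤ + M +ℤ + e)) (lo +ℤ + d))))))
        where
        split : ∀ lo n → n ≡ lo +ℤ n -ℤ lo
        split = solve-∀
        regroup : ∀ M e lo d → M +ℤ e -ℤ lo ≡ d +ℤ (M +ℤ M +ℤ e) +ℤ (-ℤ M -ℤ (lo +ℤ d))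
        regroup = solve-∀
        clear : ∀ x y → x +ℤ (y -ℤ y) ≡ x
        clear = solve-∀
      middle : ∀ j → lo +ℤ + (d +ℕ j) ≡ -ℤ + M +ℤ + j
      middle j = ≡.trans (≡.sym (ℤ.+-assoc lo (+ d) (+ j))) (≡.cong (_+ℤ + j) (≡.sym -M≡lo+d))
      below : ∀ j → j < d → f j ≈ 0#
      below j j<d with i , ≡.refl ← ℕ.m≤n⇒∃[o]m+o≡n j<d = small _ (≡.subst (λ k → M ≤ ∣ k ∣) (≡.sym position)
        (≡.subst (M ≤_) (≡.sym (ℤ.∣-i∣≡∣i∣ (+ (M +ℕ suc i)))) (ℕ.m≤m+n M (suc i))))
        where
        expand : ∀ lo i j → lo +ℤ j ≡ lo +ℤ (+ 1 +ℤ j +ℤ i) -ℤ (+ 1 +ℤ i)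
        expand = solve-∀
        collect : ∀ M i → -ℤ M -ℤ i ≡ -ℤ (M +ℤ i)
        collect = solve-∀
        position : lo +ℤ + j ≡ -ℤ + (M +ℕ suc i)
        position = ≡.trans (expand lo (+ i) (+ j)) (≡.trans (≡.cong (_-ℤ + suc i) (≡.sym -M≡lo+d)) (collect (+ M) (+ suc i)))
      above : ∀ j → j < e → f (d +ℕ (M +ℕ M +ℕ j)) ≈ 0#
      above j _ = small _ (≡.subst (λ k → M ≤ ∣ k ∣) (≡.sym (≡.trans (middle _) (collect (+ M) (+ j)))) (ℕ.m≤m+n M j))
        where
        collect : ∀ M j → -ℤ M +ℤ (M +ℤ M +ℤ j) ≡ M +ℤ j
        collect = solve-∀

    -- Passage to the limit: the Jacobi triple product

    module _ (a c : ℕ) .{{_ : NonZero a}} .{{_ : NonZero c}} .{{_ : NonZero (a +ℕ c)}} where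
      open FiniteTripleProduct a c
      open Gaussian (a +ℕ c)

      -- With both lower indices at least M, all three q-factorials in `gauss-poch` have stabilized,
      -- so the coefficient is the inverse of `poch M`.
      gauss-central : ∀ i j → M ≤ i → M ≤ j → poch M * gauss (i +ℕ j) i ≈ 1#
      gauss-central i j M≤i M≤j = cancel (poch-regular M) (begin
        P * (P * g)             ≈⟨ solve 2 (λ P g → P :* (P :* g) := g :* (P :* P)) refl P g ⟩
        g * (P * P)             ≈⟨ *-congˡ (*-cong (AP-stable b b i M≤i) (AP-stable b b j M≤j)) ⟨
        g * (poch i * poch j)   ≈⟨ gauss-poch i j ⟩
        poch (i +ℕ j)           ≈⟨ AP-stable b b (i +ℕ j) (ℕ.≤-trans M≤i (ℕ.m≤m+n i j)) ⟩
        P                       ≈⟨ *-identityʳ P ⟨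
        P * 1#                  ∎)
        where
        P = poch M
        g = gauss (i +ℕ j) i

      triple-product : AP∞ a b * AP∞ c b * AP∞ b b ≈ ∑ℤ (θ-term a c)
      triple-product = begin
        AP∞ a b * AP∞ c b * poch M    ≈⟨ *-congʳ (*-cong (AP-stable a b n M≤n) (AP-stable c b n M≤n)) ⟨
        AP a b n * AP c b n * poch M  ≈⟨ *-congʳ (finite-triple-product n n) ⟩
        S (n +ℕ n) n * poch M         ≈⟨ ∑-*ʳ (suc (n +ℕ n)) (poch M) (λ j → W (-ℤ + n +ℤ + j) * gauss (n +ℕ n) j) ⟨
        ∑ (suc (n +ℕ n)) (λ j → W (-ℤ + n +ℤ + j) * gauss (n +ℕ n) j * poch M)
          ≈⟨ Σ.fold-cong (suc (n +ℕ n)) term ⟩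
        ∑ (suc (n +ℕ n)) (λ j → W (-ℤ + n +ℤ + j))
          ≈⟨ ∑-window (θ-term-high a c) (-ℤ + n) (suc (n +ℕ n)) (ℤ.neg-mono-≤ (+≤+ M≤n)) upper ⟩
        ∑ℤ W ∎
        where
        -- With n = 2M factors on each side, every index k = j - n with |k| ≤ M has j = n + k ≥ M
        -- and i = n - k ≥ M, so `gauss-central` applies; for |k| ≥ M the theta term itself
        -- vanishes.
        n = M +ℕ M
        M≤n = ℕ.m≤m+n M M
        upper : + M ≤ℤ -ℤ + n +ℤ + suc (n +ℕ n)
        upper = ≡.subst (+ M ≤ℤ_) (position (+ n)) (+≤+ (ℕ.m≤n⇒m≤1+n M≤n))
          where
          position : ∀ n → + 1 +ℤ n ≡ -ℤ n +ℤ (+ 1 +ℤ (n +ℤ n))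
          position = solve-∀
        term : ∀ j → j < suc (n +ℕ n) → W (-ℤ + n +ℤ + j) * gauss (n +ℕ n) j * poch M ≈ W (-ℤ + n +ℤ + j)
        term j (ℕ.s≤s j≤2n) with M ℕ.≤? ∣ -ℤ + n +ℤ + j ∣
        ... | yes M≤∣k∣ = trans (trans (*-congʳ (trans (*-congʳ W≈0) (zeroˡ _))) (zeroˡ _)) (sym W≈0)
          where W≈0 = θ-term-high a c (-ℤ + n +ℤ + j) M≤∣k∣
        ... | no M≰∣k∣ = begin
          W (-ℤ + n +ℤ + j) * gauss (n +ℕ n) j * poch M     ≈⟨ *-assoc _ _ _ ⟩
          W (-ℤ + n +ℤ + j) * (gauss (n +ℕ n) j * poch M)   ≈⟨ *-congˡ (trans (*-comm _ _) central) ⟩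
          W (-ℤ + n +ℤ + j) * 1#                            ≈⟨ *-identityʳ _ ⟩
          W (-ℤ + n +ℤ + j)                                 ∎
          where
          ∣k∣≤M : ∣ -ℤ + n +ℤ + j ∣ ≤ M
          ∣k∣≤M = ℕ.<⇒≤ (ℕ.≰⇒> M≰∣k∣)
          central : poch M * gauss (n +ℕ n) j ≈ 1#
          central with i , j+i≡2n ← ℕ.m≤n⇒∃[o]m+o≡n j≤2n | lower , upper ← bounds (-ℤ + n +ℤ + j) ∣k∣≤M
                  with d , k≡-M+d ← ≤ℤ⇒∃ lower | e , M≡k+e ← ≤ℤ⇒∃ upper =
            ≡.subst (λ N → poch M * gauss N j ≈ 1#) j+i≡2n (gauss-central j i
              (≡.subst (M ≤_) (ℤ.+-injective (≡.sym (≡.trans (at-j (+ M) (+ j)) (≡.trans (≡.cong (+ n +ℤ_) k≡-M+d) (drop (+ M) (+ d)))))) (ℕ.m≤m+n M d))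
              (≡.subst (M ≤_) (ℤ.+-injective (≡.sym (≡.trans (at-i (+ n) (+ j) (+ i)) (≡.trans
                 (≡.cong (λ s → + s -ℤ (+ n +ℤ (-ℤ + n +ℤ + j))) j+i≡2n) (≡.trans (finish (+ M) (-ℤ + n +ℤ + j))
                 (≡.trans (≡.cong (λ m → + M +ℤ (m -ℤ (-ℤ + n +ℤ + j))) M≡k+e) (drop′ (+ M) (-ℤ + n +ℤ + j) (+ e)))))))) (ℕ.m≤m+n M e)))
            where
            at-j : ∀ m j → j ≡ m +ℤ m +ℤ (-ℤ (m +ℤ m) +ℤ j)
            at-j = solve-∀
            drop : ∀ m d → m +ℤ m +ℤ (-ℤ m +ℤ d) ≡ m +ℤ d
            drop = solve-∀
            at-i : ∀ n j i → i ≡ j +ℤ i -ℤ (n +ℤ (-ℤ n +ℤ j))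
            at-i = solve-∀
            finish : ∀ m k → m +ℤ m +ℤ (m +ℤ m) -ℤ (m +ℤ m +ℤ k) ≡ m +ℤ (m -ℤ k)
            finish = solve-∀
            drop′ : ∀ m k e → m +ℤ (k +ℤ e -ℤ k) ≡ m +ℤ e
            drop′ = solve-∀

  -- Lattice sums over ℤ³ and the products f₁ f₂, f₁ f₅, f₁ f₇

  module ProductIdentities (T : TruncatedPowers) where
    open TruncatedPowers T renaming (order to M; ring to R)
    open CommutativeRing R
    open import Algebra.Properties.Ring ring using (-‿distribˡ-*; -‿distribʳ-*)
    open import Algebra.Properties.AbelianGroup +-abelianGroup using ()
      renaming (⁻¹-involutive to -‿involutive)
    open import Algebra.Solver.Ring.NaturalCoefficients.Default commutativeSemiring using (solve; _:+_; _:*_; _:=_; con)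
    open import Relation.Binary.Reasoning.Setoid setoid
    open import Data.Integer using (ℤ; +_; ∣_∣; +≤+) renaming (_+_ to _+ℤ_; _*_ to _*ℤ_; -_ to -ℤ_; _≤_ to _≤ℤ_; _-_ to _-ℤ_)
    import Data.Integer.Properties as ℤ
    open import Data.Integer.Tactic.RingSolver using (solve-∀)
    open import Data.Nat.Tactic.RingSolver using () renaming (solve-∀ to solveℕ-∀)
    import Data.Nat.Properties as ℕ
    open import Data.Product using (_,_)
    open import Data.Sum using (inj₁; inj₂)
    open import Function using (_∘_)
    open import Data.Nat.Divisibility using (_∣?_; _∣_; ∣m+n∣m⇒∣n; m∣m*n; >⇒∤)
    open import Relation.Nullary using (¬_; yes; no; contradiction)
    open import Relation.Binary.PropositionalEquality as ≡ using (_≡_)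
    open Theta T

    -- Points of ℤ³ are written as (α , β , r - α - β) + w (1 , 1 , 1) with 0 ≤ r < 3.
    module TripleSum {F₁ F₂ F₃ : ℤ → Carrier} (small₁ : Small F₁) (small₂ : Small F₂) (small₃ : Small F₃) where

      2M = M +ℕ M
      4M = 2M +ℕ 2M

      at : ℕ → ℤ
      at j = -ℤ + M +ℤ + j

      at₂ : ℕ → ℤ
      at₂ j = -ℤ + 2M +ℤ + j

      at-≥ : ∀ j → -ℤ + M ≤ℤ at j
      at-≥ j = ℤ.i≤i+j (-ℤ + M) (+ j)

      at-≤ : ∀ {j} → j < 2M → at j ≤ℤ + M
      at-≤ j<2M = ≡.subst (at _ ≤ℤ_) (collect (+ M)) (ℤ.+-monoʳ-≤ (-ℤ + M) (+≤+ (ℕ.<⇒≤ j<2M)))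
        where
        collect : ∀ m → -ℤ m +ℤ (m +ℤ m) ≡ m
        collect = solve-∀

      product-expand : ∑ℤ F₁ * (∑ℤ F₂ * ∑ℤ F₃) ≈ ∑ℤ (λ k₁ → ∑ℤ (λ k₂ → ∑ℤ (λ k₃ → F₁ k₁ * (F₂ k₂ * F₃ k₃))))
      product-expand = sym (begin
        ∑ℤ (λ k₁ → ∑ℤ (λ k₂ → ∑ℤ (λ k₃ → F₁ k₁ * (F₂ k₂ * F₃ k₃))))
          ≈⟨ Σ.fold-cong 2M (λ j₁ _ → Σ.fold-cong 2M (λ j₂ _ →
               trans (∑-*ˡ 2M (F₁ (at j₁)) _) (*-congˡ (∑-*ˡ 2M (F₂ (at j₂)) (F₃ ∘ at))))) ⟩
        ∑ℤ (λ k₁ → ∑ℤ (λ k₂ → F₁ k₁ * (F₂ k₂ * ∑ℤ F₃)))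
          ≈⟨ Σ.fold-cong 2M (λ j₁ _ → trans (∑-*ˡ 2M (F₁ (at j₁)) _) (*-congˡ (∑-*ʳ 2M (∑ℤ F₃) (F₂ ∘ at)))) ⟩
        ∑ℤ (λ k₁ → F₁ k₁ * (∑ℤ F₂ * ∑ℤ F₃))
          ≈⟨ ∑-*ʳ 2M (∑ℤ F₂ * ∑ℤ F₃) (F₁ ∘ at) ⟩
        ∑ℤ F₁ * (∑ℤ F₂ * ∑ℤ F₃) ∎)

      *-smallˡ : ∀ {F : ℤ → Carrier} (G : ℤ → Carrier) → Small F → Small (λ k → F k * G k)
      *-smallˡ G small k M≤∣k∣ = trans (*-congʳ (small k M≤∣k∣)) (zeroˡ _)

      -- Writes k₁ + k₂ + k₃ = 3 w + r. As w runs over the window, k₃ fills an interval of length 6M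
      -- starting at -3M - k₁ - k₂, and the bounds |k₁|, |k₂| ≤ M ensure that it covers the window
      -- of k₃.
      regroup₃ : ∀ k₁ k₂ → -ℤ + M ≤ℤ k₁ → k₁ ≤ℤ + M → -ℤ + M ≤ℤ k₂ → k₂ ≤ℤ + M →
        ∑ℤ F₃ ≈ ∑ 3 (λ r → ∑ℤ (λ w → F₃ (w +ℤ (w +ℤ w) +ℤ + r -ℤ k₁ -ℤ k₂)))
      regroup₃ k₁ k₂ l₁ u₁ l₂ u₂ = begin
        ∑ℤ F₃ ≈⟨ ∑-window small₃ lo (2M *ℕ 3) (ℤ.0≤i-j⇒j≤i lower) (ℤ.0≤i-j⇒j≤i upper) ⟨
        ∑ (2M *ℕ 3) (λ j → F₃ (lo +ℤ + j)) ≈⟨ Σ.fold-* 2M 3 _ ⟩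
        ∑ 3 (λ r → ∑ 2M (λ i → F₃ (lo +ℤ + (i *ℕ 3 +ℕ r))))
          ≈⟨ Σ.fold-cong 3 (λ r _ → Σ.fold-cong 2M (λ i _ → reflexive (≡.cong F₃ (position r i)))) ⟩
        _ ∎
        where
        lo = -ℤ (+ M +ℤ (+ M +ℤ + M)) -ℤ k₁ -ℤ k₂
        lower : + 0 ≤ℤ -ℤ + M -ℤ lo
        lower = ≡.subst (+ 0 ≤ℤ_) (eq (+ M) k₁ k₂) (ℤ.+-mono-≤ (ℤ.i≤j⇒0≤j-i l₁) (ℤ.i≤j⇒0≤j-i l₂))
          where
          eq : ∀ m k₁ k₂ → (k₁ -ℤ -ℤ m) +ℤ (k₂ -ℤ -ℤ m) ≡ -ℤ m -ℤ (-ℤ (m +ℤ (m +ℤ m)) -ℤ k₁ -ℤ k₂)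
          eq = solve-∀
        upper : + 0 ≤ℤ lo +ℤ + (2M *ℕ 3) -ℤ + M
        upper = ≡.subst (+ 0 ≤ℤ_) (≡.trans (eq (+ M) k₁ k₂) (≡.cong (λ z → lo +ℤ z -ℤ + M) (≡.sym (ℤ.pos-* 2M 3))))
          (ℤ.+-mono-≤ (ℤ.i≤j⇒0≤j-i u₁) (ℤ.i≤j⇒0≤j-i u₂))
          where
          eq : ∀ m k₁ k₂ → (m -ℤ k₁) +ℤ (m -ℤ k₂) ≡ -ℤ (m +ℤ (m +ℤ m)) -ℤ k₁ -ℤ k₂ +ℤ (m +ℤ m) *ℤ + 3 -ℤ m
          eq = solve-∀
        position : ∀ r i → lo +ℤ + (i *ℕ 3 +ℕ r) ≡ at i +ℤ (at i +ℤ at i) +ℤ + r -ℤ k₁ -ℤ k₂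
        position r i = ≡.trans (≡.cong (λ z → lo +ℤ (z +ℤ + r)) (ℤ.pos-* i 3)) (eq (+ M) k₁ k₂ (+ i) (+ r))
          where
          eq : ∀ m k₁ k₂ i r → -ℤ (m +ℤ (m +ℤ m)) -ℤ k₁ -ℤ k₂ +ℤ (i *ℤ + 3 +ℤ r)
            ≡ (-ℤ m +ℤ i) +ℤ ((-ℤ m +ℤ i) +ℤ (-ℤ m +ℤ i)) +ℤ r -ℤ k₁ -ℤ k₂
          eq = solve-∀

      -- Under k = α + w the range of α would move with w. The doubled window -2M ≤ α < 2M serves
      -- all w in the window at once, so the order of summation can be exchanged afterwards.
      recenter : ∀ {F} → Small F → ∀ {j} → j < 2M → ∑ℤ F ≈ ∑ 4M (λ i → F (at₂ i +ℤ at j))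
      recenter {F} small {j} j<2M = begin
        ∑ℤ F                              ≈⟨ ∑-window small lo 4M (ℤ.0≤i-j⇒j≤i lower) (ℤ.0≤i-j⇒j≤i upper) ⟨
        ∑ 4M (λ i → F (lo +ℤ + i))        ≈⟨ Σ.fold-cong 4M (λ i _ → reflexive (≡.cong F (position (+ 2M) (at j) (+ i)))) ⟩
        ∑ 4M (λ i → F (at₂ i +ℤ at j))    ∎
        where
        lo = -ℤ + 2M +ℤ at j
        lower : + 0 ≤ℤ -ℤ + M -ℤ lo
        lower = ≡.subst (+ 0 ≤ℤ_) (eq (+ M) (at j)) (ℤ.i≤j⇒0≤j-i (at-≤ j<2M))
          where
          eq : ∀ m w → m -ℤ w ≡ -ℤ m -ℤ (-ℤ (m +ℤ m) +ℤ w)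
          eq = solve-∀
        upper : + 0 ≤ℤ lo +ℤ + 4M -ℤ + M
        upper = ≡.subst (+ 0 ≤ℤ_) (eq (+ M) (at j)) (ℤ.i≤j⇒0≤j-i (at-≥ j))
          where
          eq : ∀ m w → w -ℤ -ℤ m ≡ -ℤ (m +ℤ m) +ℤ w +ℤ (m +ℤ m +ℤ (m +ℤ m)) -ℤ m
          eq = solve-∀
        position : ∀ m w i → -ℤ m +ℤ w +ℤ i ≡ -ℤ m +ℤ i +ℤ w
        position = solve-∀

      -- The variable w first replaces k₃ innermost, then moves outermost so that k₁ and k₂ can be
      -- recentred at it, and finally returns innermost: the inner sum now runs along (1,1,1).
      product-regroup : ∑ℤ F₁ * (∑ℤ F₂ * ∑ℤ F₃) ≈
        ∑ 3 (λ r → ∑ 4M (λ α → ∑ 4M (λ β → ∑ℤ (λ w →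
          F₁ (at₂ α +ℤ w) * (F₂ (at₂ β +ℤ w) * F₃ (+ r -ℤ at₂ α -ℤ at₂ β +ℤ w))))))
      product-regroup = begin
        ∑ℤ F₁ * (∑ℤ F₂ * ∑ℤ F₃) ≈⟨ product-expand ⟩
        ∑ℤ (λ k₁ → ∑ℤ (λ k₂ → ∑ℤ (λ k₃ → F₁ k₁ * (F₂ k₂ * F₃ k₃))))
          ≈⟨ Σ.fold-cong 2M (λ j₁ l₁ → Σ.fold-cong 2M (λ j₂ l₂ → slice (at j₁) (at j₂) (at-≥ j₁) (at-≤ l₁) (at-≥ j₂) (at-≤ l₂))) ⟩
        ∑ℤ (λ k₁ → ∑ℤ (λ k₂ → ∑ 3 (λ r → ∑ℤ (λ w → H r w k₁ k₂))))
          ≈⟨ Σ.fold-cong 2M (λ j₁ _ → Σ.fold-swap 2M 3 (λ j₂ r → ∑ℤ (λ w → H r w (at j₁) (at j₂)))) ⟩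
        ∑ℤ (λ k₁ → ∑ 3 (λ r → ∑ℤ (λ k₂ → ∑ℤ (λ w → H r w k₁ k₂))))
          ≈⟨ Σ.fold-swap 2M 3 (λ j₁ r → ∑ℤ (λ k₂ → ∑ℤ (λ w → H r w (at j₁) k₂))) ⟩
        ∑ 3 (λ r → ∑ℤ (λ k₁ → ∑ℤ (λ k₂ → ∑ℤ (λ w → H r w k₁ k₂))))
          ≈⟨ Σ.fold-cong 3 (λ r _ → slab r) ⟩
        _ ∎
        where
        H : ℕ → ℤ → ℤ → ℤ → Carrier
        H r w k₁ k₂ = F₁ k₁ * (F₂ k₂ * F₃ (w +ℤ (w +ℤ w) +ℤ + r -ℤ k₁ -ℤ k₂))

        slice : ∀ k₁ k₂ → -ℤ + M ≤ℤ k₁ → k₁ ≤ℤ + M → -ℤ + M ≤ℤ k₂ → k₂ ≤ℤ + M →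
          ∑ℤ (λ k₃ → F₁ k₁ * (F₂ k₂ * F₃ k₃)) ≈ ∑ 3 (λ r → ∑ℤ (λ w → H r w k₁ k₂))
        slice k₁ k₂ l₁ u₁ l₂ u₂ = begin
          ∑ℤ (λ k₃ → F₁ k₁ * (F₂ k₂ * F₃ k₃))
            ≈⟨ trans (∑-*ˡ 2M (F₁ k₁) _) (*-congˡ (∑-*ˡ 2M (F₂ k₂) (F₃ ∘ at))) ⟩
          F₁ k₁ * (F₂ k₂ * ∑ℤ F₃)
            ≈⟨ *-congˡ (*-congˡ (regroup₃ k₁ k₂ l₁ u₁ l₂ u₂)) ⟩
          F₁ k₁ * (F₂ k₂ * ∑ 3 (λ r → ∑ℤ (λ w → F₃ (w +ℤ (w +ℤ w) +ℤ + r -ℤ k₁ -ℤ k₂))))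
            ≈⟨ trans (∑-*ˡ 3 (F₁ k₁) (λ r → F₂ k₂ * G r)) (*-congˡ (∑-*ˡ 3 (F₂ k₂) G)) ⟨
          ∑ 3 (λ r → F₁ k₁ * (F₂ k₂ * ∑ℤ (λ w → F₃ (w +ℤ (w +ℤ w) +ℤ + r -ℤ k₁ -ℤ k₂))))
            ≈⟨ Σ.fold-cong 3 (λ r _ → trans (∑-*ˡ 2M (F₁ k₁) (λ j → F₂ k₂ * g r (at j))) (*-congˡ (∑-*ˡ 2M (F₂ k₂) (g r ∘ at)))) ⟨
          ∑ 3 (λ r → ∑ℤ (λ w → H r w k₁ k₂)) ∎
          where
          g : ℕ → ℤ → Carrier
          g r w = F₃ (w +ℤ (w +ℤ w) +ℤ + r -ℤ k₁ -ℤ k₂)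
          G : ℕ → Carrier
          G r = ∑ℤ (g r)

        straighten : ∀ r w α β → w +ℤ (w +ℤ w) +ℤ r -ℤ (α +ℤ w) -ℤ (β +ℤ w) ≡ r -ℤ α -ℤ β +ℤ w
        straighten = solve-∀

        layer : ∀ r {j} → j < 2M → ∑ℤ (λ k₁ → ∑ℤ (λ k₂ → H r (at j) k₁ k₂)) ≈
          ∑ 4M (λ α → ∑ 4M (λ β → F₁ (at₂ α +ℤ at j) * (F₂ (at₂ β +ℤ at j) * F₃ (+ r -ℤ at₂ α -ℤ at₂ β +ℤ at j))))
        layer r {j} l = begin
          ∑ℤ (λ k₁ → ∑ℤ (λ k₂ → H r (at j) k₁ k₂))
            ≈⟨ recenter (λ k₁ far → Σ.fold-ε 2M (λ j₂ _ → *-smallˡ (λ k → F₂ (at j₂) * F₃ (at j +ℤ (at j +ℤ at j) +ℤ + r -ℤ k -ℤ at j₂)) small₁ k₁ far)) l ⟩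
          ∑ 4M (λ α → ∑ℤ (λ k₂ → H r (at j) (at₂ α +ℤ at j) k₂))
            ≈⟨ Σ.fold-cong 4M (λ α _ → recenter (λ k₂ far → trans (*-congˡ (*-smallˡ (λ k → F₃ (at j +ℤ (at j +ℤ at j) +ℤ + r -ℤ (at₂ α +ℤ at j) -ℤ k)) small₂ k₂ far)) (zeroʳ _)) l) ⟩
          ∑ 4M (λ α → ∑ 4M (λ β → H r (at j) (at₂ α +ℤ at j) (at₂ β +ℤ at j)))
            ≈⟨ Σ.fold-cong 4M (λ α _ → Σ.fold-cong 4M (λ β _ → *-congˡ (*-congˡ (reflexive (≡.cong F₃ (straighten (+ r) (at j) (at₂ α) (at₂ β))))))) ⟩
          _ ∎

        slab : ∀ r → ∑ℤ (λ k₁ → ∑ℤ (λ k₂ → ∑ℤ (λ w → H r w k₁ k₂))) ≈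
          ∑ 4M (λ α → ∑ 4M (λ β → ∑ℤ (λ w → F₁ (at₂ α +ℤ w) * (F₂ (at₂ β +ℤ w) * F₃ (+ r -ℤ at₂ α -ℤ at₂ β +ℤ w)))))
        slab r = begin
          ∑ℤ (λ k₁ → ∑ℤ (λ k₂ → ∑ℤ (λ w → H r w k₁ k₂)))
            ≈⟨ Σ.fold-cong 2M (λ j₁ _ → Σ.fold-swap 2M 2M _) ⟩
          ∑ℤ (λ k₁ → ∑ℤ (λ w → ∑ℤ (λ k₂ → H r w k₁ k₂)))
            ≈⟨ Σ.fold-swap 2M 2M _ ⟩
          ∑ℤ (λ w → ∑ℤ (λ k₁ → ∑ℤ (λ k₂ → H r w k₁ k₂)))
            ≈⟨ Σ.fold-cong 2M (λ j l → layer r l) ⟩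
          ∑ℤ (λ w → ∑ 4M (λ α → ∑ 4M (λ β → F₁ (at₂ α +ℤ w) * (F₂ (at₂ β +ℤ w) * F₃ (+ r -ℤ at₂ α -ℤ at₂ β +ℤ w)))))
            ≈⟨ Σ.fold-swap 2M 4M _ ⟩
          ∑ 4M (λ α → ∑ℤ (λ w → ∑ 4M (λ β → F₁ (at₂ α +ℤ w) * (F₂ (at₂ β +ℤ w) * F₃ (+ r -ℤ at₂ α -ℤ at₂ β +ℤ w)))))
            ≈⟨ Σ.fold-cong 4M (λ α _ → Σ.fold-swap 2M 4M _) ⟩
          _ ∎

    -- Euler products as theta products

    f : ℕ → Carrier
    f t = AP∞ t t

    f-regular : ∀ t .{{_ : NonZero t}} → Regular (f t)
    f-regular t = AP-regular t t M

    theta : ℕ → ℕ → Carrier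
    theta a c = ∑ℤ (θ-term a c)

    -- Exponents combine by `θ-exp-diagonal`. Each sign gains the factor σ = (-1)^w, and σ³ = σ, so
    -- the line through a base point again carries a signed theta series.
    θ-diagonal : ∀ r s → r +ℕ s ≡ 2 → ∀ α β w →
      θ-term 1 6 (α +ℤ w) * (θ-term 2 5 (β +ℤ w) * θ-term 4 3 (+ r -ℤ α -ℤ β +ℤ w))
      ≈ θ-term 1 6 α * (θ-term 2 5 β * θ-term 4 3 (+ r -ℤ α -ℤ β)) * θ-term (7 *ℕ suc r) (7 *ℕ s) w
    θ-diagonal r s r+s≡2 α β w = begin
      sgn ∣ α +ℤ w ∣ * q^ e₁ * (sgn ∣ β +ℤ w ∣ * q^ e₂ * (sgn ∣ γ +ℤ w ∣ * q^ e₃))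
        ≈⟨ gather (sgn ∣ α +ℤ w ∣) (q^ e₁) (sgn ∣ β +ℤ w ∣) (q^ e₂) (sgn ∣ γ +ℤ w ∣) (q^ e₃) ⟩
      sgn ∣ α +ℤ w ∣ * (sgn ∣ β +ℤ w ∣ * sgn ∣ γ +ℤ w ∣) * (q^ e₁ * (q^ e₂ * q^ e₃))
        ≈⟨ *-cong signs powers ⟩
      sgn ∣ α ∣ * (sgn ∣ β ∣ * sgn ∣ γ ∣) * sgn ∣ w ∣ * (q^ d₁ * (q^ d₂ * q^ d₃) * q^ d₄)
        ≈⟨ solve 4 (λ a b c d → a :* b :* (c :* d) := a :* c :* (b :* d)) refl
             (sgn ∣ α ∣ * (sgn ∣ β ∣ * sgn ∣ γ ∣)) (sgn ∣ w ∣) (q^ d₁ * (q^ d₂ * q^ d₃)) (q^ d₄) ⟩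
      sgn ∣ α ∣ * (sgn ∣ β ∣ * sgn ∣ γ ∣) * (q^ d₁ * (q^ d₂ * q^ d₃)) * (sgn ∣ w ∣ * q^ d₄)
        ≈⟨ *-congʳ (gather (sgn ∣ α ∣) (q^ d₁) (sgn ∣ β ∣) (q^ d₂) (sgn ∣ γ ∣) (q^ d₃)) ⟨
      sgn ∣ α ∣ * q^ d₁ * (sgn ∣ β ∣ * q^ d₂ * (sgn ∣ γ ∣ * q^ d₃)) * (sgn ∣ w ∣ * q^ d₄) ∎
      where
      γ = + r -ℤ α -ℤ β
      e₁ = θ-exp 1 6 (α +ℤ w)
      e₂ = θ-exp 2 5 (β +ℤ w)
      e₃ = θ-exp 4 3 (γ +ℤ w)
      d₁ = θ-exp 1 6 α
      d₂ = θ-exp 2 5 β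
      d₃ = θ-exp 4 3 γ
      d₄ = θ-exp (7 *ℕ suc r) (7 *ℕ s) w
      gather : ∀ a x b y c z → a * x * (b * y * (c * z)) ≈ a * (b * c) * (x * (y * z))
      gather = solve 6 (λ a x b y c z → a :* x :* (b :* y :* (c :* z)) := a :* (b :* c) :* (x :* (y :* z))) refl
      powers : q^ e₁ * (q^ e₂ * q^ e₃) ≈ q^ d₁ * (q^ d₂ * q^ d₃) * q^ d₄
      powers = begin
        q^ e₁ * (q^ e₂ * q^ e₃)                 ≈⟨ trans (q^-+ e₁ _) (*-congˡ (q^-+ e₂ e₃)) ⟨
        q^ (e₁ +ℕ (e₂ +ℕ e₃))                   ≡⟨ ≡.cong q^ (θ-exp-diagonal r s α β w r+s≡2) ⟩
        q^ (d₁ +ℕ (d₂ +ℕ d₃) +ℕ d₄)             ≈⟨ trans (q^-+ _ d₄) (*-congʳ (trans (q^-+ d₁ _) (*-congˡ (q^-+ d₂ d₃)))) ⟩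
        q^ d₁ * (q^ d₂ * q^ d₃) * q^ d₄         ∎
      signs : sgn ∣ α +ℤ w ∣ * (sgn ∣ β +ℤ w ∣ * sgn ∣ γ +ℤ w ∣) ≈ sgn ∣ α ∣ * (sgn ∣ β ∣ * sgn ∣ γ ∣) * sgn ∣ w ∣
      signs = begin
        sgn ∣ α +ℤ w ∣ * (sgn ∣ β +ℤ w ∣ * sgn ∣ γ +ℤ w ∣) ≈⟨ *-cong (sgn-+ α w) (*-cong (sgn-+ β w) (sgn-+ γ w)) ⟩
        sgn ∣ α ∣ * σ * (sgn ∣ β ∣ * σ * (sgn ∣ γ ∣ * σ))
          ≈⟨ solve 4 (λ a b c s → a :* s :* (b :* s :* (c :* s)) := a :* (b :* c) :* s :* (s :* s)) refl (sgn ∣ α ∣) (sgn ∣ β ∣) (sgn ∣ γ ∣) σ ⟩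
        sgn ∣ α ∣ * (sgn ∣ β ∣ * sgn ∣ γ ∣) * σ * (σ * σ) ≈⟨ *-congˡ (sgn² ∣ w ∣) ⟩
        sgn ∣ α ∣ * (sgn ∣ β ∣ * sgn ∣ γ ∣) * σ * 1#      ≈⟨ *-identityʳ _ ⟩
        sgn ∣ α ∣ * (sgn ∣ β ∣ * sgn ∣ γ ∣) * σ           ∎
        where
        σ = sgn ∣ w ∣
        sgn² : ∀ n → sgn n * sgn n ≈ 1#
        sgn² zero    = *-identityˡ 1#
        sgn² (suc n) = trans (sym (-‿distribˡ-* _ _)) (trans (-‿cong (sym (-‿distribʳ-* _ _)))
          (trans (-‿involutive _) (sgn² n)))

    -- Euler's pentagonal number theorem in q⁷: the progressions 7, 14, 21 modulo 21 together run
    -- over all multiples of 7.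
    theta-7-14 : theta 7 14 ≈ f 7
    theta-7-14 = begin
      theta 7 14                                    ≈⟨ triple-product 7 14 ⟨
      AP∞ 7 21 * AP∞ 14 21 * AP∞ 21 21              ≈⟨ solve 3 (λ a b c → a :* b :* c := a :* (b :* (c :* con 1))) refl (AP∞ 7 21) (AP∞ 14 21) (AP∞ 21 21) ⟩
      AP∞ 7 21 * (AP∞ 14 21 * (AP∞ 21 21 * 1#))     ≈⟨ AP∞-dissect 3 7 7 ⟨
      f 7                                           ∎

    theta-14-7 : theta 14 7 ≈ f 7
    theta-14-7 = begin
      theta 14 7                                    ≈⟨ triple-product 14 7 ⟨
      AP∞ 14 21 * AP∞ 7 21 * AP∞ 21 21              ≈⟨ *-congʳ (*-comm _ _) ⟩
      AP∞ 7 21 * AP∞ 14 21 * AP∞ 21 21              ≈⟨ triple-product 7 14 ⟩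
      theta 7 14                                    ≈⟨ theta-7-14 ⟩
      f 7                                           ∎

    -- k ↦ -1 - k reverses the signs of the terms, so the sum equals its negative.
    theta-a-0 : ∀ a → theta a 0 ≈ 0#
    theta-a-0 a = begin
      -- The mirror only yields 2x = 0; with 3x = 0 this gives x = 3x - 2x = 0.
      x             ≈⟨ solve 1 (λ x → x := x :+ con 0) refl x ⟩
      x + 0#        ≈⟨ +-congˡ 2x≈0 ⟨
      x + (x + x)   ≈⟨ solve 1 (λ x → x :+ (x :+ x) := (con 1 :+ con 1 :+ con 1) :* x) refl x ⟩
      (1# + 1# + 1#) * x ≈⟨ trans (*-congʳ char3) (zeroˡ x) ⟩
      0#            ∎
      where
      x = theta a 0
      mirror : ∀ i j → suc (i +ℕ j) ≡ M +ℕ M → θ-term a 0 (-ℤ + M +ℤ + i) ≈ - 1# * θ-term a 0 (-ℤ + M +ℤ + j)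
      mirror i j 1+i+j≡2M = begin
        θ-term a 0 (-ℤ + M +ℤ + i)  ≡⟨ ≡.cong (θ-term a 0) position ⟩
        θ-term a 0 (-ℤ + 1 -ℤ k)    ≈⟨ *-cong sign (reflexive (≡.cong q^ (θ-exp-mirror a k))) ⟩
        - 1# * sgn ∣ k ∣ * q^ (θ-exp a 0 k) ≈⟨ *-assoc _ _ _ ⟩
        - 1# * θ-term a 0 k         ∎
        where
        k = -ℤ + M +ℤ + j
        split : ∀ m i j → -ℤ m +ℤ i ≡ -ℤ m +ℤ (+ 1 +ℤ (i +ℤ j)) -ℤ + 1 -ℤ j
        split = solve-∀
        merge : ∀ m j → -ℤ m +ℤ (m +ℤ m) -ℤ + 1 -ℤ j ≡ -ℤ + 1 -ℤ (-ℤ m +ℤ j)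
        merge = solve-∀
        position : -ℤ + M +ℤ + i ≡ -ℤ + 1 -ℤ k
        position = ≡.trans (split (+ M) (+ i) (+ j)) (≡.trans (≡.cong (λ n → -ℤ + M +ℤ + n -ℤ + 1 -ℤ + j) 1+i+j≡2M) (merge (+ M) (+ j)))
        sign : sgn ∣ -ℤ + 1 -ℤ k ∣ ≈ - 1# * sgn ∣ k ∣
        sign = trans (sgn-+ (-ℤ + 1) (-ℤ k)) (*-congˡ (reflexive (≡.cong sgn (ℤ.∣-i∣≡∣i∣ k))))
      x≈-x : x ≈ - 1# * x
      x≈-x = trans (Σ.fold-reverse (M +ℕ M) _ _ mirror) (∑-*ˡ (M +ℕ M) (- 1#) _)
      2x≈0 : x + x ≈ 0#
      2x≈0 = begin
        x + x              ≈⟨ +-congˡ x≈-x ⟩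
        x + - 1# * x       ≈⟨ solve 2 (λ m x → x :+ m :* x := (con 1 :+ m) :* x) refl (- 1#) x ⟩
        (1# + - 1#) * x    ≈⟨ trans (*-congʳ (-‿inverseʳ 1#)) (zeroˡ x) ⟩
        0#                 ∎

    -- Modulo 4, f₁ supplies the classes 1, 2, 3, 0 and f₂ supplies 2, 0, which regroup into the
    -- triples 1, 3, 0 and 2, 2, 0.
    f₁f₂-as-1+4 : f 1 * f 2 ≈ theta 1 3 * theta 2 2
    f₁f₂-as-1+4 = begin
      f 1 * f 2 ≈⟨ *-cong (AP∞-dissect 4 1 1) (AP∞-dissect 2 2 2) ⟩
      AP∞ 1 4 * (AP∞ 2 4 * (AP∞ 3 4 * (AP∞ 4 4 * 1#))) * (AP∞ 2 4 * (AP∞ 4 4 * 1#))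
        ≈⟨ solve 4 (λ a b c d → a :* (b :* (c :* (d :* con 1))) :* (b :* (d :* con 1)) := a :* c :* d :* (b :* b :* d)) refl
             (AP∞ 1 4) (AP∞ 2 4) (AP∞ 3 4) (AP∞ 4 4) ⟩
      AP∞ 1 4 * AP∞ 3 4 * AP∞ 4 4 * (AP∞ 2 4 * AP∞ 2 4 * AP∞ 4 4)
        ≈⟨ *-cong (triple-product 1 3) (triple-product 2 2) ⟩
      theta 1 3 * theta 2 2 ∎

    -- Euler's pentagonal number theorem for each factor, in base 3 and base 6.
    f₁f₂-as-1+2 : f 1 * f 2 ≈ theta 1 2 * theta 2 4
    f₁f₂-as-1+2 = begin
      f 1 * f 2 ≈⟨ *-cong (AP∞-dissect 3 1 1) (AP∞-dissect 3 2 2) ⟩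
      AP∞ 1 3 * (AP∞ 2 3 * (AP∞ 3 3 * 1#)) * (AP∞ 2 6 * (AP∞ 4 6 * (AP∞ 6 6 * 1#)))
        ≈⟨ solve 6 (λ a b c d e g → a :* (b :* (c :* con 1)) :* (d :* (e :* (g :* con 1))) := a :* b :* c :* (d :* e :* g)) refl
             (AP∞ 1 3) (AP∞ 2 3) (AP∞ 3 3) (AP∞ 2 6) (AP∞ 4 6) (AP∞ 6 6) ⟩
      AP∞ 1 3 * AP∞ 2 3 * AP∞ 3 3 * (AP∞ 2 6 * AP∞ 4 6 * AP∞ 6 6)
        ≈⟨ *-cong (triple-product 1 2) (triple-product 2 4) ⟩
      theta 1 2 * theta 2 4 ∎

    -- Modulo 5 the pairs 1, 4 and 2, 3 each need a copy of class 0; f₁ provides one and f₅ the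
    -- other.
    f₁f₅-product : f 1 * f 5 ≈ theta 1 4 * theta 2 3
    f₁f₅-product = begin
      f 1 * f 5 ≈⟨ *-congʳ (AP∞-dissect 5 1 1) ⟩
      AP∞ 1 5 * (AP∞ 2 5 * (AP∞ 3 5 * (AP∞ 4 5 * (AP∞ 5 5 * 1#)))) * AP∞ 5 5
        ≈⟨ solve 5 (λ a b c d e → a :* (b :* (c :* (d :* (e :* con 1)))) :* e := a :* d :* e :* (b :* c :* e)) refl
             (AP∞ 1 5) (AP∞ 2 5) (AP∞ 3 5) (AP∞ 4 5) (AP∞ 5 5) ⟩
      AP∞ 1 5 * AP∞ 4 5 * AP∞ 5 5 * (AP∞ 2 5 * AP∞ 3 5 * AP∞ 5 5)
        ≈⟨ *-cong (triple-product 1 4) (triple-product 2 3) ⟩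
      theta 1 4 * theta 2 3 ∎

    f₇f₁f₇-product : f 7 * (f 1 * f 7) ≈ theta 1 6 * (theta 2 5 * theta 4 3)
    f₇f₁f₇-product = begin
      f 7 * (f 1 * f 7) ≈⟨ *-congˡ (*-congʳ (AP∞-dissect 7 1 1)) ⟩
      f 7 * (AP∞ 1 7 * (AP∞ 2 7 * (AP∞ 3 7 * (AP∞ 4 7 * (AP∞ 5 7 * (AP∞ 6 7 * (f 7 * 1#)))))) * f 7)
        ≈⟨ solve 7 (λ a b c d e g h → h :* (a :* (b :* (c :* (d :* (e :* (g :* (h :* con 1)))))) :* h)
             := a :* g :* h :* (b :* e :* h :* (d :* c :* h))) refl
             (AP∞ 1 7) (AP∞ 2 7) (AP∞ 3 7) (AP∞ 4 7) (AP∞ 5 7) (AP∞ 6 7) (f 7) ⟩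
      AP∞ 1 7 * AP∞ 6 7 * f 7 * (AP∞ 2 7 * AP∞ 5 7 * f 7 * (AP∞ 4 7 * AP∞ 3 7 * f 7))
        ≈⟨ *-cong (triple-product 1 6) (*-cong (triple-product 2 5) (triple-product 4 3)) ⟩
      theta 1 6 * (theta 2 5 * theta 4 3) ∎

    hexagonal : ℕ → Carrier
    hexagonal r = ∑ 4M (λ α → ∑ 4M (λ β → θ-term 1 6 (at₂ α) * (θ-term 2 5 (at₂ β) * θ-term 4 3 (+ r -ℤ at₂ α -ℤ at₂ β))))
      where open TripleSum (θ-term-high 1 6) (θ-term-high 2 5) (θ-term-high 4 3)

    -- The Macdonald identity of type A₂ at (q , q² , q⁴), with base q⁷.
    f₁f₇-hexagonal : f 1 * f 7 ≈ hexagonal 0 + hexagonal 1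
    f₁f₇-hexagonal = cancel (f-regular 7) (begin
      f 7 * (f 1 * f 7) ≈⟨ f₇f₁f₇-product ⟩
      theta 1 6 * (theta 2 5 * theta 4 3) ≈⟨ product-regroup ⟩
      ∑ 3 line ≈⟨ +-cong (factor 0 2 ≡.refl) (+-cong (factor 1 1 ≡.refl) (+-congʳ (factor 2 0 ≡.refl))) ⟩
      hexagonal 0 * theta 7 14 + (hexagonal 1 * theta 14 7 + (hexagonal 2 * theta 21 0 + 0#))
        ≈⟨ +-cong (*-congˡ theta-7-14) (+-cong (*-congˡ theta-14-7) (+-congʳ (*-congˡ (theta-a-0 21)))) ⟩
      hexagonal 0 * f 7 + (hexagonal 1 * f 7 + (hexagonal 2 * 0# + 0#))
        ≈⟨ solve 4 (λ a b c h → a :* h :+ (b :* h :+ (c :* con 0 :+ con 0)) := h :* (a :+ b)) refl (hexagonal 0) (hexagonal 1) (hexagonal 2) (f 7) ⟩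
      f 7 * (hexagonal 0 + hexagonal 1) ∎)
      where
      open TripleSum (θ-term-high 1 6) (θ-term-high 2 5) (θ-term-high 4 3)
      line : ℕ → Carrier
      line r = ∑ 4M (λ α → ∑ 4M (λ β → ∑ℤ (λ w →
        θ-term 1 6 (at₂ α +ℤ w) * (θ-term 2 5 (at₂ β +ℤ w) * θ-term 4 3 (+ r -ℤ at₂ α -ℤ at₂ β +ℤ w)))))
      factor : ∀ r s → r +ℕ s ≡ 2 → line r ≈ hexagonal r * theta (7 *ℕ suc r) (7 *ℕ s)
      factor r s r+s≡2 = begin
        line r
          ≈⟨ Σ.fold-cong 4M (λ α _ → Σ.fold-cong 4M (λ β _ →
               trans (Σ.fold-cong (M +ℕ M) (λ j _ → θ-diagonal r s r+s≡2 (at₂ α) (at₂ β) (at j)))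
                     (∑-*ˡ (M +ℕ M) (base α β) (λ j → θ-term (7 *ℕ suc r) (7 *ℕ s) (at j))))) ⟩
        ∑ 4M (λ α → ∑ 4M (λ β → base α β * t))
          ≈⟨ Σ.fold-cong 4M (λ α _ → ∑-*ʳ 4M t (base α)) ⟩
        ∑ 4M (λ α → ∑ 4M (base α) * t)
          ≈⟨ ∑-*ʳ 4M t (λ α → ∑ 4M (base α)) ⟩
        hexagonal r * t ∎
        where
        t = theta (7 *ℕ suc r) (7 *ℕ s)
        base : ℕ → ℕ → Carrier
        base α β = θ-term 1 6 (at₂ α) * (θ-term 2 5 (at₂ β) * θ-term 4 3 (+ r -ℤ at₂ α -ℤ at₂ β))

    -- The additive group generated by the powers q^e with e in D, closed under equality in the
    -- ring. It records which exponents may occur and forgets the coefficients, which is enough to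
    -- show that a coefficient vanishes.
    data Span (D : ℕ → Set) : Carrier → Set where
      power : ∀ {e} → D e → Span D (q^ e)
      zero# : Span D 0#
      plus  : ∀ {x y} → Span D x → Span D y → Span D (x + y)
      minus : ∀ {x} → Span D x → Span D (- x)
      resp  : ∀ {x y} → x ≈ y → Span D x → Span D y

    Span-∑ : ∀ {D} n {g} → (∀ i → Span D (g i)) → Span D (∑ n g)
    Span-∑ zero    s = zero#
    Span-∑ (suc n) s = plus (s 0) (Span-∑ n (s ∘ suc))

    Span-sgn : ∀ {D x} n → Span D x → Span D (sgn n * x)
    Span-sgn {x = x} n s with sgn-±1 n
    ... | inj₁ eq = resp (sym (trans (*-congʳ eq) (*-identityˡ x))) s
    ... | inj₂ eq = resp (trans (-‿cong (sym (*-identityˡ x))) (trans (-‿distribˡ-* 1# x) (*-congʳ (sym eq)))) (minus s)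

    Span-θθ : ∀ {D} a c a′ c′ k k′ → D (θ-exp a c k +ℕ θ-exp a′ c′ k′) → Span D (θ-term a c k * θ-term a′ c′ k′)
    Span-θθ a c a′ c′ k k′ d = resp
      (trans (*-congˡ (*-congˡ (q^-+ _ _)))
        (solve 4 (λ s t x y → s :* (t :* (x :* y)) := s :* x :* (t :* y)) refl (sgn ∣ k ∣) (sgn ∣ k′ ∣) (q^ (θ-exp a c k)) (q^ (θ-exp a′ c′ k′))))
      (Span-sgn ∣ k ∣ (Span-sgn ∣ k′ ∣ (power d)))

    Span-θθθ : ∀ {D} a c a′ c′ a″ c″ k k′ k″ → D (θ-exp a c k +ℕ (θ-exp a′ c′ k′ +ℕ θ-exp a″ c″ k″)) →
      Span D (θ-term a c k * (θ-term a′ c′ k′ * θ-term a″ c″ k″))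
    Span-θθθ a c a′ c′ a″ c″ k k′ k″ d = resp
      (trans (*-congˡ (*-congˡ (*-congˡ (trans (q^-+ _ _) (*-congˡ (q^-+ _ _))))))
        (solve 6 (λ s t u x y z → s :* (t :* (u :* (x :* (y :* z)))) := s :* x :* (t :* y :* (u :* z))) refl
          (sgn ∣ k ∣) (sgn ∣ k′ ∣) (sgn ∣ k″ ∣) (q^ (θ-exp a c k)) (q^ (θ-exp a′ c′ k′)) (q^ (θ-exp a″ c″ k″))))
      (Span-sgn ∣ k ∣ (Span-sgn ∣ k′ ∣ (Span-sgn ∣ k″ ∣ (power d))))

    Span-theta² : ∀ a c a′ c′ → Span (TwoTheta a c a′ c′) (theta a c * theta a′ c′)
    Span-theta² a c a′ c′ = resp
      (trans (Σ.fold-cong 2M (λ i _ → ∑-*ˡ 2M (g i) g′)) (∑-*ʳ 2M (theta a′ c′) g))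
      (Span-∑ 2M (λ i → Span-∑ 2M (λ j → Span-θθ a c a′ c′ (at i) (at j) (at i , at j , ≡.refl))))
      where
      2M = M +ℕ M
      at : ℕ → ℤ
      at j = -ℤ + M +ℤ + j
      g g′ : ℕ → Carrier
      g i = θ-term a c (at i)
      g′ i = θ-term a′ c′ (at i)

    Span-f₁f₂-as-1+4 : Span (TwoTheta 1 3 2 2) (f 1 * f 2)
    Span-f₁f₂-as-1+4 = resp (sym f₁f₂-as-1+4) (Span-theta² 1 3 2 2)

    Span-f₁f₂-as-1+2 : Span (TwoTheta 1 2 2 4) (f 1 * f 2)
    Span-f₁f₂-as-1+2 = resp (sym f₁f₂-as-1+2) (Span-theta² 1 2 2 4)

    Span-f₁f₅ : Span (TwoTheta 1 4 2 3) (f 1 * f 5)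
    Span-f₁f₅ = resp (sym f₁f₅-product) (Span-theta² 1 4 2 3)

    Span-f₁f₇ : Span Hexagonal (f 1 * f 7)
    Span-f₁f₇ = resp (sym f₁f₇-hexagonal) (plus (span 0 (ℕ.s≤s ℕ.z≤n)) (span 1 (ℕ.s≤s (ℕ.s≤s ℕ.z≤n))))
      where
      open TripleSum (θ-term-high 1 6) (θ-term-high 2 5) (θ-term-high 4 3)
      span : ∀ r → r < 2 → Span Hexagonal (hexagonal r)
      span r r<2 = Span-∑ 4M (λ α → Span-∑ 4M (λ β → Span-θθθ 1 6 2 5 4 3 (at₂ α) (at₂ β) (+ r -ℤ at₂ α -ℤ at₂ β) (r , r<2 , at₂ α , at₂ β , ≡.refl)))

    -- Frobenius in characteristic 3, factor by factor: (1 + y)³ = 1 + y³ + 3 (y + y²) with y =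
    -- -q^e.
    f₃≈f₁³ : f 3 ≈ f 1 * (f 1 * f 1)
    f₃≈f₁³ = begin
      ∏ M (λ i → 1-q^ (3 +ℕ 3 *ℕ i)) ≈⟨ Π.fold-cong M (λ i _ → frobenius i) ⟩
      ∏ M (λ i → g i * (g i * g i))  ≈⟨ trans (Π.fold-∙ M g _) (*-congˡ (Π.fold-∙ M g g)) ⟩
      f 1 * (f 1 * f 1)              ∎
      where
      g : ℕ → Carrier
      g i = 1-q^ (1 +ℕ 1 *ℕ i)
      triple : ∀ i → 3 +ℕ 3 *ℕ i ≡ (1 +ℕ 1 *ℕ i) +ℕ ((1 +ℕ 1 *ℕ i) +ℕ (1 +ℕ 1 *ℕ i))
      triple = solveℕ-∀
      frobenius : ∀ i → 1-q^ (3 +ℕ 3 *ℕ i) ≈ g i * (g i * g i)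
      frobenius i = begin
        1# + - q^ (3 +ℕ 3 *ℕ i)     ≈⟨ +-congˡ (-‿cong (trans (reflexive (≡.cong q^ (triple i))) (trans (q^-+ e _) (*-congˡ (q^-+ e e))))) ⟩
        1# + - (x * (x * x))        ≈⟨ +-congˡ cube ⟩
        1# + y * (y * y)            ≈⟨ +-identityʳ _ ⟨
        1# + y * (y * y) + 0#       ≈⟨ +-congˡ (trans (*-congʳ char3) (zeroˡ _)) ⟨
        1# + y * (y * y) + (1# + 1# + 1#) * (y + y * y)
          ≈⟨ solve 1 (λ y → con 1 :+ y :* (y :* y) :+ (con 1 :+ con 1 :+ con 1) :* (y :+ y :* y)
               := (con 1 :+ y) :* ((con 1 :+ y) :* (con 1 :+ y))) refl y ⟩
        g i * (g i * g i)           ∎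
        where
        e = 1 +ℕ 1 *ℕ i
        x = q^ e
        y = - x
        cube : - (x * (x * x)) ≈ y * (y * y)
        cube = trans (-‿distribˡ-* x (x * x)) (*-congˡ (trans (sym (-‿involutive (x * x)))
          (trans (-‿cong (-‿distribˡ-* x x)) (-‿distribʳ-* y x))))

    -- Euler products of partitions with restricted parts

    module _ (u : ℕ) where
      -- The product of 1 - q^i over i ≤ m with u not dividing i, and the complementary product over
      -- multiples of u. For composite u, the first condition is weaker than being coprime to u. The
      -- recursion matches that of `partsBounded`.
      coprimePart multiplePart : ℕ → Carrier
      coprimePart zero = 1#
      coprimePart (suc m) with u ∣? suc m
      ... | yes _ = coprimePart m
      ... | no  _ = coprimePart m * 1-q^ (suc m)

      coprimePart-∣ : ∀ {m} → u ∣ suc m → coprimePart (suc m) ≈ coprimePart m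
      coprimePart-∣ {m} u∣ with u ∣? suc m
      ... | yes _ = refl
      ... | no u∤ = contradiction u∣ u∤

      coprimePart-∤ : ∀ {m} → ¬ u ∣ suc m → coprimePart (suc m) ≈ coprimePart m * 1-q^ (suc m)
      coprimePart-∤ {m} u∤ with u ∣? suc m
      ... | yes u∣ = contradiction u∣ u∤
      ... | no _   = refl

      multiplePart zero = 1#
      multiplePart (suc m) with u ∣? suc m
      ... | yes _ = multiplePart m * 1-q^ (suc m)
      ... | no  _ = multiplePart m

      coprimePart-multiplePart : ∀ m → coprimePart m * multiplePart m ≈ AP 1 1 m
      coprimePart-multiplePart zero = *-identityˡ 1#
      coprimePart-multiplePart (suc m) = trans step (trans (*-congʳ (coprimePart-multiplePart m)) (trans
        (*-congˡ (reflexive (≡.cong (1-q^ ∘ suc) (≡.sym (ℕ.*-identityˡ m))))) (sym (AP-suc 1 1 m))))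
        where
        step : coprimePart (suc m) * multiplePart (suc m) ≈ coprimePart m * multiplePart m * 1-q^ (suc m)
        step with u ∣? suc m
        ... | yes _ = sym (*-assoc _ _ _)
        ... | no  _ = solve 3 (λ x y z → x :* z :* y := x :* y :* z) refl (coprimePart m) (multiplePart m) (1-q^ (suc m))

    multiplePart≈AP : ∀ u k .{{_ : NonZero u}} → multiplePart u (u *ℕ k) ≈ AP u u k
    multiplePart≈AP (suc v) zero rewrite ℕ.*-zeroʳ v = refl
    multiplePart≈AP u@(suc v) (suc k) = begin
      multiplePart u (u *ℕ suc k)                       ≡⟨ ≡.cong (multiplePart u) (last v k) ⟩
      multiplePart u (suc (u *ℕ k +ℕ v))                ≈⟨ hit ⟩
      multiplePart u (u *ℕ k +ℕ v) * 1-q^ (suc (u *ℕ k +ℕ v))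
        ≈⟨ *-cong (trans (gap v (ℕ.n<1+n v)) (multiplePart≈AP u k)) (reflexive (≡.cong 1-q^ (≡.trans (≡.sym (last v k)) (ℕ.*-suc u k)))) ⟩
      AP u u k * 1-q^ (u +ℕ u *ℕ k)                     ≈⟨ AP-suc u u k ⟨
      AP u u (suc k)                                    ∎
      where
      last : ∀ v k → suc v *ℕ suc k ≡ suc (suc v *ℕ k +ℕ v)
      last = solveℕ-∀
      hit : multiplePart u (suc (u *ℕ k +ℕ v)) ≈ multiplePart u (u *ℕ k +ℕ v) * 1-q^ (suc (u *ℕ k +ℕ v))
      hit with u ∣? suc (u *ℕ k +ℕ v)
      ... | yes _ = refl
      ... | no u∤ = contradiction (≡.subst (u ∣_) (last v k) (m∣m*n (suc k))) u∤
      gap : ∀ r → r < u → multiplePart u (u *ℕ k +ℕ r) ≈ multiplePart u (u *ℕ k)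
      gap zero    _     = reflexive (≡.cong (multiplePart u) (ℕ.+-identityʳ (u *ℕ k)))
      gap (suc r) 1+r<u rewrite ℕ.+-suc (u *ℕ k) r with u ∣? suc (u *ℕ k +ℕ r)
      ... | yes u∣ = contradiction (∣m+n∣m⇒∣n (≡.subst (u ∣_) (≡.sym (ℕ.+-suc (u *ℕ k) r)) u∣) (m∣m*n k)) (>⇒∤ 1+r<u)
      ... | no  _  = gap r (ℕ.<-trans (ℕ.n<1+n r) 1+r<u)

    -- Up to u M the multiples of u contribute exactly the M factors of `f u`, so the other factors
    -- represent f₁ / f_u.
    coprimePart-f : ∀ u .{{_ : NonZero u}} → coprimePart u (u *ℕ M) * f u ≈ f 1
    coprimePart-f u = begin
      coprimePart u (u *ℕ M) * f u                       ≈⟨ *-congˡ (multiplePart≈AP u M) ⟨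
      coprimePart u (u *ℕ M) * multiplePart u (u *ℕ M)   ≈⟨ coprimePart-multiplePart u (u *ℕ M) ⟩
      AP 1 1 (u *ℕ M)                                    ≈⟨ AP-stable 1 1 (u *ℕ M) (ℕ.m≤n*m M u) ⟩
      f 1                                                ∎

    -- Here x and y stand for f₃ / f₁ and f_v / f₁. Multiplying by the regular element f₁² avoids
    -- the quotients, and f₃ = f₁³ leaves f₁ f_v.
    bipartition-product : ∀ v .{{_ : NonZero v}} {x y} → x * coprimePart 3 (3 *ℕ M) ≈ 1# → y * coprimePart v (v *ℕ M) ≈ 1# →
      x * y ≈ f 1 * f v
    bipartition-product v {x} {y} x-inv y-inv = cancel (*-regular (f-regular 1) (f-regular 1)) (begin
      f 1 * f 1 * (x * y)  ≈⟨ *-congʳ (*-cong (coprimePart-f 3) (coprimePart-f v)) ⟨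
      c₃ * f 3 * (cᵥ * f v) * (x * y)
        ≈⟨ solve 6 (λ c a d b x y → c :* a :* (d :* b) :* (x :* y) := (x :* c) :* (y :* d) :* (a :* b)) refl c₃ (f 3) cᵥ (f v) x y ⟩
      (x * c₃) * (y * cᵥ) * (f 3 * f v)  ≈⟨ *-cong (*-cong x-inv y-inv) (*-congʳ f₃≈f₁³) ⟩
      1# * 1# * (f 1 * (f 1 * f 1) * f v)
        ≈⟨ solve 2 (λ a b → con 1 :* con 1 :* (a :* (a :* a) :* b) := a :* a :* (a :* b)) refl (f 1) (f v) ⟩
      f 1 * f 1 * (f 1 * f v) ∎)
      where
      c₃ = coprimePart 3 (3 *ℕ M)
      cᵥ = coprimePart v (v *ℕ M)

    *-1-q^ : ∀ e {x y} → x ≈ y + q^ e * x → x * 1-q^ e ≈ y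
    *-1-q^ e {x} {y} x≈y+qx = begin
      x * 1-q^ e                      ≈⟨ trans (distribˡ x 1# _) (+-congʳ (*-identityʳ x)) ⟩
      x + x * - q^ e                  ≈⟨ +-congʳ x≈y+qx ⟩
      y + q^ e * x + x * - q^ e       ≈⟨ solve 4 (λ x y a b → y :+ a :* x :+ x :* b := y :+ x :* (a :+ b)) refl x y (q^ e) (- q^ e) ⟩
      y + x * (q^ e + - q^ e)         ≈⟨ +-congˡ (trans (*-congˡ (-‿inverseʳ (q^ e))) (zeroʳ x)) ⟩
      y + 0#                          ≈⟨ +-identityʳ y ⟩
      y                               ∎

-- From counted bipartitions to power series

module PartitionSeries where
  open import Data.Nat
  open import Data.Nat.Properties
  open import Data.Nat.DivMod using (m/n≡1+[m∸n]/n; m<n⇒m/n≡0)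
  open import Data.Nat.Divisibility using (_∣_; _∣?_)
  open import Data.Nat.ListAction using (sum)
  open import Data.List using (map; upTo)
  open import Data.List.Properties using (map-upTo; map-cong)
  open import Data.Integer as ℤ using (ℤ; +_)
  import Data.Integer.Properties as ℤ
  open import Data.Integer.Divisibility.Signed using (∣⇒∣ᵤ)
  open import Data.Product using (_,_)
  open import Function using (_∘_)
  open import Relation.Nullary using (¬_; Dec; yes; no; contradiction)
  open import Relation.Binary.PropositionalEquality
  open ≡-Reasoning
  open Series
  open TruncatedPowerRings

  sum-upTo-suc : ∀ (f : ℕ → ℕ) n → sum (map f (upTo (suc n))) ≡ f 0 + sum (map (f ∘ suc) (upTo n))
  sum-upTo-suc f n = cong (λ xs → sum xs) (trans (map-upTo f (suc n)) (cong (f 0 Data.List.∷_) (sym (map-upTo (f ∘ suc) n))))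

  module _ {u m : ℕ} where

    partsBounded-∣ : u ∣ suc m → ∀ n → partsBounded u (suc m) n ≡ partsBounded u m n
    partsBounded-∣ u∣ n with u ∣? suc m
    ... | yes _ = refl
    ... | no u∤ = contradiction u∣ u∤

    multiplicities : ℕ → ℕ
    multiplicities n = sum (map (λ c → partsBounded u m (n ∸ c * suc m)) (upTo (suc (n / suc m))))

    partsBounded-∤ : ¬ u ∣ suc m → ∀ n → partsBounded u (suc m) n ≡ multiplicities n
    partsBounded-∤ u∤ n with u ∣? suc m
    ... | yes u∣ = contradiction u∣ u∤
    ... | no _ = refl

    multiplicities-< : ∀ {n} → n < suc m → multiplicities n ≡ partsBounded u m n
    multiplicities-< {n} n<1+m = begin
      multiplicities n                              ≡⟨ cong (λ d → sum (map g (upTo (suc d)))) (m<n⇒m/n≡0 n<1+m) ⟩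
      partsBounded u m n + 0                        ≡⟨ +-identityʳ _ ⟩
      partsBounded u m n                            ∎
      where
      g : ℕ → ℕ
      g c = partsBounded u m (n ∸ c * suc m)

    -- The summand c = 0 uses no part m + 1; in the others one copy of that part is removed, leaving
    -- a partition of k. This is the geometric series in recursive form.
    multiplicities-+ : ∀ k → multiplicities (suc m + k) ≡ partsBounded u m (suc m + k) + multiplicities k
    multiplicities-+ k = begin
      sum (map g (upTo (suc ((suc m + k) / suc m))))  ≡⟨ cong (λ d → sum (map g (upTo (suc d)))) quotient ⟩
      sum (map g (upTo (suc (suc (k / suc m)))))      ≡⟨ sum-upTo-suc g (suc (k / suc m)) ⟩
      g 0 + sum (map (g ∘ suc) (upTo (suc (k / suc m))))
        ≡⟨ cong (λ xs → g 0 + sum xs) (map-cong (λ c → cong (partsBounded u m) ([m+n]∸[m+o]≡n∸o (suc m) k (c * suc m))) (upTo (suc (k / suc m)))) ⟩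
      g 0 + multiplicities k ∎
      where
      g : ℕ → ℕ
      g c = partsBounded u m (suc m + k ∸ c * suc m)
      quotient : (suc m + k) / suc m ≡ suc (k / suc m)
      quotient = trans (m/n≡1+[m∸n]/n (m≤m+n (suc m) k)) (cong (λ x → suc (x / suc m)) (m+n∸m≡n (suc m) k))

    partsBounded-< : ∀ {n} → n < suc m → partsBounded u (suc m) n ≡ partsBounded u m n
    partsBounded-< {n} n<1+m with u ∣? suc m
    ... | yes _ = refl
    ... | no _  = multiplicities-< n<1+m

  -- `partsNotDiv u n` bounds the parts by n itself, whereas a generating function needs one bound
  -- for all coefficients; parts larger than n cannot occur.
  partsBounded-stable : ∀ u n d → partsBounded u (n + d) n ≡ partsNotDiv u n
  partsBounded-stable u n zero    = cong (λ m → partsBounded u m n) (+-identityʳ n)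
  partsBounded-stable u n (suc d) rewrite +-suc n d =
    trans (partsBounded-< (s≤s (m≤m+n n d))) (partsBounded-stable u n d)

  series : (ℕ → ℕ) → Series
  series f n = + f n

  series-⊛ : ∀ f g n → (series f ⊛ series g) n ≡ + sum (map (λ a → f a * g (n ∸ a)) (upTo (suc n)))
  series-⊛ f g zero    = trans (sym (ℤ.pos-* (f 0) (g 0))) (cong +_ (sym (+-identityʳ (f 0 * g 0))))
  series-⊛ f g (suc n) = begin
    + f 0 ℤ.* + g (suc n) ℤ.+ (series (f ∘ suc) ⊛ series g) n
      ≡⟨ cong₂ ℤ._+_ (sym (ℤ.pos-* (f 0) (g (suc n)))) (series-⊛ (f ∘ suc) g n) ⟩
    + (f 0 * g (suc n) + sum (map (λ a → f (suc a) * g (n ∸ a)) (upTo (suc n))))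
      ≡⟨ cong +_ (sum-upTo-suc (λ a → f a * g (suc n ∸ a)) (suc n)) ⟨
    + sum (map (λ a → f a * g (suc n ∸ a)) (upTo (suc (suc n)))) ∎

  partsBounded-recurrence : ∀ {u m} → ¬ u ∣ suc m → ∀ n →
    series (partsBounded u (suc m)) n ≡ (series (partsBounded u m) ⊕ X^ (suc m) ⊛ series (partsBounded u (suc m))) n
  partsBounded-recurrence {u} {m} u∤ n with suc m ≤? n
  ... | no n≱1+m = begin
    + partsBounded u (suc m) n ≡⟨ cong +_ (partsBounded-< (≰⇒> n≱1+m)) ⟩
    + partsBounded u m n       ≡⟨ ℤ.+-identityʳ _ ⟨
    + partsBounded u m n ℤ.+ + 0 ≡⟨ cong (λ z → + partsBounded u m n ℤ.+ z) (X^-⊛-< (suc m) (series (partsBounded u (suc m))) (≰⇒> n≱1+m)) ⟨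
    _ ∎
  ... | yes 1+m≤n with k , refl ← m≤n⇒∃[o]m+o≡n 1+m≤n = begin
    + partsBounded u (suc m) (suc m + k)
      ≡⟨ cong +_ (trans (partsBounded-∤ u∤ (suc m + k)) (multiplicities-+ {u} {m} k)) ⟩
    + partsBounded u m (suc m + k) ℤ.+ + multiplicities k
      ≡⟨ cong (λ z → + partsBounded u m (suc m + k) ℤ.+ z) (trans (cong +_ (sym (partsBounded-∤ u∤ k)))
           (sym (X^-⊛-+ (suc m) (series (partsBounded u (suc m))) k))) ⟩
    _ ∎

  powers : ℕ → TruncatedPowers
  powers M = record
    { ring    = ring
    ; q^      = X^
    ; q^0     = ≐⇒≈ (λ _ → refl)
    ; q^-+    = λ d e → ≐⇒≈ (X^-+ d e)
    ; order   = M
    ; q^-high = X^-high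
    ; char3   = 1+1+1≈0
    }
    where open Truncated M

  module _ (M : ℕ) where
    open TruncatedPowers (powers M) using () renaming (ring to R)
    open import Algebra.Bundles using (CommutativeRing)
    open CommutativeRing R using (_≈_; 1#) renaming
      ( _*_ to _*ᴿ_; *-cong to *ᴿ-cong; *-congˡ to *ᴿ-congˡ; *-congʳ to *ᴿ-congʳ; *-assoc to *ᴿ-assoc
      ; *-comm to *ᴿ-comm; *-identityʳ to *ᴿ-identityʳ; trans to ≈-trans )
    open import Relation.Binary.Reasoning.Setoid (CommutativeRing.setoid R) using (step-≈-⟩; step-≈-⟨; step-≡-⟩) renaming (begin_ to begin≈_; _∎ to _∎≈)
    open Truncated M using (mk≈; ≐⇒≈; coeff≈)
    open Theta (powers M) using (1-q^)
    open ProductIdentities (powers M)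

    P : ℕ → ℕ → Series
    P u m = series (partsBounded u m)

    P-inverse : ∀ u m → P u m *ᴿ coprimePart u m ≈ 1#
    P-inverse u zero = ≈-trans (*ᴿ-identityʳ (P u 0)) (≐⇒≈ λ where
      zero → refl
      (suc n) → refl)
    P-inverse u (suc m) = by-cases (u ∣? suc m)
      where
      by-cases : Dec (u ∣ suc m) → P u (suc m) *ᴿ coprimePart u (suc m) ≈ 1#
      by-cases (yes u∣) = begin≈
        P u (suc m) *ᴿ coprimePart u (suc m) ≈⟨ *ᴿ-congˡ {P u (suc m)} (coprimePart-∣ u u∣) ⟩
        P u (suc m) *ᴿ coprimePart u m       ≈⟨ *ᴿ-congʳ {coprimePart u m} {P u (suc m)} {P u m} (≐⇒≈ (λ n → cong +_ (partsBounded-∣ u∣ n))) ⟩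
        P u m *ᴿ coprimePart u m             ≈⟨ P-inverse u m ⟩
        1#                                  ∎≈
      by-cases (no u∤) = begin≈
        P u (suc m) *ᴿ coprimePart u (suc m)               ≈⟨ *ᴿ-congˡ {P u (suc m)} (coprimePart-∤ u u∤) ⟩
        P u (suc m) *ᴿ (coprimePart u m *ᴿ 1-q^ (suc m))    ≈⟨ *ᴿ-congˡ {P u (suc m)} (*ᴿ-comm (coprimePart u m) (1-q^ (suc m))) ⟩
        P u (suc m) *ᴿ (1-q^ (suc m) *ᴿ coprimePart u m)    ≈⟨ *ᴿ-assoc (P u (suc m)) (1-q^ (suc m)) (coprimePart u m) ⟨
        P u (suc m) *ᴿ 1-q^ (suc m) *ᴿ coprimePart u m
          ≈⟨ *ᴿ-congʳ {coprimePart u m} (*-1-q^ (suc m) {P u (suc m)} {P u m} (≐⇒≈ (partsBounded-recurrence u∤))) ⟩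
        P u m *ᴿ coprimePart u m                           ≈⟨ P-inverse u m ⟩
        1#                                                ∎≈

    P-stable : ∀ u .{{_ : NonZero u}} → series (partsNotDiv u) ≈ P u (u * M)
    P-stable u = mk≈ λ n n<M → ≡⇒≡₃ (cong +_ (stable n (≤-trans (<⇒≤ n<M) (m≤n*m M u))))
      where
      stable : ∀ n {m} → n ≤ m → partsNotDiv u n ≡ partsBounded u m n
      stable n n≤m with d , refl ← m≤n⇒∃[o]m+o≡n n≤m = sym (partsBounded-stable u n d)

    B-product : ∀ v .{{_ : NonZero v}} → series (B 3 v) ≈ f 1 *ᴿ f v
    B-product v = begin≈
      series (B 3 v)                                  ≈⟨ ≐⇒≈ (series-⊛ (partsNotDiv 3) (partsNotDiv v)) ⟨
      series (partsNotDiv 3) *ᴿ series (partsNotDiv v)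
        ≈⟨ *ᴿ-cong {series (partsNotDiv 3)} {P 3 (3 * M)} {series (partsNotDiv v)} {P v (v * M)} (P-stable 3) (P-stable v) ⟩
      P 3 (3 * M) *ᴿ P v (v * M)                      ≈⟨ bipartition-product v {P 3 (3 * M)} {P v (v * M)} (P-inverse 3 (3 * M)) (P-inverse v (v * M)) ⟩
      f 1 *ᴿ f v                                      ∎≈

    Span⇒≡₃0 : ∀ {D x n} → n < M → ¬ D n → Span D x → x n ≡₃ + 0
    Span⇒≡₃0 {D} {n = n} n<M ¬Dn (power {e} De) = ≡⇒≡₃ (X^-≢ e n (λ e≡n → ¬Dn (subst D e≡n De)))
    Span⇒≡₃0 n<M ¬Dn zero#        = ≡⇒≡₃ refl
    Span⇒≡₃0 n<M ¬Dn (plus s t)   = ≡₃-+ (Span⇒≡₃0 n<M ¬Dn s) (Span⇒≡₃0 n<M ¬Dn t)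
    Span⇒≡₃0 n<M ¬Dn (minus s)    = ≡₃-neg (Span⇒≡₃0 n<M ¬Dn s)
    Span⇒≡₃0 n<M ¬Dn (resp x≈y s) = ≡₃-trans (≡₃-sym (coeff≈ x≈y _ n<M)) (Span⇒≡₃0 n<M ¬Dn s)

  -- The truncation order n + 1 is the least at which the coefficient of q^n is still visible.
  3∣B : ∀ v .{{_ : NonZero v}} n (D : ℕ → Set) → (let open ProductIdentities (powers (suc n))) → Span D (f 1 ⊛ f v) → ¬ D n → 3 ∣ B 3 v n
  3∣B v n D span ¬Dn = subst (λ z → 3 ∣ ℤ.∣ z ∣) (ℤ.+-identityʳ (+ B 3 v n)) (∣⇒∣ᵤ (divides-diff
    (≡₃-trans (coeff≈ (B-product (suc n) v) n (n<1+n n)) (Span⇒≡₃0 (suc n) (n<1+n n) ¬Dn span))))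
    where open Truncated (suc n) using (coeff≈)

-- Binary quadratic forms anisotropic at a prime

module QuadraticForms where
  open import Data.Nat as ℕ using (ℕ; zero; suc; s≤s; z≤n; NonZero) renaming (_+_ to _+ℕ_; _*_ to _*ℕ_; _<_ to _<ℕ_; _≤_ to _≤ℕ_; _%_ to _%ℕ′_)
  import Data.Nat.Properties as ℕ
  open import Data.Nat.Properties using (allUpTo?)
  import Data.Nat.DivMod as ℕ
  import Data.Nat.Divisibility as ℕ
  import Data.Nat.Coprimality as Coprime
  open import Data.Nat.Primality using (Prime; euclidsLemma; prime⇒nonZero; prime⇒nonTrivial)
  open import Data.Nat.GCD using (module Bézout)
  open import Data.Nat.Induction using (<-rec)
  open import Data.Integer using (ℤ; +_; _+_; _*_; -_; _-_; _%ℕ_; _/ℕ_) renaming (∣_∣ to abs)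
  import Data.Integer.Properties as ℤ
  open import Data.Integer.DivMod using (a≡a%ℕn+[a/ℕn]*n; n%ℕd<d)
  open import Data.Integer.Divisibility.Signed
  open import Data.Integer.Tactic.RingSolver using (solve-∀)
  open import Data.Nat.Tactic.RingSolver using () renaming (solve-∀ to solveℕ-∀)
  open import Data.Product using (∃; ∃₂; _,_; _×_)
  open import Data.Sum using (_⊎_; inj₁; inj₂; [_,_])
  open import Data.Empty using (⊥)
  open import Function using (id; it)
  open import Relation.Nullary using (¬_; yes; no; contradiction)
  open import Relation.Nullary.Decidable using (from-yes; _→-dec_; ¬?; _⊎-dec_)
  open import Relation.Unary using (Decidable)
  open import Relation.Binary.PropositionalEquality hiding ([_])
  open ≡-Reasoning

  form : ℤ → ℤ → ℤ → ℤ → ℤ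
  form b c x y = x * x + b * (x * y) + c * (y * y)

  poly : ℕ → ℕ → ℕ → ℕ
  poly b c x = x *ℕ x +ℕ b *ℕ x +ℕ c

  poly-cast : ∀ b c x → + poly b c x ≡ form (+ b) (+ c) (+ x) (+ 1)
  poly-cast b c x = begin
    + (x *ℕ x) + + (b *ℕ x) + + c      ≡⟨ cong₂ (λ s t → s + t + + c) (ℤ.pos-* x x) (ℤ.pos-* b x) ⟩
    + x * + x + + b * + x + + c        ≡⟨ homogenize (+ b) (+ c) (+ x) ⟩
    form (+ b) (+ c) (+ x) (+ 1)       ∎
    where
    homogenize : ∀ b c x → x * x + b * x + c ≡ x * x + b * (x * + 1) + c * (+ 1 * + 1)
    homogenize = solve-∀

  module _ (d : ℕ) .{{_ : NonZero d}} where

    %-cong-+ : ∀ {a a′ b b′} → a %ℕ′ d ≡ a′ %ℕ′ d → b %ℕ′ d ≡ b′ %ℕ′ d → (a +ℕ b) %ℕ′ d ≡ (a′ +ℕ b′) %ℕ′ d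
    %-cong-+ {a} {a′} {b} {b′} p q =
      trans (ℕ.%-distribˡ-+ a b d) (trans (cong₂ (λ s t → (s +ℕ t) %ℕ′ d) p q) (sym (ℕ.%-distribˡ-+ a′ b′ d)))

    %-cong-* : ∀ {a a′ b b′} → a %ℕ′ d ≡ a′ %ℕ′ d → b %ℕ′ d ≡ b′ %ℕ′ d → (a *ℕ b) %ℕ′ d ≡ (a′ *ℕ b′) %ℕ′ d
    %-cong-* {a} {a′} {b} {b′} p q =
      trans (ℕ.%-distribˡ-* a b d) (trans (cong₂ (λ s t → (s *ℕ t) %ℕ′ d) p q) (sym (ℕ.%-distribˡ-* a′ b′ d)))

    poly-% : ∀ b c x → poly b c (x %ℕ′ d) %ℕ′ d ≡ poly b c x %ℕ′ d
    poly-% b c x = %-cong-+ {b = c} (%-cong-+ {x %ℕ′ d *ℕ (x %ℕ′ d)} (%-cong-* {x %ℕ′ d} {x} same same) (%-cong-* {b} refl same)) refl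
      where same = ℕ.m%n%n≡m%n x d

  -- Fermat descent: a bad modulus dividing a value of x² + b x + c leaves a smaller bad cofactor.
  module Descent (b c D : ℕ) .{{_ : NonZero D}} (Bad Good : ℕ → Set) (Good? : Decidable Good)
    -- `Good` marks the residues of roots x for which the cofactor of a bad modulus m is bad again.
    -- The roots x and m - b - x come in pairs, and `good-partner` says that at least one of the two
    -- is good.
    (bad-cofactor : ∀ {ρ} → ρ <ℕ D → ∀ {μ} → μ <ℕ D → ∀ {ξ} → ξ <ℕ D → Good ξ → Bad μ →
      (ρ *ℕ μ) %ℕ′ D ≡ poly b c ξ %ℕ′ D → Bad ρ)
    (good-partner : ∀ {μ} → μ <ℕ D → ∀ {ξ} → ξ <ℕ D → ∀ {υ} → υ <ℕ D → Bad μ →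
      (ξ +ℕ υ +ℕ b) %ℕ′ D ≡ μ → ¬ Good ξ → Good υ)
    (b≤1 : b ≤ℕ 1) (b+c≤2 : b +ℕ c ≤ℕ 2)
    (bad-∤ : ∀ m → Bad (m %ℕ′ D) → ¬ m ℕ.∣ c)
    (¬bad-0 : ¬ Bad (0 %ℕ′ D))
    where

    -- For 1 ≤ K and x ≤ K the value is at most K² + (b + c) K ≤ K² + 2K, just below (K + 1)². With
    -- m = K + 1 the cofactor of m is therefore less than m, as the descent requires.
    poly-< : ∀ k x → x ≤ℕ suc k → poly b c x <ℕ suc (suc k) *ℕ suc (suc k)
    poly-< k x x≤K = s≤s (ℕ.≤-trans (ℕ.+-monoˡ-≤ c (ℕ.+-mono-≤ (ℕ.*-mono-≤ x≤K x≤K) (ℕ.*-monoʳ-≤ b x≤K)))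
      (ℕ.≤-trans (ℕ.+-monoʳ-≤ (K *ℕ K +ℕ b *ℕ K) (ℕ.m≤m*n c K)) (ℕ.≤-trans (ℕ.≤-reflexive (collect b c K))
      (ℕ.≤-trans (ℕ.+-monoʳ-≤ (K *ℕ K) (ℕ.*-monoˡ-≤ K b+c≤2)) (ℕ.≤-reflexive (square K))))))
      where
      K = suc k
      collect : ∀ b c K → K *ℕ K +ℕ b *ℕ K +ℕ c *ℕ K ≡ K *ℕ K +ℕ (b +ℕ c) *ℕ K
      collect = solveℕ-∀
      square : ∀ K → K *ℕ K +ℕ 2 *ℕ K ≡ K +ℕ K *ℕ (1 +ℕ K)
      square = solveℕ-∀

    -- The two roots of x² + b x + c modulo m sum to -b.
    partner-∣ : ∀ {m x y} → x +ℕ y +ℕ b ≡ m → m ℕ.∣ poly b c x → m ℕ.∣ poly b c y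
    partner-∣ {m} {x} {y} refl m∣ = ∣⇒∣ᵤ {+ m} {+ poly b c y} (subst (+ m ∣_) (sym eq)
      (∣m∣n⇒∣m+n (∣ᵤ⇒∣ {+ m} {+ poly b c x} m∣) (∣n⇒∣m*n (+ y - + x) ∣-refl)))
      where
      shift : ∀ b c x y → form b c y (+ 1) ≡ form b c x (+ 1) + (y - x) * (x + y + b)
      shift = expand
        where
        expand : ∀ b c x y → y * y + b * (y * + 1) + c * (+ 1 * + 1) ≡ x * x + b * (x * + 1) + c * (+ 1 * + 1) + (y - x) * (x + y + b)
        expand = solve-∀
      eq : + poly b c y ≡ + poly b c x + (+ y - + x) * + m
      eq = trans (poly-cast b c y) (trans (shift (+ b) (+ c) (+ x) (+ y)) (cong (λ z → z + (+ y - + x) * + m) (sym (poly-cast b c x))))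

    cofactor : ∀ m → Bad (m %ℕ′ D) → ∀ x → x <ℕ m → Good (x %ℕ′ D) → m ℕ.∣ poly b c x →
      ∃ λ r → r <ℕ m × Bad (r %ℕ′ D) × r ℕ.∣ poly b c x
    cofactor zero bad x x<m good m∣ = contradiction bad ¬bad-0
    cofactor (suc zero) bad x x<m good m∣ = contradiction (ℕ.1∣ c) (bad-∤ 1 bad)
    cofactor m@(suc (suc k)) bad x (s≤s x≤1+k) good (ℕ.divides r poly≡r*m) = r
      , ℕ.*-cancelʳ-< m r m (subst (_<ℕ m *ℕ m) poly≡r*m (poly-< k x x≤1+k))
      , bad-cofactor (ℕ.m%n<n r D) (ℕ.m%n<n m D) (ℕ.m%n<n x D) good bad
          (trans (sym (ℕ.%-distribˡ-* r m D)) (trans (cong (_%ℕ′ D) (sym poly≡r*m)) (sym (poly-% D b c x))))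
      , ℕ.divides m (trans poly≡r*m (ℕ.*-comm r m))

    reduce : ∀ m .{{_ : NonZero m}} x → m ℕ.∣ poly b c x → m ℕ.∣ poly b c (x %ℕ′ m)
    reduce m x m∣ = ℕ.m%n≡0⇒n∣m _ m (trans (poly-% m b c x) (ℕ.n∣m⇒m%n≡0 _ m m∣))

    good-root : ∀ m → Bad (m %ℕ′ D) → ∀ x → x <ℕ m → m ℕ.∣ poly b c x →
      ∃ λ y → y <ℕ m × Good (y %ℕ′ D) × m ℕ.∣ poly b c y
    good-root m bad x x<m m∣ with Good? (x %ℕ′ D)
    ... | yes good = x , x<m , good , m∣
    -- For x = 0 the partner m - b may fail to be below m, but then m divides c, which `bad-∤`
    -- excludes.
    good-root m bad zero x<m m∣ | no _ = contradiction (subst (λ z → m ℕ.∣ z +ℕ c) (ℕ.*-zeroʳ b) m∣) (bad-∤ m bad)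
    good-root m bad x@(suc x′) x<m m∣ | no ¬good
      with y , x+b+y≡m ← ℕ.m≤n⇒∃[o]m+o≡n (ℕ.≤-trans (ℕ.+-monoʳ-≤ x b≤1) (subst (_≤ℕ m) (ℕ.+-comm 1 x) x<m)) =
      y , subst (y <ℕ_) x+b+y≡m (s≤s (ℕ.m≤n+m y (x′ +ℕ b)))
        , good-partner (ℕ.m%n<n m D) (ℕ.m%n<n x D) (ℕ.m%n<n y D) bad
            (trans (%-cong-+ D {b = b} (%-cong-+ D {x %ℕ′ D} {x} (ℕ.m%n%n≡m%n x D) (ℕ.m%n%n≡m%n y D)) refl) (cong (_%ℕ′ D) x+y+b≡m)) ¬good
        , partner-∣ {m} {x} {y} x+y+b≡m m∣
      where
      x+y+b≡m : x +ℕ y +ℕ b ≡ m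
      x+y+b≡m = trans (ℕ.+-assoc x y b) (trans (cong (x +ℕ_) (ℕ.+-comm y b)) (trans (sym (ℕ.+-assoc x b y)) x+b+y≡m))

    no-root : ∀ m → Bad (m %ℕ′ D) → ∀ x → ¬ m ℕ.∣ poly b c x
    no-root = <-rec (λ m → Bad (m %ℕ′ D) → ∀ x → ¬ m ℕ.∣ poly b c x) step
      where
      step : ∀ m → (∀ {r} → r <ℕ m → Bad (r %ℕ′ D) → ∀ x → ¬ r ℕ.∣ poly b c x) →
        Bad (m %ℕ′ D) → ∀ x → ¬ m ℕ.∣ poly b c x
      step zero      rec bad x m∣ = ¬bad-0 bad
      step m@(suc _) rec bad x m∣
        with y , y<m , good , m∣y ← good-root m bad (x %ℕ′ m) (ℕ.m%n<n x m) (reduce m x m∣)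
        with r , r<m , bad-r , r∣y ← cofactor m bad y y<m good m∣y = rec r<m bad-r y r∣y

  -- For x ≢ 1 (mod 3) the value x² + x + 1 is 1 modulo 3, so a divisor ≡ 2 has a cofactor ≡ 2. If x
  -- ≡ 1 and m ≡ 2, the partner m - 1 - x is ≡ 0.
  no-root-3 : ∀ m → m %ℕ′ 3 ≡ 2 → ∀ x → ¬ m ℕ.∣ poly 1 1 x
  no-root-3 = no-root
    where
    Bad Good : ℕ → Set
    Bad = _≡ 2
    Good ξ = ¬ ξ ≡ 1
    open Descent 1 1 3 Bad Good (λ ξ → ¬? (ξ ℕ.≟ 1))
      (from-yes (allUpTo? (λ ρ → allUpTo? (λ μ → allUpTo? (λ ξ → ¬? (ξ ℕ.≟ 1) →-dec (μ ℕ.≟ 2 →-dec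
        ((ρ *ℕ μ) %ℕ′ 3 ℕ.≟ poly 1 1 ξ %ℕ′ 3 →-dec ρ ℕ.≟ 2))) 3) 3) 3))
      (from-yes (allUpTo? (λ μ → allUpTo? (λ ξ → allUpTo? (λ υ → μ ℕ.≟ 2 →-dec
        ((ξ +ℕ υ +ℕ 1) %ℕ′ 3 ℕ.≟ μ →-dec (¬? (¬? (ξ ℕ.≟ 1)) →-dec ¬? (υ ℕ.≟ 1)))) 3) 3) 3))
      (s≤s z≤n) (s≤s (s≤s z≤n)) (λ m bad m∣1 → contradiction (subst (λ m → m %ℕ′ 3 ≡ 2) (ℕ.∣1⇒≡1 m∣1) bad) λ ()) (λ ())

  -- For even x the value x² + 1 is 1 modulo 4, so a divisor ≡ 3 has a cofactor ≡ 3; since m is odd,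
  -- x and m - x differ in parity.
  no-root-4 : ∀ m → m %ℕ′ 4 ≡ 3 → ∀ x → ¬ m ℕ.∣ poly 0 1 x
  no-root-4 = no-root
    where
    Bad Good : ℕ → Set
    Bad = _≡ 3
    Good ξ = ξ %ℕ′ 2 ≡ 0
    open Descent 0 1 4 Bad Good (λ ξ → ξ %ℕ′ 2 ℕ.≟ 0)
      (from-yes (allUpTo? (λ ρ → allUpTo? (λ μ → allUpTo? (λ ξ → ξ %ℕ′ 2 ℕ.≟ 0 →-dec (μ ℕ.≟ 3 →-dec
        ((ρ *ℕ μ) %ℕ′ 4 ℕ.≟ poly 0 1 ξ %ℕ′ 4 →-dec ρ ℕ.≟ 3))) 4) 4) 4))
      (from-yes (allUpTo? (λ μ → allUpTo? (λ ξ → allUpTo? (λ υ → μ ℕ.≟ 3 →-dec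
        ((ξ +ℕ υ +ℕ 0) %ℕ′ 4 ℕ.≟ μ →-dec (¬? (ξ %ℕ′ 2 ℕ.≟ 0) →-dec υ %ℕ′ 2 ℕ.≟ 0))) 4) 4) 4))
      z≤n (s≤s z≤n) (λ m bad m∣1 → contradiction (subst (λ m → m %ℕ′ 4 ≡ 3) (ℕ.∣1⇒≡1 m∣1) bad) λ ()) (λ ())

  -- For odd x the value x² + 2 is 3 modulo 8, and 5 · 7 ≡ 3: passing to the cofactor exchanges the
  -- classes 5 and 7, so the descent must treat them together.
  no-root-8 : ∀ m → m %ℕ′ 8 ≡ 5 ⊎ m %ℕ′ 8 ≡ 7 → ∀ x → ¬ m ℕ.∣ poly 0 2 x
  no-root-8 = no-root
    where
    Bad Good : ℕ → Set
    Bad μ = μ ≡ 5 ⊎ μ ≡ 7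
    Bad? : Decidable Bad
    Bad? μ = μ ℕ.≟ 5 ⊎-dec μ ℕ.≟ 7
    Good ξ = ξ %ℕ′ 2 ≡ 1
    divisors-of-2 : ∀ {m} → m <ℕ 3 → Bad (m %ℕ′ 8) → ⊥
    divisors-of-2 = λ m<3 → from-yes (allUpTo? (λ m → ¬? (Bad? (m %ℕ′ 8))) 3) m<3
    open Descent 0 2 8 Bad Good (λ ξ → ξ %ℕ′ 2 ℕ.≟ 1)
      (from-yes (allUpTo? (λ ρ → allUpTo? (λ μ → allUpTo? (λ ξ → ξ %ℕ′ 2 ℕ.≟ 1 →-dec (Bad? μ →-dec
        ((ρ *ℕ μ) %ℕ′ 8 ℕ.≟ poly 0 2 ξ %ℕ′ 8 →-dec Bad? ρ))) 8) 8) 8))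
      (from-yes (allUpTo? (λ μ → allUpTo? (λ ξ → allUpTo? (λ υ → Bad? μ →-dec
        ((ξ +ℕ υ +ℕ 0) %ℕ′ 8 ℕ.≟ μ →-dec (¬? (ξ %ℕ′ 2 ℕ.≟ 1) →-dec υ %ℕ′ 2 ℕ.≟ 1))) 8) 8) 8))
      z≤n (s≤s (s≤s z≤n)) (λ m bad m∣2 → divisors-of-2 (s≤s (ℕ.∣⇒≤ m∣2)) bad) [ (λ ()) , (λ ()) ]

  euclid : ∀ {p} → Prime p → ∀ x y → + p ∣ x * y → + p ∣ x ⊎ + p ∣ y
  euclid {p} pr x y p∣xy with euclidsLemma (abs x) (abs y) pr (subst (p ℕ.∣_) (ℤ.abs-* x y) (∣⇒∣ᵤ p∣xy))
  ... | inj₁ p∣x = inj₁ (∣ᵤ⇒∣ p∣x)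
  ... | inj₂ p∣y = inj₂ (∣ᵤ⇒∣ p∣y)

  euclid² : ∀ {p} → Prime p → ∀ x → + p ∣ x * x → + p ∣ x
  euclid² pr x p∣x² = [ id , id ] (euclid pr x x p∣x²)

  residue-inverse : ∀ {p} → Prime p → ∀ r .{{_ : NonZero r}} → r <ℕ p → ∃₂ λ z t → + r * z ≡ + 1 + t * + p
  residue-inverse {p} pr r r<p with Coprime.coprime-Bézout (Coprime.prime⇒coprime pr r<p)
  ... | Bézout.+- a b 1+br≡ap = - + b , - + a , (begin
          + r * - + b                  ≡⟨ isolate (+ r) (+ b) ⟩
          + 1 - (+ 1 + + b * + r)      ≡⟨ cong (λ s → + 1 - (+ 1 + s)) (ℤ.pos-* b r) ⟨
          + 1 - + (1 +ℕ b *ℕ r)        ≡⟨ cong (λ s → + 1 - s) (trans (cong +_ 1+br≡ap) (ℤ.pos-* a p)) ⟩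
          + 1 - + a * + p              ≡⟨ cong (λ s → + 1 + s) (ℤ.neg-distribˡ-* (+ a) (+ p)) ⟩
          + 1 + - + a * + p            ∎)
    where
    isolate : ∀ r b → r * - b ≡ + 1 - (+ 1 + b * r)
    isolate = solve-∀
  ... | Bézout.-+ a b 1+ap≡br = + b , + a , (begin
          + r * + b                    ≡⟨ trans (ℤ.*-comm (+ r) (+ b)) (sym (ℤ.pos-* b r)) ⟩
          + (b *ℕ r)                   ≡⟨ cong +_ 1+ap≡br ⟨
          + 1 + + (a *ℕ p)             ≡⟨ cong (λ s → + 1 + s) (ℤ.pos-* a p) ⟩
          + 1 + + a * + p              ∎)

  inverse : ∀ {p} → Prime p → ∀ y → ¬ + p ∣ y → ∃₂ λ z t → y * z ≡ + 1 + t * + p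
  inverse {p} pr y p∤y = from-residue (y %ℕ p) (n%ℕd<d y p) (a≡a%ℕn+[a/ℕn]*n y p)
    where
    instance _ = prime⇒nonZero pr
    s = y /ℕ p
    from-residue : ∀ r → r <ℕ p → y ≡ + r + s * + p → ∃₂ λ z t → y * z ≡ + 1 + t * + p
    from-residue zero      r<p y≡ = contradiction (divides s (trans y≡ (ℤ.+-identityˡ _))) p∤y
    from-residue r@(suc _) r<p y≡ with z , t , rz≡1+tp ← residue-inverse pr r r<p = z , t + s * z , (begin
      y * z                       ≡⟨ cong (_* z) y≡ ⟩
      (+ r + s * + p) * z         ≡⟨ expand (+ r) s (+ p) z ⟩
      + r * z + s * z * + p       ≡⟨ cong (λ x → x + s * z * + p) rz≡1+tp ⟩
      + 1 + t * + p + s * z * + p ≡⟨ collect t (+ p) (s * z) ⟩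
      + 1 + (t + s * z) * + p     ∎)
      where
      expand : ∀ r s p z → (r + s * p) * z ≡ r * z + s * z * p
      expand = solve-∀
      collect : ∀ t p u → + 1 + t * p + u * p ≡ + 1 + (t + u) * p
      collect = solve-∀

  Anisotropic : ℕ → ℕ → ℕ → Set
  Anisotropic p b c = ∀ x y → + p ∣ form (+ b) (+ c) x y → + p ∣ x × + p ∣ y

  -- If p does not divide y, then x / y modulo p is a root of the polynomial; if p divides y, then p
  -- divides x² and hence x.
  no-root⇒anisotropic : ∀ {p} b c → Prime p → (∀ x → ¬ p ℕ.∣ poly b c x) → Anisotropic p b c
  no-root⇒anisotropic {p} b c pr no-root x y p∣form with + p ∣? y
  ... | yes (divides y′ refl) = euclid² pr x (∣m+n∣n⇒∣m {+ p} {x * x} (subst (+ p ∣_) (split (+ b) (+ c) x y′ (+ p)) p∣form) (∣n⇒∣m*n (+ b * (x * y′) + + c * (y′ * y′) * + p) ∣-refl))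
                              , divides y′ refl
    where
    split : ∀ b c x y p → x * x + b * (x * (y * p)) + c * (y * p * (y * p)) ≡ x * x + (b * (x * y) + c * (y * y) * p) * p
    split = solve-∀
  ... | no p∤y with z , t , yz≡1+tp ← inverse pr y p∤y = contradiction (∣⇒∣ᵤ p∣poly) (no-root (w %ℕ p))
    where
    instance _ = prime⇒nonZero pr
    w = x * z
    s = w /ℕ p
    v = + (w %ℕ p)
    -- The cofactor of p that remains when the form is expanded at (v + s p, 1 + t p), the values of
    -- x z and y z.
    k = + 2 * v * s + s * s * + p + + b * (v * t + s + s * t * + p) + + c * (+ 2 * t + t * t * + p)
    scale : ∀ b c x y z → z * z * (x * x + b * (x * y) + c * (y * y)) ≡ x * z * (x * z) + b * (x * z * (y * z)) + c * (y * z * (y * z))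
    scale = solve-∀
    expand : ∀ b c v s t p → (v + s * p) * (v + s * p) + b * ((v + s * p) * (+ 1 + t * p)) + c * ((+ 1 + t * p) * (+ 1 + t * p))
      ≡ v * v + b * (v * + 1) + c * (+ 1 * + 1) + (+ 2 * v * s + s * s * p + b * (v * t + s + s * t * p) + c * (+ 2 * t + t * t * p)) * p
    expand = solve-∀
    p∣scaled : + p ∣ form (+ b) (+ c) v (+ 1) + k * + p
    p∣scaled = subst (+ p ∣_) (trans (scale (+ b) (+ c) x y z) (trans (cong₂ (λ X Y → X * X + + b * (X * Y) + + c * (Y * Y)) (a≡a%ℕn+[a/ℕn]*n w p) yz≡1+tp)
      (expand (+ b) (+ c) v s t (+ p)))) (∣n⇒∣m*n (z * z) p∣form)
    p∣poly : + p ∣ + poly b c (w %ℕ p)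
    p∣poly = subst (+ p ∣_) (sym (poly-cast b c (w %ℕ p))) (∣m+n∣n⇒∣m {+ p} {form (+ b) (+ c) v (+ 1)} p∣scaled (∣n⇒∣m*n k ∣-refl))

  -- Descent on P: anisotropy gives p | x and p | y, so p² divides the form and p divides P² u,
  -- hence P. Cancelling p² gives the same equation with P / p.
  odd-valuation : ∀ {p b c} → Prime p → Anisotropic p b c → ∀ {u} → ¬ + p ∣ u → ∀ P .{{_ : NonZero P}} x y →
    ¬ form (+ b) (+ c) x y ≡ + P * + P * + p * u
  odd-valuation {p} {b} {c} pr aniso {u} p∤u = <-rec Claim step
    where
    instance _ = prime⇒nonZero pr
    Claim : ℕ → Set
    Claim P = .{{_ : NonZero P}} → ∀ x y → ¬ form (+ b) (+ c) x y ≡ + P * + P * + p * u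
    swap : ∀ P p u → P * P * p * u ≡ P * P * u * p
    swap = solve-∀
    homogeneous : ∀ b c x y p → x * p * (x * p) + b * (x * p * (y * p)) + c * (y * p * (y * p)) ≡ (x * x + b * (x * y) + c * (y * y)) * p * p
    homogeneous = solve-∀
    step : ∀ P → (∀ {R} → R <ℕ P → Claim R) → Claim P
    step P rec x y eq with aniso x y (divides (+ P * + P * u) (trans eq (swap (+ P) (+ p) u)))
    ... | divides x′ refl , divides y′ refl = [ (λ p∣P² → shrink (euclid² pr (+ P) p∣P²)) , p∤u ] (euclid pr (+ P * + P) u (divides (form (+ b) (+ c) x′ y′) once))
      where
      once : + P * + P * u ≡ form (+ b) (+ c) x′ y′ * + p
      once = ℤ.*-cancelʳ-≡ _ _ (+ p) (trans (sym (swap (+ P) (+ p) u)) (trans (sym eq) (homogeneous (+ b) (+ c) x′ y′ (+ p))))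
      shrink : ¬ + p ∣ + P
      shrink p∣P with ∣⇒∣ᵤ p∣P
      ... | ℕ.divides R P≡Rp = rec R<P {{R≢0}} x′ y′ (ℤ.*-cancelʳ-≡ _ _ (+ p) (trans (sym once) (trans (cong (λ Q → Q * Q * u) P≡Rp′) (regroup (+ R) (+ p) u))))
        where
        P≡Rp′ : + P ≡ + R * + p
        P≡Rp′ = trans (cong +_ P≡Rp) (ℤ.pos-* R p)
        R≢0 : NonZero R
        R≢0 = ℕ.m*n≢0⇒m≢0 R {{subst NonZero P≡Rp it}}
        R<P : R <ℕ P
        R<P = subst (R <ℕ_) (sym P≡Rp) (ℕ.m<m*n R p {{R≢0}} (ℕ.nonTrivial⇒n>1 p {{prime⇒nonTrivial pr}}))
        regroup : ∀ R p u → R * p * (R * p) * u ≡ R * R * p * u * p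
        regroup = solve-∀

-- Coefficients supported on values of quadratic forms

module Lacunarity where
  open import Data.Nat as ℕ using (ℕ; suc; NonZero)
  open import Data.Nat.Divisibility using (_∣_)
  open import Data.Integer using (ℤ; +_; _+_; _*_; _-_; -_)
  import Data.Integer.Properties as ℤ
  open import Data.Integer.Tactic.RingSolver using (solve-∀)
  open import Data.Product using (∃₂; _,_)
  open import Relation.Nullary using (¬_)
  open import Relation.Binary.PropositionalEquality
  open ThetaExponent
  open TruncatedPowerRings
  open PartitionSeries
  open QuadraticForms using (form)
  open ≡-Reasoning

  -- C is the constant by which D N + 1 gets multiplied when the squares in the theta exponents are
  -- completed; later it must be prime to p.
  Lacunary : (D v b c C : ℕ) → Set
  Lacunary D v b c C = ∀ N → (∀ x y → ¬ form (+ b) (+ c) x y ≡ + C * (+ D * + N + + 1)) → 3 ∣ B 3 v N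

  lacunary : ∀ D v b c C .{{_ : NonZero v}} {S : ℕ → Set} →
    (∀ M → let open ProductIdentities (powers M) in Span S (f 1 Series.⊛ f v)) →
    (∀ N → S N → ∃₂ λ x y → form (+ b) (+ c) x y ≡ + C * (+ D * + N + + 1)) → Lacunary D v b c C
  lacunary D v b c C {S} span represent N no-rep = 3∣B v N S (span (suc N)) λ s →
    let x , y , eq = represent N s in no-rep x y eq

  double-sum : ∀ a c k a′ c′ k′ → + 2 * (+ θ-exp a c k + + θ-exp a′ c′ k′) ≡ quad (+ a) (+ c) k + quad (+ a′) (+ c′) k′
  double-sum a c k a′ c′ k′ = trans (ℤ.*-distribˡ-+ (+ 2) (+ θ-exp a c k) _) (cong₂ _+_ (2*θ-exp a c k) (2*θ-exp a′ c′ k′))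

  -- Completing squares: 40 times the exponents (5k² - 3k) / 2 and (5l² - l) / 2 are (10k - 3)² - 9
  -- and (10l - 1)² - 1.
  f₁f₅-form : ∀ N → TwoTheta 1 4 2 3 N → ∃₂ λ x y → form (+ 0) (+ 1) x y ≡ + 10 * (+ 4 * + N + + 1)
  f₁f₅-form _ (k , l , refl) = + 10 * k - + 3 , + 10 * l - + 1 , trans (square k l)
    (trans (cong (λ z → + 20 * z + + 10) (sym (double-sum 1 4 k 2 3 l))) (scale (+ θ-exp 1 4 k + + θ-exp 2 3 l)))
    where
    square : ∀ k l → (+ 10 * k - + 3) * (+ 10 * k - + 3) + + 0 * ((+ 10 * k - + 3) * (+ 10 * l - + 1)) + + 1 * ((+ 10 * l - + 1) * (+ 10 * l - + 1))
      ≡ + 20 * ((+ 1 + + 4) * (k * (k - + 1)) + + 2 * (+ 1 * k) + ((+ 2 + + 3) * (l * (l - + 1)) + + 2 * (+ 2 * l))) + + 10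
    square = solve-∀
    scale : ∀ e → + 20 * (+ 2 * e) + + 10 ≡ + 10 * (+ 4 * e + + 1)
    scale = solve-∀

  -- The exponents 2k² - k and 2l², multiplied by 8, are (4k - 1)² - 1 and (4l)².
  f₁f₂-form-1 : ∀ N → TwoTheta 1 3 2 2 N → ∃₂ λ x y → form (+ 0) (+ 1) x y ≡ + 1 * (+ 8 * + N + + 1)
  f₁f₂-form-1 _ (k , l , refl) = + 4 * k - + 1 , + 4 * l , trans (square k l)
    (trans (cong (λ z → + 4 * z + + 1) (sym (double-sum 1 3 k 2 2 l))) (scale (+ θ-exp 1 3 k + + θ-exp 2 2 l)))
    where
    square : ∀ k l → (+ 4 * k - + 1) * (+ 4 * k - + 1) + + 0 * ((+ 4 * k - + 1) * (+ 4 * l)) + + 1 * ((+ 4 * l) * (+ 4 * l))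
      ≡ + 4 * ((+ 1 + + 3) * (k * (k - + 1)) + + 2 * (+ 1 * k) + ((+ 2 + + 2) * (l * (l - + 1)) + + 2 * (+ 2 * l))) + + 1
    square = solve-∀
    scale : ∀ e → + 4 * (+ 2 * e) + + 1 ≡ + 1 * (+ 8 * e + + 1)
    scale = solve-∀

  -- The exponents (3k² - k) / 2 and 3l² - l, multiplied by 24, are (6k - 1)² - 1 and 2 (6l - 1)² -
  -- 2.
  f₁f₂-form-2 : ∀ N → TwoTheta 1 2 2 4 N → ∃₂ λ x y → form (+ 0) (+ 2) x y ≡ + 3 * (+ 8 * + N + + 1)
  f₁f₂-form-2 _ (k , l , refl) = + 6 * k - + 1 , + 6 * l - + 1 , trans (square k l)
    (trans (cong (λ z → + 12 * z + + 3) (sym (double-sum 1 2 k 2 4 l))) (scale (+ θ-exp 1 2 k + + θ-exp 2 4 l)))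
    where
    square : ∀ k l → (+ 6 * k - + 1) * (+ 6 * k - + 1) + + 0 * ((+ 6 * k - + 1) * (+ 6 * l - + 1)) + + 2 * ((+ 6 * l - + 1) * (+ 6 * l - + 1))
      ≡ + 12 * ((+ 1 + + 2) * (k * (k - + 1)) + + 2 * (+ 1 * k) + ((+ 2 + + 4) * (l * (l - + 1)) + + 2 * (+ 2 * l))) + + 3
    square = solve-∀
    scale : ∀ e → + 12 * (+ 2 * e) + + 3 ≡ + 3 * (+ 8 * e + + 1)
    scale = solve-∀

  -- Put κᵢ = 7kᵢ + aᵢ - 7/2 with a = (1, 2, 4) and k = (α, β, γ). Then x = κ₁ - κ₂, y = κ₂ - κ₃ and
  -- x² + xy + y² = (3 Σκᵢ² - (Σκᵢ)²) / 2, where Σκᵢ² = 14 N + 35/4. Since Σκᵢ = 7r - 7/2, its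
  -- square 49/4 is the same for r = 0 and r = 1, so both classes give 21 N + 7.
  f₁f₇-form : ∀ N → Hexagonal N → ∃₂ λ x y → form (+ 1) (+ 1) x y ≡ + 7 * (+ 3 * + N + + 1)
  f₁f₇-form N (r , r<2 , α , β , N≡) = x , y , ℤ.*-cancelˡ-≡ (+ 2) _ _ (begin
    + 2 * form (+ 1) (+ 1) x y            ≡⟨ value r r<2 ⟩
    + 21 * (q₁ + (q₂ + q₃)) + + 14        ≡⟨ cong (λ z → + 21 * z + + 14) (cong₂ _+_ (2*θ-exp 1 6 α) (trans (ℤ.*-distribˡ-+ (+ 2) (+ θ-exp 2 5 β) _) (cong₂ _+_ (2*θ-exp 2 5 β) (2*θ-exp 4 3 γ)))) ⟨
    + 21 * (+ 2 * + θ-exp 1 6 α + + 2 * (+ θ-exp 2 5 β + + θ-exp 4 3 γ)) + + 14 ≡⟨ scale (+ θ-exp 1 6 α) (+ θ-exp 2 5 β + + θ-exp 4 3 γ) ⟩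
    + 2 * (+ 7 * (+ 3 * (+ θ-exp 1 6 α + (+ θ-exp 2 5 β + + θ-exp 4 3 γ)) + + 1)) ≡⟨ cong (λ N → + 2 * (+ 7 * (+ 3 * + N + + 1))) N≡ ⟨
    + 2 * (+ 7 * (+ 3 * + N + + 1))       ∎)
    where
    γ = + r - α - β
    x = + 7 * α - + 7 * β - + 1
    y = + 7 * β - + 7 * γ - + 2
    q₁ = quad (+ 1) (+ 6) α
    q₂ = quad (+ 2) (+ 5) β
    q₃ = quad (+ 4) (+ 3) γ
    scale : ∀ s t → + 21 * (+ 2 * s + + 2 * t) + + 14 ≡ + 2 * (+ 7 * (+ 3 * (s + t) + + 1))
    scale = solve-∀
    value : ∀ r → r ℕ.< 2 → let γ = + r - α - β ; x = + 7 * α - + 7 * β - + 1 ; y = + 7 * β - + 7 * γ - + 2 in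
      + 2 * form (+ 1) (+ 1) x y ≡ + 21 * (quad (+ 1) (+ 6) α + (quad (+ 2) (+ 5) β + quad (+ 4) (+ 3) γ)) + + 14
    value 0 _ = at-0 α β
      where
      at-0 : ∀ α β → + 2 * ((+ 7 * α - + 7 * β - + 1) * (+ 7 * α - + 7 * β - + 1) + + 1 * ((+ 7 * α - + 7 * β - + 1) * (+ 7 * β - + 7 * (+ 0 - α - β) - + 2))
          + + 1 * ((+ 7 * β - + 7 * (+ 0 - α - β) - + 2) * (+ 7 * β - + 7 * (+ 0 - α - β) - + 2)))
        ≡ + 21 * ((+ 1 + + 6) * (α * (α - + 1)) + + 2 * (+ 1 * α) + ((+ 2 + + 5) * (β * (β - + 1)) + + 2 * (+ 2 * β)
          + ((+ 4 + + 3) * ((+ 0 - α - β) * (+ 0 - α - β - + 1)) + + 2 * (+ 4 * (+ 0 - α - β))))) + + 14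
      at-0 = solve-∀
    value 1 _ = at-1 α β
      where
      at-1 : ∀ α β → + 2 * ((+ 7 * α - + 7 * β - + 1) * (+ 7 * α - + 7 * β - + 1) + + 1 * ((+ 7 * α - + 7 * β - + 1) * (+ 7 * β - + 7 * (+ 1 - α - β) - + 2))
          + + 1 * ((+ 7 * β - + 7 * (+ 1 - α - β) - + 2) * (+ 7 * β - + 7 * (+ 1 - α - β) - + 2)))
        ≡ + 21 * ((+ 1 + + 6) * (α * (α - + 1)) + + 2 * (+ 1 * α) + ((+ 2 + + 5) * (β * (β - + 1)) + + 2 * (+ 2 * β)
          + ((+ 4 + + 3) * ((+ 1 - α - β) * (+ 1 - α - β - + 1)) + + 2 * (+ 4 * (+ 1 - α - β))))) + + 14
      at-1 = solve-∀
    value (suc (suc _)) (ℕ.s≤s (ℕ.s≤s ()))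

  lacunary-3-7 : Lacunary 3 7 1 1 7
  lacunary-3-7 = lacunary 3 7 1 1 7 (λ M → ProductIdentities.Span-f₁f₇ (powers M)) f₁f₇-form

  lacunary-3-5 : Lacunary 4 5 0 1 10
  lacunary-3-5 = lacunary 4 5 0 1 10 (λ M → ProductIdentities.Span-f₁f₅ (powers M)) f₁f₅-form

  lacunary-3-2 : Lacunary 8 2 0 1 1
  lacunary-3-2 = lacunary 8 2 0 1 1 (λ M → ProductIdentities.Span-f₁f₂-as-1+4 (powers M)) f₁f₂-form-1

  lacunary-3-2′ : Lacunary 8 2 0 2 3
  lacunary-3-2′ = lacunary 8 2 0 2 3 (λ M → ProductIdentities.Span-f₁f₂-as-1+2 (powers M)) f₁f₂-form-2

-- Odd valuations in the arithmetic progressions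

module Progression where
  open import Data.Nat as ℕ using (ℕ; NonZero; _%_) renaming (_+_ to _+ℕ_; _*_ to _*ℕ_)
  import Data.Nat.Properties as ℕ
  import Data.Nat.DivMod as ℕ
  import Data.Nat.Divisibility as ℕ
  open import Data.Nat.Primality using (Prime; ¬prime[1]; productOfPrimes≢0)
  open import Data.Nat.ListAction using (product)
  open import Data.List using (List; []; _∷_)
  open import Data.List.Relation.Unary.All as All using (All; []; _∷_)
  open import Data.Integer using (ℤ; +_; -[1+_]; _+_; _*_; _-_; -_; _%ℕ_; _/ℕ_)
  import Data.Integer.Properties as ℤ
  open import Data.Integer.DivMod using (a≡a%ℕn+[a/ℕn]*n; n%ℕd<d)
  open import Data.Integer.Divisibility.Signed
  open import Data.Integer.Tactic.RingSolver using (solve-∀)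
  open import Data.Nat.Tactic.RingSolver using () renaming (solve-∀ to solveℕ-∀)
  open import Data.Product using (_,_)
  open import Data.Sum using ([_,_])
  open import Relation.Nullary using (¬_)
  open import Relation.Binary.PropositionalEquality hiding ([_])
  open QuadraticForms
  open Lacunarity
  open ≡-Reasoning

  -- The common property n² ≡ 1 (mod D) of the primes in all three cases: it makes the quotient by D
  -- in the argument exact and keeps p from dividing D.
  SquareUnit : (D : ℕ) .{{_ : NonZero D}} → ℕ → Set
  SquareUnit D n = (n *ℕ n) % D ≡ 1

  /ℕ-exact : ∀ D .{{_ : NonZero D}} x → + D ∣ x → x /ℕ D * + D ≡ x
  /ℕ-exact D x D∣x = sym (trans x≡ (trans (cong (λ r → + r + x /ℕ D * + D) r≡0) (ℤ.+-identityˡ _)))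
    where
    x≡ = a≡a%ℕn+[a/ℕn]*n x D
    D∣r : D ℕ.∣ x %ℕ D
    D∣r = ∣⇒∣ᵤ {+ D} {+ (x %ℕ D)} (∣m+n∣n⇒∣m {+ D} {+ (x %ℕ D)} (subst (+ D ∣_) x≡ D∣x) (∣n⇒∣m*n (x /ℕ D) ∣-refl))
    r≡0 : x %ℕ D ≡ 0
    r≡0 = trans (sym (ℕ.m<n⇒m%n≡m (n%ℕd<d x D))) (ℕ.n∣m⇒m%n≡0 _ D D∣r)

  module _ (D : ℕ) .{{_ : NonZero D}} where

    SquareUnit-* : ∀ m n → SquareUnit D m → SquareUnit D n → SquareUnit D (m *ℕ n)
    SquareUnit-* m n m² n² = begin
      (m *ℕ n *ℕ (m *ℕ n)) % D                   ≡⟨ cong (_% D) (interchange m n) ⟩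
      (m *ℕ m *ℕ (n *ℕ n)) % D                   ≡⟨ ℕ.%-distribˡ-* (m *ℕ m) (n *ℕ n) D ⟩
      ((m *ℕ m) % D *ℕ ((n *ℕ n) % D)) % D       ≡⟨ cong₂ (λ s t → (s *ℕ t) % D) m² (trans n² (sym m²)) ⟩
      (1 *ℕ ((m *ℕ m) % D)) % D                  ≡⟨ cong (_% D) (ℕ.*-identityˡ ((m *ℕ m) % D)) ⟩
      ((m *ℕ m) % D) % D                         ≡⟨ ℕ.m%n%n≡m%n (m *ℕ m) D ⟩
      (m *ℕ m) % D                               ≡⟨ m² ⟩
      1                                          ∎
      where
      interchange : ∀ m n → m *ℕ n *ℕ (m *ℕ n) ≡ m *ℕ m *ℕ (n *ℕ n)
      interchange = solveℕ-∀

    SquareUnit⇒∣ : ∀ n → SquareUnit D n → + D ∣ + n * + n - + 1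
    SquareUnit⇒∣ n n² = divides (+ ((n *ℕ n) ℕ./ D)) (begin
      + n * + n - + 1                         ≡⟨ cong (_- + 1) (ℤ.pos-* n n) ⟨
      + (n *ℕ n) - + 1                        ≡⟨ cong (λ z → + z - + 1) (ℕ.m≡m%n+[m/n]*n (n *ℕ n) D) ⟩
      + ((n *ℕ n) % D +ℕ (n *ℕ n) ℕ./ D *ℕ D) - + 1 ≡⟨ cong (λ r → + (r +ℕ (n *ℕ n) ℕ./ D *ℕ D) - + 1) n² ⟩
      + 1 + + ((n *ℕ n) ℕ./ D *ℕ D) - + 1     ≡⟨ cancel (+ ((n *ℕ n) ℕ./ D *ℕ D)) ⟩
      + ((n *ℕ n) ℕ./ D *ℕ D)                 ≡⟨ ℤ.pos-* ((n *ℕ n) ℕ./ D) D ⟩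
      + ((n *ℕ n) ℕ./ D) * + D                ∎)
      where
      cancel : ∀ x → + 1 + x - + 1 ≡ x
      cancel = solve-∀

    SquareUnit⇒∤ : ∀ {p} → Prime p → SquareUnit D p → ¬ + p ∣ + D
    SquareUnit⇒∤ {p} pr p² p∣D = ¬prime[1] (subst Prime (ℕ.∣1⇒≡1 (∣⇒∣ᵤ p∣1)) pr)
      where
      isolate : ∀ x → x * x - (x * x - + 1) ≡ + 1
      isolate = solve-∀
      p∣1 : + p ∣ + 1
      p∣1 = subst (+ p ∣_) (isolate (+ p)) (∣m∣n⇒∣m-n (∣n⇒∣m*n (+ p) ∣-refl) (∣-trans p∣D (SquareUnit⇒∣ p p²)))

    -- With P the product of the pᵢ, D times the argument plus 1 equals P² p t for t = D (p n + j) +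
    -- p, and p divides neither D nor j, hence not t. So C (D N + 1) has odd valuation at p and is
    -- not a value of the form.
    progression : ∀ v b c C → Lacunary D v b c C → ∀ {ps p} j n → All Prime ps → All (SquareUnit D) ps →
      Prime p → SquareUnit D p → Anisotropic p b c → ¬ + p ∣ + C → ¬ + p ∣ j →
      3 ℕ.∣ Bℤ 3 v (+ (product ps *ℕ product ps *ℕ p *ℕ p) * + n
        + (+ (product ps *ℕ product ps *ℕ p) * (+ D * j + + p) - + 1) /ℕ D)
    progression v b c C lac {ps} {p} j n primes units pr p² aniso p∤C p∤j = at _ position
      where
      P = product ps
      instance _ = productOfPrimes≢0 primes
      t = + D * (+ p * + n + j) + + p
      x = + (P *ℕ P *ℕ p) * (+ D * j + + p) - + 1

      times-p : ∀ {qs} → All (SquareUnit D) qs → SquareUnit D (product qs *ℕ p)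
      times-p []                  = subst (SquareUnit D) (sym (ℕ.*-identityˡ p)) p²
      times-p (_∷_ {q} {qs} q² qs²) = subst (SquareUnit D) (sym (ℕ.*-assoc q (product qs) p))
        (SquareUnit-* q (product qs *ℕ p) q² (times-p qs²))

      p∤t : ¬ + p ∣ t
      p∤t p∣t = [ SquareUnit⇒∤ pr p² , (λ p∣pn+j → p∤j (∣m+n∣m⇒∣n {+ p} {+ p * + n} p∣pn+j (∣m⇒∣m*n (+ n) ∣-refl))) ]
        (euclid pr (+ D) (+ p * + n + j) (∣m+n∣n⇒∣m {+ p} {+ D * (+ p * + n + j)} p∣t ∣-refl))

      cast : + (P *ℕ P *ℕ p) ≡ + P * + P * + p
      cast = trans (ℤ.pos-* (P *ℕ P) p) (cong (_* + p) (ℤ.pos-* P P))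

      cast′ : + (P *ℕ P *ℕ p *ℕ p) ≡ + P * + P * + p * + p
      cast′ = trans (ℤ.pos-* (P *ℕ P *ℕ p) p) (cong (_* + p) cast)

      -- Up to a multiple of D, x is (P p)² - 1, and P p is a product of square units.
      D∣x : + D ∣ x
      D∣x = subst (+ D ∣_) (sym (trans (cong (λ z → z * (+ D * j + + p) - + 1) cast) (trans (split (+ P) (+ p) (+ D) j)
          (cong (λ z → + P * + P * + p * j * + D + (z * z - + 1)) (sym (ℤ.pos-* P p))))))
        (∣m∣n⇒∣m+n (∣n⇒∣m*n (+ P * + P * + p * j) ∣-refl) (SquareUnit⇒∣ (P *ℕ p) (times-p units)))
        where
        split : ∀ P p D j → P * P * p * (D * j + p) - + 1 ≡ P * P * p * j * D + (P * p * (P * p) - + 1)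
        split = solve-∀

      position : + D * (+ (P *ℕ P *ℕ p *ℕ p) * + n + x /ℕ D) + + 1 ≡ + P * + P * + p * t
      position = begin
        + D * (+ (P *ℕ P *ℕ p *ℕ p) * + n + x /ℕ D) + + 1       ≡⟨ distribute (+ D) (+ (P *ℕ P *ℕ p *ℕ p)) (+ n) (x /ℕ D) ⟩
        + D * (+ (P *ℕ P *ℕ p *ℕ p) * + n) + x /ℕ D * + D + + 1 ≡⟨ cong₂ (λ y z → + D * (y * + n) + z + + 1) cast′ (/ℕ-exact D x D∣x) ⟩
        + D * (+ P * + P * + p * + p * + n) + x + + 1
          ≡⟨ cong (λ z → + D * (+ P * + P * + p * + p * + n) + (z * (+ D * j + + p) - + 1) + + 1) cast ⟩
        + D * (+ P * + P * + p * + p * + n) + (+ P * + P * + p * (+ D * j + + p) - + 1) + + 1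
          ≡⟨ collect (+ D) (+ P) (+ p) (+ n) j ⟩
        + P * + P * + p * t ∎
        where
        distribute : ∀ D y n z → D * (y * n + z) + + 1 ≡ D * (y * n) + z * D + + 1
        distribute = solve-∀
        collect : ∀ D P p n j → D * (P * P * p * p * n) + (P * P * p * (D * j + p) - + 1) + + 1 ≡ P * P * p * (D * (p * n + j) + p)
        collect = solve-∀

      at : ∀ z → + D * z + + 1 ≡ + P * + P * + p * t → 3 ℕ.∣ Bℤ 3 v z
      -- A sufficiently negative j makes the argument negative, where the count is 0 by convention.
      at -[1+ _ ] _  = 3 ℕ.∣0
      at (+ N)    eq = lac N λ y z rep → odd-valuation {b = b} {c} pr aniso {+ C * t} p∤Ct P y z
        (trans rep (trans (cong (+ C *_) eq) (swap (+ C) (+ P) (+ p) t)))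
        where
        swap : ∀ C P p t → C * (P * P * p * t) ≡ P * P * p * (C * t)
        swap = solve-∀
        p∤Ct : ¬ + p ∣ + C * t
        p∤Ct p∣Ct = [ p∤C , p∤t ] (euclid pr (+ C) t p∣Ct)

-- Residue classes of the primes involved

module Residues where
  open import Data.Nat using (ℕ; NonZero; _≟_; _<_; _%_; _*_; s≤s)
  open import Data.Nat.Properties using (allUpTo?)
  open import Data.Nat.DivMod using (%-distribˡ-*; m%n<n; m∣n⇒o%n%m≡o%m)
  open import Data.Nat.Divisibility using (_∣_; _∣?_; ∣⇒≤; divides)
  open import Data.Integer using (+_)
  open import Data.Integer.Divisibility.Signed using (∣⇒∣ᵤ) renaming (_∣_ to _∣ℤ_)
  open import Data.Sum using (_⊎_; inj₁; inj₂)
  open import Relation.Nullary using (¬_)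
  open import Relation.Nullary.Decidable using (from-yes; _→-dec_; _⊎-dec_; ¬?)
  open import Relation.Binary.PropositionalEquality using (_≡_; _≢_; sym; trans)
  open Progression using (SquareUnit)

  square-residue : ∀ D .{{_ : NonZero D}} q → ((q % D) * (q % D)) % D ≡ 1 → SquareUnit D q
  square-residue D q = trans (%-distribˡ-* q q D)

  squareUnit-3 : ∀ q → q % 3 ≡ 2 → SquareUnit 3 q
  squareUnit-3 q q%3 = square-residue 3 q
    (from-yes (allUpTo? (λ r → r ≟ 2 →-dec (r * r) % 3 ≟ 1) 3) (m%n<n q 3) q%3)

  squareUnit-4 : ∀ q → q % 4 ≡ 3 → SquareUnit 4 q
  squareUnit-4 q q%4 = square-residue 4 q
    (from-yes (allUpTo? (λ r → r ≟ 3 →-dec (r * r) % 4 ≟ 1) 4) (m%n<n q 4) q%4)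

  squareUnit-8 : ∀ q → q % 2 ≡ 1 → SquareUnit 8 q
  squareUnit-8 q odd = square-residue 8 q
    (from-yes (allUpTo? (λ r → r % 2 ≟ 1 →-dec (r * r) % 8 ≟ 1) 8) (m%n<n q 8)
      (trans (m∣n⇒o%n%m≡o%m 2 8 q (divides 4 _≡_.refl)) odd))

  odd-classes : ∀ p → p % 2 ≡ 1 → p % 8 ≢ 1 → p % 4 ≡ 3 ⊎ p % 8 ≡ 5
  odd-classes p odd ≢1 with from-yes (allUpTo? (λ r → r % 2 ≟ 1 →-dec (¬? (r ≟ 1) →-dec (r % 4 ≟ 3 ⊎-dec r ≟ 5))) 8)
    (m%n<n p 8) (trans (m∣n⇒o%n%m≡o%m 2 8 p (divides 4 _≡_.refl)) odd) ≢1
  ... | inj₁ 3mod4 = inj₁ (trans (sym (m∣n⇒o%n%m≡o%m 4 8 p (divides 2 _≡_.refl))) 3mod4)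
  ... | inj₂ 5mod8 = inj₂ 5mod8

  module _ {D C r : ℕ} .{{_ : NonZero D}} .{{_ : NonZero C}} where
    -- Divisors of C are at most C, so a finite check suffices.
    non-divisor : (∀ {p} → p < ℕ.suc C → p % D ≡ r → ¬ p ∣ C) → ∀ p → p % D ≡ r → ¬ + p ∣ℤ + C
    non-divisor check p p%D p∣C = check (s≤s (∣⇒≤ (∣⇒∣ᵤ p∣C))) p%D (∣⇒∣ᵤ p∣C)

  ∤7 : ∀ p → p % 3 ≡ 2 → ¬ + p ∣ℤ + 7
  ∤7 = non-divisor (from-yes (allUpTo? (λ p → p % 3 ≟ 2 →-dec ¬? (p ∣? 7)) 8))

  ∤10 : ∀ p → p % 4 ≡ 3 → ¬ + p ∣ℤ + 10
  ∤10 = non-divisor (from-yes (allUpTo? (λ p → p % 4 ≟ 3 →-dec ¬? (p ∣? 10)) 11))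

  ∤1 : ∀ p → p % 4 ≡ 3 → ¬ + p ∣ℤ + 1
  ∤1 = non-divisor (from-yes (allUpTo? (λ p → p % 4 ≟ 3 →-dec ¬? (p ∣? 1)) 2))

  ∤3 : ∀ p → p % 8 ≡ 5 → ¬ + p ∣ℤ + 3
  ∤3 = non-divisor (from-yes (allUpTo? (λ p → p % 8 ≟ 5 →-dec ¬? (p ∣? 3)) 4))

-- The three congruences

open import Data.Nat using (ℕ; _%_) renaming (_*_ to _*ℕ_)
open import Data.Nat.Divisibility using (_∣_)
open import Data.Nat.Primality using (Prime)
open import Data.List using (List)
open import Data.Nat.ListAction using (product)
open import Data.List.Relation.Unary.All using (All)
open import Data.Integer using (ℤ; +_; _+_; _*_; _-_; _/ℕ_)
open import Data.Integer.Divisibility using () renaming (_∣_ to _∣ℤ_)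
open import Data.Product using (_×_)
open import Relation.Nullary using (¬_)
open import Relation.Binary.PropositionalEquality using (_≡_; _≢_)
open import Data.Integer.Divisibility.Signed using (∣⇒∣ᵤ)
open import Data.List.Relation.Unary.All using (map)
open import Data.Product using (_,_)
open import Data.Sum using (inj₁; [_,_])
open import Function using (_∘_)
open QuadraticForms using (no-root⇒anisotropic; no-root-3; no-root-4; no-root-8)
open Lacunarity using (lacunary-3-7; lacunary-3-5; lacunary-3-2; lacunary-3-2′)
open Progression using (progression)
open Residues

theorem1p2 : ((ps : List ℕ) (p : ℕ) (j : ℤ) (n : ℕ) →
    All Prime ps → All (λ q → q % 3 ≡ 2) ps → Prime p → p % 3 ≡ 2 → ¬ (+ p ∣ℤ j) →
    3 ∣ Bℤ 3 7 (+ (product ps *ℕ product ps *ℕ p *ℕ p) * + n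
    + (+ (product ps *ℕ product ps *ℕ p) * (+ 3 * j + + p) - + 1) /ℕ 3))
    × ((ps : List ℕ) (p : ℕ) (j : ℤ) (n : ℕ) →
    All Prime ps → All (λ q → q % 4 ≡ 3) ps → Prime p → p % 4 ≡ 3 → ¬ (+ p ∣ℤ j) →
    3 ∣ Bℤ 3 5 (+ (product ps *ℕ product ps *ℕ p *ℕ p) * + n
    + (+ (product ps *ℕ product ps *ℕ p) * (+ 4 * j + + p) - + 1) /ℕ 4))
    × ((ps : List ℕ) (p : ℕ) (j : ℤ) (n : ℕ) →
    All Prime ps → All (λ q → q % 2 ≡ 1) ps → All (λ q → q % 8 ≢ 1) ps →
    Prime p → p % 2 ≡ 1 → p % 8 ≢ 1 → ¬ (+ p ∣ℤ j) →
    3 ∣ Bℤ 3 2 (+ (product ps *ℕ product ps *ℕ p *ℕ p) * + n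
    + (+ (product ps *ℕ product ps *ℕ p) * (+ 8 * j + + p) - + 1) /ℕ 8))
theorem1p2 =
    (λ ps p j n primes residues pr p%3 p∤j →
      progression 3 7 1 1 7 lacunary-3-7 j n primes (map (λ {q} → squareUnit-3 q) residues) pr (squareUnit-3 p p%3)
        (no-root⇒anisotropic 1 1 pr (no-root-3 p p%3)) (∤7 p p%3) (p∤j ∘ ∣⇒∣ᵤ))
  , (λ ps p j n primes residues pr p%4 p∤j →
      progression 4 5 0 1 10 lacunary-3-5 j n primes (map (λ {q} → squareUnit-4 q) residues) pr (squareUnit-4 p p%4)
        (no-root⇒anisotropic 0 1 pr (no-root-4 p p%4)) (∤10 p p%4) (p∤j ∘ ∣⇒∣ᵤ))
  , (λ ps p j n primes odds _ pr odd ≢1 p∤j →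
      -- p ≡ 3, 7 (mod 8) is inert in ℚ(i), and p ≡ 5 (mod 8) is inert in ℚ(√-2).
      [ (λ p%4 → progression 8 2 0 1 1 lacunary-3-2 j n primes (map (λ {q} → squareUnit-8 q) odds) pr (squareUnit-8 p odd)
          (no-root⇒anisotropic 0 1 pr (no-root-4 p p%4)) (∤1 p p%4) (p∤j ∘ ∣⇒∣ᵤ))
      , (λ p%8 → progression 8 2 0 2 3 lacunary-3-2′ j n primes (map (λ {q} → squareUnit-8 q) odds) pr (squareUnit-8 p odd)
          (no-root⇒anisotropic 0 2 pr (no-root-8 p (inj₁ p%8))) (∤3 p p%8) (p∤j ∘ ∣⇒∣ᵤ))
      ] (odd-classes p odd ≢1))
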